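{- Let $K=\mathbb{Q}(\sqrt{d})$, where $d>1$ is square-free and $d=m^2+r$ with $m,r$ integers, $m>0$, $-m<r\le m$ and $4m\equiv 0 \pmod r$ (i.e. $K$ is of Richaud–Degert type). Suppose that either $d\equiv 2,3 \pmod 4$, or $d\equiv 1\pmod 4$ and $m$ is odd. If $K$ is not unit reducible, then $n_K=2$.
   Context: For a totally real number field $K$ with ring of integers $\mathcal{O}_K$ and unit group $\mathcal{O}_K^\times$, let $K_{>>0}$ be the set of totally positive elements. For $a\in K_{>>0}$, $\mu(a)=\min_{x\in\mathcal{O}_K\setminus\{0\}}\mathrm{Tr}_{K/\mathbb{Q}}(ax^2)$ and $\mathcal{M}(a)=\{x\in\mathcal{O}_K:\mathrm{Tr}_{K/\mathbb{Q}}(ax^2)=\mu(a)\}$. $K$ is unit reducible if $\mu(a)=\min_{u\in\mathcal{O}_K^\times}\mathrm{Tr}_{K/\mathbb{Q}}(au^2)$ for all $a\in K_{>>0}$. The unary form $ax^2$ is perfect if $a$ is the only $b\in K_{>>0}$ with $\mathrm{Tr}_{K/\mathbb{Q}}(bv^2)=\mu(a)$ for all $v\in\mathcal{M}(a)$. Forms $ax^2,bx^2$ are equivalent if $b=au^2$ for some $u\in\mathcal{O}_K^\times$, homothetic if $b=\lambda a$ with rational $\lambda>0$; $n_K$ is the number of classes of perfect unary forms up to equivalence and homothety. -}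

module Defs where

open import Data.Fin.Base using (Fin)
open import Data.Integer.Base using (ℤ; +_)
open import Data.List.Base using (List; []; _∷_)
open import Data.Nat.Base as ℕ using (ℕ)
open import Data.Nat.Divisibility using (_∣_)
open import Data.Product.Base using (Σ; ∃; ∃-syntax; _×_; proj₁)
open import Data.Rational.Base using (ℚ; 0ℚ; 1ℚ; _+_; _*_; -_; _/_; _≤_; _<_)
open import Function.Bundles using (Inverse)
open import Level using (0ℓ)
open import Relation.Binary.Bundles using (Setoid)
import Relation.Binary.Construct.Closure.Equivalence as EqClosure
import Relation.Binary.Construct.On as On
open import Relation.Binary.Construct.Union using (_∪_)
open import Relation.Binary.PropositionalEquality using (_≡_; _≢_; setoid)

SquareFree : ℕ → Set
SquareFree n = ∀ k → k ℕ.* k ∣ n → k ≡ 1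

-- ℚ(√ d); a field when d is not a square.  `p +√ q` stands for p + q √d.
-- Rationals are in lowest terms, so _≡_ is equality of field elements.
module QuadraticField (d : ℕ) where

  infix  5 _+√_
  infixl 6 _⊕_
  infixl 7 _⊗_

  record K : Set where
    constructor _+√_
    field
      re im : ℚ

  open K public

  dℚ : ℚ
  dℚ = + d / 1

  fromℚ : ℚ → K
  fromℚ p = p +√ 0ℚ

  0K 1K √d : K
  0K = fromℚ 0ℚ
  1K = fromℚ 1ℚ
  √d = 0ℚ +√ 1ℚ

  _⊕_ _⊗_ : K → K → K
  x ⊕ y = (re x + re y) +√ (im x + im y)
  x ⊗ y = (re x * re y + dℚ * (im x * im y)) +√ (re x * im y + im x * re y)

  conj : K → K
  conj x = re x +√ (- im x)

  _² : K → K
  x ² = x ⊗ x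

  -- Trace over ℚ of multiplication by x, in the basis 1, √d.
  Tr : K → ℚ
  Tr x = re (x ⊗ 1K) + im (x ⊗ √d)

  -- Value at x of the monic polynomial c₀ + c₁ X + ⋯ + cₙ₋₁ Xⁿ⁻¹ + Xⁿ,
  -- where n is the length of the list c₀ ∷ c₁ ∷ ⋯ ∷ cₙ₋₁ ∷ [].
  evalMonic : List ℤ → K → K
  evalMonic []       x = 1K
  evalMonic (c ∷ cs) x = fromℚ (c / 1) ⊕ x ⊗ evalMonic cs x

  Integral : K → Set
  Integral x = ∃[ cs ] evalMonic cs x ≡ 0K

  NonZeroIntegral : K → Set
  NonZeroIntegral x = Integral x × x ≢ 0K

  Unit : K → Set
  Unit u = Integral u × (∃[ v ] Integral v × u ⊗ v ≡ 1K)

  -- The real number p + q √d, √d the positive root, is positive: the affine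
  -- function t ↦ p + q t is positive at both ends of some rational interval
  -- around √d.  (For d = 0 no such interval has l ≥ 0; only d > 0 is of interest.)
  Positive : K → Set
  Positive x = ∃[ l ] ∃[ u ]
      (0ℚ ≤ l × l * l < dℚ)
    × (0ℚ ≤ u × dℚ < u * u)
    × 0ℚ < re x + im x * l
    × 0ℚ < re x + im x * u

  -- The two real embeddings send √d to the positive and to the negative root.
  TotallyPositive : K → Set
  TotallyPositive x = Positive x × Positive (conj x)

  IsMinimum : (K → Set) → (K → ℚ) → ℚ → Set
  IsMinimum S f m = (∃[ x ] S x × f x ≡ m) × (∀ x → S x → m ≤ f x)

  -- The unary form a x², composed with the trace.
  trForm : K → K → ℚ
  trForm a x = Tr (a ⊗ x ²)

  -- `Isμ a m` says μ(a) = m.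
  Isμ : K → ℚ → Set
  Isμ a = IsMinimum NonZeroIntegral (trForm a)

  -- The set ℳ(a) of minimal vectors.
  ℳ : K → K → Set
  ℳ a x = Integral x × Isμ a (trForm a x)

  UnitReducible : Set
  UnitReducible = ∀ a → TotallyPositive a →
    ∃[ m ] Isμ a m × IsMinimum Unit (trForm a) m

  Perfect : K → Set
  Perfect a = TotallyPositive a × (∃[ m ] Isμ a m ×
    (∀ b → TotallyPositive b → (∀ v → ℳ a v → trForm b v ≡ m) → b ≡ a))

  Equivalent : K → K → Set
  Equivalent a b = ∃[ u ] Unit u × b ≡ a ⊗ u ²

  Homothetic : K → K → Set
  Homothetic a b = ∃[ r ] 0ℚ < r × b ≡ fromℚ r ⊗ a

  -- Perfect unary forms, identified when related by the equivalence relation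
  -- generated by equivalence and homothety.
  PerfectForms : Setoid 0ℓ 0ℓ
  PerfectForms = On.setoid {B = Σ K Perfect}
    (EqClosure.setoid (Equivalent ∪ Homothetic)) proj₁

  -- `nK-is n` says n_K = n.
  nK-is : ℕ → Set
  nK-is n = Inverse PerfectForms (setoid (Fin n))

module Submission where

-- In both cases 𝒪_K = ℤ[ξ] with ξ² = T ξ + n and n ∣ T: for d ≡ 2, 3 (mod 4) take
-- ξ = m + √d, T = 2m, n = r, and for d ≡ 1 (mod 4) take ξ = (m + √d) / 2, T = m, n = r / 4.
-- Then ε = ξ² / n is a unit of norm 1.  As a binary quadratic form in the coordinates
-- of x, the form Tr(a x²) is determined by Tr a and Tr (a ξ).
--
-- The bounds on r say that the form P₁ taking equal values at 1 and ξ is reduced, so its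
-- minimum is attained there, and that of its conjugate P₂ is attained at 1 and conj ξ.
-- Since ε maps conj ξ to −ξ, the unit translates of the cones spanned by
-- P₁, P₂ and by P₁, P₂ ε⁻² cover all totally positive a: a descent on Tr (a u²) over the
-- units u finds the cone containing a.  The minimum of a form inside a cone is attained at the
-- vector shared by the two ends (1 or ξ), so a perfect form lies on an end, and every
-- perfect form is a multiple of a unit translate of P₁ or P₂.
--
-- If ξ is a unit, this shows that K is unit reducible.  Otherwise the only units
-- among the minimal vectors of P₁ are ±1, so an equivalence between P₁ and P₂ would give P₁ = P₂.

-- The condition `n ∣ T` is what puts `ξ² / n = 1 + (T / n) ξ` into the order. The norm of ξ is -n,
-- so ξ is a unit exactly when n = ±1, and this is the dichotomy of the proof. The space of forms is
-- two-dimensional, so lying in a cone with two edges amounts to two inequalities between values of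
-- the trace form at lattice vectors. Hence it is enough that the reduction compares Tr (a u²) with
-- its values at the two neighbours u ε and u ε⁻¹. No real embedding is used: total positivity
-- becomes `re a > 0` and `norm a > 0`, and since all values Tr (a u²) share one denominator, the
-- descent runs over natural numbers instead of appealing to compactness. `Integral` admits monic
-- polynomials of every degree, so the identification of 𝒪_K with ℤ[ξ] is part of the work. It rests
-- on the fact that the powers of the norms of z and z + 1 have bounded denominators.

module TraceForms where

  open import Data.Empty using (⊥; ⊥-elim)
  open import Data.Fin.Base using (Fin; zero; suc)
  open import Data.Integer.Base as ℤ using (ℤ; +_; -[1+_])
  import Data.Integer.Properties as ℤ
  import Data.Integer.Tactic.RingSolver as ℤ
  open import Data.List.Base using (List; []; _∷_; length)
  open import Data.Maybe.Base using (Maybe; just; nothing)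
  open import Data.Nat.Base as ℕ using (ℕ; zero; suc)
  open import Data.Nat.Coprimality as Coprime using (Coprime; coprime-divisor)
  open import Data.Nat.Divisibility as ∣ using (_∣_; divides)
  open import Data.Nat.Induction using (<-wellFounded)
  import Data.Nat.Properties as ℕ
  import Data.Nat.Tactic.RingSolver as ℕ
  open import Data.Product.Base using (∃-syntax; _×_; _,_; proj₁; proj₂)
  open import Data.Rational.Base as ℚ using (ℚ; mkℚ; 0ℚ; 1ℚ; _+_; _*_; -_; _-_; _/_; _≤_; _<_; toℚᵘ)
  import Data.Rational.Properties as ℚ
  import Data.Rational.Unnormalised.Base as ℚᵘ
  import Data.Rational.Unnormalised.Properties as ℚᵘ
  open import Data.Sum.Base using (_⊎_; inj₁; inj₂; [_,_]′)
  open import Data.Vec.Base as Vec using (Vec; []; _∷_)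
  open import Function.Base using (_$_)
  open import Induction.WellFounded using (Acc; acc)
  open import Level using (0ℓ)
  open import Relation.Binary.Construct.Closure.Equivalence as EqClosure using (EqClosure)
  open import Relation.Binary.Construct.Union using (_∪_)
  open import Relation.Binary.Definitions using (Tri; tri<; tri≈; tri>)
  open import Relation.Binary.PropositionalEquality
  open import Relation.Binary.Structures using (IsEquivalence)
  open import Relation.Nullary using (¬_; Dec; yes; no; contradiction)
  open import Tactic.RingSolver using (solve-∀)
  open import Tactic.RingSolver.Core.AlmostCommutativeRing using (AlmostCommutativeRing; fromCommutativeRing)
  open import Defs

  -- Rational and integer arithmetic

  ℚ-ring : AlmostCommutativeRing 0ℓ 0ℓ
  ℚ-ring = fromCommutativeRing ℚ.+-*-commutativeRing isZero
    where
    isZero : ∀ x → Maybe (0ℚ ≡ x)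
    isZero x with 0ℚ ℚ.≟ x
    ... | yes 0≡x = just 0≡x
    ... | no  _   = nothing

  -- Opaque, since conversion checking would otherwise unfold the gcd in _/_.
  opaque
    ι : ℤ → ℚ
    ι i = i / 1

    ι≡ : ∀ i → ι i ≡ i / 1
    ι≡ i = refl

    ι-0 : ι (+ 0) ≡ 0ℚ
    ι-0 = refl

    ι-1 : ι (+ 1) ≡ 1ℚ
    ι-1 = refl

    toℚᵘ-ι : ∀ i → toℚᵘ (ι i) ℚᵘ.≃ ℚᵘ.mkℚᵘ i 0
    toℚᵘ-ι i = ℚ.toℚᵘ-fromℚᵘ (ℚᵘ.mkℚᵘ i 0)

    ι-injective : ∀ {i j} → ι i ≡ ι j → i ≡ j
    ι-injective {i} {j} eq
      with ℚᵘ.*≡* e ← ℚ.fromℚᵘ-injective {ℚᵘ.mkℚᵘ i 0} {ℚᵘ.mkℚᵘ j 0} eq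
      = trans (sym (ℤ.*-identityʳ i)) (trans e (ℤ.*-identityʳ j))

    ι-+ : ∀ i j → ι (i ℤ.+ j) ≡ ι i + ι j
    ι-+ i j = ℚ.toℚᵘ-injective (begin
      toℚᵘ (ι (i ℤ.+ j))             ≈⟨ toℚᵘ-ι (i ℤ.+ j) ⟩
      ℚᵘ.mkℚᵘ (i ℤ.+ j) 0            ≈⟨ ℚᵘ.*≡* (cong (ℤ._* + 1) (cong₂ ℤ._+_ (sym (ℤ.*-identityʳ i)) (sym (ℤ.*-identityʳ j)))) ⟩
      ℚᵘ.mkℚᵘ i 0 ℚᵘ.+ ℚᵘ.mkℚᵘ j 0  ≈⟨ ℚᵘ.+-cong (toℚᵘ-ι i) (toℚᵘ-ι j) ⟨
      toℚᵘ (ι i) ℚᵘ.+ toℚᵘ (ι j)     ≈⟨ ℚ.toℚᵘ-homo-+ (ι i) (ι j) ⟨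
      toℚᵘ (ι i + ι j)               ∎)
      where open ℚᵘ.≃-Reasoning

    ι-* : ∀ i j → ι (i ℤ.* j) ≡ ι i * ι j
    ι-* i j = ℚ.toℚᵘ-injective (begin
      toℚᵘ (ι (i ℤ.* j))             ≈⟨ toℚᵘ-ι (i ℤ.* j) ⟩
      ℚᵘ.mkℚᵘ i 0 ℚᵘ.* ℚᵘ.mkℚᵘ j 0  ≈⟨ ℚᵘ.*-cong (toℚᵘ-ι i) (toℚᵘ-ι j) ⟨
      toℚᵘ (ι i) ℚᵘ.* toℚᵘ (ι j)     ≈⟨ ℚ.toℚᵘ-homo-* (ι i) (ι j) ⟨
      toℚᵘ (ι i * ι j)               ∎)
      where open ℚᵘ.≃-Reasoning

    ι-neg : ∀ i → ι (ℤ.- i) ≡ - ι i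
    ι-neg i = ℚ.toℚᵘ-injective (begin
      toℚᵘ (ι (ℤ.- i))       ≈⟨ toℚᵘ-ι (ℤ.- i) ⟩
      ℚᵘ.- ℚᵘ.mkℚᵘ i 0       ≈⟨ ℚᵘ.-‿cong (toℚᵘ-ι i) ⟨
      ℚᵘ.- toℚᵘ (ι i)        ≈⟨ ℚ.toℚᵘ-homo‿- (ι i) ⟨
      toℚᵘ (- ι i)           ∎)
      where open ℚᵘ.≃-Reasoning

    ι-mono-≤ : ∀ {i j} → i ℤ.≤ j → ι i ≤ ι j
    ι-mono-≤ {i} {j} i≤j = ℚ.toℚᵘ-cancel-≤ (begin
      toℚᵘ (ι i)   ≃⟨ toℚᵘ-ι i ⟩
      ℚᵘ.mkℚᵘ i 0  ≤⟨ ℚᵘ.*≤* (ℤ.*-monoʳ-≤-nonNeg (+ 1) i≤j) ⟩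
      ℚᵘ.mkℚᵘ j 0  ≃⟨ toℚᵘ-ι j ⟨
      toℚᵘ (ι j)   ∎)
      where open ℚᵘ.≤-Reasoning

    ι-mono-< : ∀ {i j} → i ℤ.< j → ι i < ι j
    ι-mono-< {i} {j} i<j = ℚ.toℚᵘ-cancel-< (begin-strict
      toℚᵘ (ι i)   ≃⟨ toℚᵘ-ι i ⟩
      ℚᵘ.mkℚᵘ i 0  <⟨ ℚᵘ.*<* (ℤ.*-monoʳ-<-pos (+ 1) i<j) ⟩
      ℚᵘ.mkℚᵘ j 0  ≃⟨ toℚᵘ-ι j ⟨
      toℚᵘ (ι j)   ∎)
      where open ℚᵘ.≤-Reasoning

    ι-cancel-≤ : ∀ {i j} → ι i ≤ ι j → i ℤ.≤ j
    ι-cancel-≤ {i} {j} p with i ℤ.≤? j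
    ... | yes i≤j = i≤j
    ... | no  i≰j = contradiction (ℚ.<-≤-trans (ι-mono-< (ℤ.≰⇒> i≰j)) p) (ℚ.<-irrefl refl)

    ι-cancel-< : ∀ {i j} → ι i < ι j → i ℤ.< j
    ι-cancel-< {i} {j} p with i ℤ.<? j
    ... | yes i<j = i<j
    ... | no  i≮j = contradiction (ℚ.<-≤-trans p (ι-mono-≤ (ℤ.≮⇒≥ i≮j))) (ℚ.<-irrefl refl)

    ↧*p≡↥p : ∀ p → ι (ℚ.↧ p) * p ≡ ι (ℚ.↥ p)
    ↧*p≡↥p p@(mkℚ i k _) = ℚ.toℚᵘ-injective (begin
      toℚᵘ (ι (+ suc k) * p)               ≈⟨ ℚ.toℚᵘ-homo-* (ι (+ suc k)) p ⟩
      toℚᵘ (ι (+ suc k)) ℚᵘ.* toℚᵘ p       ≈⟨ ℚᵘ.*-congʳ (toℚᵘ-ι (+ suc k)) ⟩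
      ℚᵘ.mkℚᵘ (+ suc k) 0 ℚᵘ.* ℚᵘ.mkℚᵘ i k ≈⟨ ℚᵘ.*≡* (trans (ℤ.*-identityʳ _) (trans (ℤ.*-comm (+ suc k) i) (cong (λ t → i ℤ.* + suc t) (sym (ℕ.+-identityʳ k))))) ⟩
      ℚᵘ.mkℚᵘ i 0                          ≈⟨ toℚᵘ-ι i ⟨
      toℚᵘ (ι i)                           ∎)
      where open ℚᵘ.≃-Reasoning

  clear-denominator : ∀ p → ∃[ k ] ∃[ i ] ι (+ suc k) * p ≡ ι i
  clear-denominator p@(mkℚ i k _) = k , i , ↧*p≡↥p p

  ι-- : ∀ i j → ι (i ℤ.- j) ≡ ι i - ι j
  ι-- i j = trans (ι-+ i (ℤ.- j)) (cong (ι i ℚ.+_) (ι-neg j))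

  ≤-by-diff : ∀ {p q e} → q - p ≡ e → 0ℚ ≤ e → p ≤ q
  ≤-by-diff {p} {q} refl 0≤e =
    subst₂ _≤_ (ℚ.+-identityˡ p) (lem p q) (ℚ.+-monoˡ-≤ p 0≤e)
    where
    lem : ∀ p q → (q - p) + p ≡ q
    lem = solve-∀ ℚ-ring

  <-by-diff : ∀ {p q e} → q - p ≡ e → 0ℚ < e → p < q
  <-by-diff {p} {q} refl 0<e =
    subst₂ _<_ (ℚ.+-identityˡ p) (lem p q) (ℚ.+-monoˡ-< p 0<e)
    where
    lem : ∀ p q → (q - p) + p ≡ q
    lem = solve-∀ ℚ-ring

  0≤diff : ∀ {p q} → p ≤ q → 0ℚ ≤ q - p
  0≤diff {p} {q} p≤q = subst (_≤ q - p) (ℚ.+-inverseʳ p) (ℚ.+-monoˡ-≤ (- p) p≤q)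

  0<diff : ∀ {p q} → p < q → 0ℚ < q - p
  0<diff {p} {q} p<q = subst (_< q - p) (ℚ.+-inverseʳ p) (ℚ.+-monoˡ-< (- p) p<q)

  0≤+ : ∀ {p q} → 0ℚ ≤ p → 0ℚ ≤ q → 0ℚ ≤ p + q
  0≤+ 0≤p 0≤q = ℚ.+-mono-≤ 0≤p 0≤q

  0<+ : ∀ {p q} → 0ℚ < p → 0ℚ ≤ q → 0ℚ < p + q
  0<+ 0<p 0≤q = ℚ.+-mono-<-≤ 0<p 0≤q

  0≤* : ∀ {p q} → 0ℚ ≤ p → 0ℚ ≤ q → 0ℚ ≤ p * q
  0≤* {p} {q} 0≤p 0≤q = ℚ.nonNegative⁻¹ (p * q) {{ℚ.nonNeg*nonNeg⇒nonNeg p {{ℚ.nonNegative 0≤p}} q {{ℚ.nonNegative 0≤q}}}}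

  0<* : ∀ {p q} → 0ℚ < p → 0ℚ < q → 0ℚ < p * q
  0<* {p} {q} 0<p 0<q = ℚ.positive⁻¹ (p * q) {{ℚ.pos*pos⇒pos p {{ℚ.positive 0<p}} q {{ℚ.positive 0<q}}}}

  0≤² : ∀ p → 0ℚ ≤ p * p
  0≤² p with ℚ.≤-total 0ℚ p
  ... | inj₁ 0≤p = 0≤* 0≤p 0≤p
  ... | inj₂ p≤0 = subst (0ℚ ≤_) (lem p) (0≤* (0≤diff p≤0) (0≤diff p≤0))
    where
    lem : ∀ p → (0ℚ - p) * (0ℚ - p) ≡ p * p
    lem = solve-∀ ℚ-ring

  *-monoˡ-≤ : ∀ {r p q} → 0ℚ ≤ r → p ≤ q → r * p ≤ r * q
  *-monoˡ-≤ {r} 0≤r = ℚ.*-monoˡ-≤-nonNeg r {{ℚ.nonNegative 0≤r}}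

  *-cancelˡ-≤ : ∀ {r p q} → 0ℚ < r → r * p ≤ r * q → p ≤ q
  *-cancelˡ-≤ {r} 0<r = ℚ.*-cancelˡ-≤-pos r {{ℚ.positive 0<r}}

  *-cancelˡ-< : ∀ {r p q} → 0ℚ < r → r * p < r * q → p < q
  *-cancelˡ-< {r} 0<r = ℚ.*-cancelˡ-<-nonNeg r {{ℚ.nonNegative (ℚ.<⇒≤ 0<r)}}

  *-monoˡ-< : ∀ {r p q} → 0ℚ < r → p < q → r * p < r * q
  *-monoˡ-< {r} 0<r = ℚ.*-monoʳ-<-pos r {{ℚ.positive 0<r}}

  *-cancelˡ-≡ : ∀ {r p q} → 0ℚ < r → r * p ≡ r * q → p ≡ q
  *-cancelˡ-≡ 0<r eq = ℚ.≤-antisym (*-cancelˡ-≤ 0<r (ℚ.≤-reflexive eq)) (*-cancelˡ-≤ 0<r (ℚ.≤-reflexive (sym eq)))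

  pos-inverse : ∀ {p} → 0ℚ < p → ∃[ q ] 0ℚ < q × q * p ≡ 1ℚ
  pos-inverse {p} 0<p = ℚ.1/_ p {{p≢0}} , ℚ.positive⁻¹ _ {{ℚ.1/pos⇒pos p {{ℚ.positive 0<p}}}} , ℚ.*-inverseˡ p {{p≢0}}
    where p≢0 = ℚ.>-nonZero 0<p

  -- Integral closure

  coprime∣^⇒∣ : ∀ {b a} j m → Coprime b a → b ∣ m ℕ.* a ℕ.^ j → b ∣ m
  coprime∣^⇒∣ zero m c b∣ = subst (_ ∣_) (ℕ.*-identityʳ m) b∣
  coprime∣^⇒∣ {b} {a} (suc j) m c b∣ =
    coprime∣^⇒∣ j m c (coprime-divisor c (subst (b ∣_) (lem m a (a ℕ.^ j)) b∣))
    where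
    lem : ∀ m a p → m ℕ.* (a ℕ.* p) ≡ a ℕ.* (m ℕ.* p)
    lem = ℕ.solve-∀

  -- One factor `b` is removed at a time: `b` divides `m`, say `m = q b`, and cancelling it leaves
  -- the same claim for `q` with `j` lowered. The exponent `k` of `a` is independent of `j`, so it
  -- stays put.
  coprime⇒^∣^⇒^∣ : ∀ {b a} .{{_ : ℕ.NonZero b}} j k m → Coprime b a → b ℕ.^ j ∣ m ℕ.* a ℕ.^ k → b ℕ.^ j ∣ m
  coprime⇒^∣^⇒^∣ zero k m c _ = ∣.1∣ m
  coprime⇒^∣^⇒^∣ {b} {a} (suc j) k m c h
    with divides q refl ← coprime∣^⇒∣ k m c (∣.m*n∣⇒m∣ b (b ℕ.^ j) h) =
    subst (_∣ q ℕ.* b) (ℕ.*-comm (b ℕ.^ j) b) (∣.*-monoˡ-∣ b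
      (coprime⇒^∣^⇒^∣ j k q c (∣.*-cancelˡ-∣ b (subst (b ℕ.* b ℕ.^ j ∣_) (lem q b (a ℕ.^ k)) h))))
    where
    lem : ∀ q b p → q ℕ.* b ℕ.* p ≡ b ℕ.* (q ℕ.* p)
    lem = ℕ.solve-∀

  _^ℚ_ : ℚ → ℕ → ℚ
  p ^ℚ zero  = 1ℚ
  p ^ℚ suc j = p * p ^ℚ j

  ι-^ : ∀ i j → ι (i ℤ.^ j) ≡ ι i ^ℚ j
  ι-^ i zero    = ι-1
  ι-^ i (suc j) = trans (ι-* i (i ℤ.^ j)) (cong (ι i *_) (ι-^ i j))

  ^ℚ-* : ∀ p q j → (p * q) ^ℚ j ≡ p ^ℚ j * q ^ℚ j
  ^ℚ-* p q zero    = refl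
  ^ℚ-* p q (suc j) rewrite ^ℚ-* p q j = lem p q (p ^ℚ j) (q ^ℚ j)
    where
    lem : ∀ p q x y → p * q * (x * y) ≡ p * x * (q * y)
    lem = solve-∀ ℚ-ring

  ∣i^j∣ : ∀ i j → ℤ.∣ i ℤ.^ j ∣ ≡ ℤ.∣ i ∣ ℕ.^ j
  ∣i^j∣ i zero    = refl
  ∣i^j∣ i (suc j) = trans (ℤ.abs-* i (i ℤ.^ j)) (cong (ℤ.∣ i ∣ ℕ.*_) (∣i^j∣ i j))

  n<2^n : ∀ n → n ℕ.< 2 ℕ.^ n
  n<2^n zero    = ℕ.s≤s ℕ.z≤n
  n<2^n (suc n) = ℕ.≤-trans (ℕ.+-mono-≤ (ℕ.m^n>0 2 n) (n<2^n n))
    (ℕ.+-monoʳ-≤ (2 ℕ.^ n) (ℕ.m≤m+n (2 ℕ.^ n) 0))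


  1+e^m≤m⇒e≡0 : ∀ e m → suc e ℕ.^ m ℕ.≤ m → e ≡ 0
  1+e^m≤m⇒e≡0 zero    m _ = refl
  1+e^m≤m⇒e≡0 (suc e) m h = contradiction
    (ℕ.≤-trans (ℕ.≤-trans (n<2^n m) (ℕ.^-monoˡ-≤ m (ℕ.s≤s (ℕ.s≤s ℕ.z≤n)))) h)
    (ℕ.<-irrefl refl)

  -- The single exponent `j = m` suffices: if `b` is the reduced denominator of `q`, then `b ^ m`
  -- divides `m`, and `m < 2 ^ m` forces `b = 1`.
  almost-integral⇒integer : ∀ m .{{_ : ℕ.NonZero m}} q →
    (∀ j → ∃[ a ] ι (+ m) * q ^ℚ j ≡ ι a) → ∃[ z ] q ≡ ι z
  almost-integral⇒integer m q@(mkℚ i e c) h = i , (begin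
    q               ≡⟨ trans (lem q) (cong (_* q) (sym ι-1)) ⟩
    ι (+ 1) * q     ≡⟨ cong (λ t → ι (+ suc t) * q) e≡0 ⟨
    ι (+ suc e) * q ≡⟨ ↧*p≡↥p q ⟩
    ι i             ∎)
    where
    open ≡-Reasoning
    lem : ∀ q → q ≡ 1ℚ * q
    lem = solve-∀ ℚ-ring
    lem₂ : ∀ b q m → b * (m * q) ≡ m * (b * q)
    lem₂ = solve-∀ ℚ-ring
    b : ℕ
    b = suc e
    a : ℤ
    a = proj₁ (h m)
    eq : (+ b) ℤ.^ m ℤ.* a ≡ + m ℤ.* i ℤ.^ m
    eq = ι-injective (begin
      ι ((+ b) ℤ.^ m ℤ.* a)               ≡⟨ ι-* ((+ b) ℤ.^ m) a ⟩
      ι ((+ b) ℤ.^ m) * ι a               ≡⟨ cong₂ _*_ (ι-^ (+ b) m) (sym (proj₂ (h m))) ⟩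
      ι (+ b) ^ℚ m * (ι (+ m) * q ^ℚ m) ≡⟨ lem₂ (ι (+ b) ^ℚ m) (q ^ℚ m) (ι (+ m)) ⟩
      ι (+ m) * (ι (+ b) ^ℚ m * q ^ℚ m) ≡⟨ cong (ι (+ m) *_) (^ℚ-* (ι (+ b)) q m) ⟨
      ι (+ m) * (ι (+ b) * q) ^ℚ m      ≡⟨ cong (λ t → ι (+ m) * t ^ℚ m) (↧*p≡↥p q) ⟩
      ι (+ m) * ι i ^ℚ m                ≡⟨ cong (ι (+ m) *_) (ι-^ i m) ⟨
      ι (+ m) * ι (i ℤ.^ m)             ≡⟨ ι-* (+ m) (i ℤ.^ m) ⟨
      ι (+ m ℤ.* i ℤ.^ m)               ∎)
    b^m∣m*i^m : b ℕ.^ m ∣ m ℕ.* ℤ.∣ i ∣ ℕ.^ m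
    b^m∣m*i^m = divides ℤ.∣ a ∣ (begin
      m ℕ.* ℤ.∣ i ∣ ℕ.^ m        ≡⟨ cong (m ℕ.*_) (∣i^j∣ i m) ⟨
      m ℕ.* ℤ.∣ i ℤ.^ m ∣        ≡⟨ ℤ.abs-* (+ m) (i ℤ.^ m) ⟨
      ℤ.∣ + m ℤ.* i ℤ.^ m ∣      ≡⟨ cong ℤ.∣_∣ eq ⟨
      ℤ.∣ (+ b) ℤ.^ m ℤ.* a ∣      ≡⟨ ℤ.abs-* ((+ b) ℤ.^ m) a ⟩
      ℤ.∣ (+ b) ℤ.^ m ∣ ℕ.* ℤ.∣ a ∣ ≡⟨ cong (ℕ._* ℤ.∣ a ∣) (∣i^j∣ (+ b) m) ⟩
      b ℕ.^ m ℕ.* ℤ.∣ a ∣        ≡⟨ ℕ.*-comm (b ℕ.^ m) ℤ.∣ a ∣ ⟩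
      ℤ.∣ a ∣ ℕ.* b ℕ.^ m        ∎)
    b^m≤m : b ℕ.^ m ℕ.≤ m
    b^m≤m = ∣.∣⇒≤ (coprime⇒^∣^⇒^∣ m m m (Coprime.sym (Coprime.recompute c)) b^m∣m*i^m)
    e≡0 : e ≡ 0
    e≡0 = 1+e^m≤m⇒e≡0 e m b^m≤m

  -- If `b` is the reduced denominator of `q`, then `b²` divides `d i²` with `b` and `i` coprime,
  -- hence `b² ∣ d`.
  integral-square⇒integer : ∀ d → SquareFree d → ∀ q k → ι (+ d) * (q * q) ≡ ι k → ∃[ z ] q ≡ ι z
  integral-square⇒integer d sf q@(mkℚ i e c) k h = i , (begin
    q               ≡⟨ trans (lem q) (cong (_* q) (sym ι-1)) ⟩
    ι (+ 1) * q     ≡⟨ cong (λ t → ι (+ t) * q) b≡1 ⟨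
    ι (+ suc e) * q ≡⟨ ↧*p≡↥p q ⟩
    ι i             ∎)
    where
    open ≡-Reasoning
    lem : ∀ q → q ≡ 1ℚ * q
    lem = solve-∀ ℚ-ring
    lem₂ : ∀ b q d → (b * b) * (d * (q * q)) ≡ d * ((b * q) * (b * q))
    lem₂ = solve-∀ ℚ-ring
    b : ℕ
    b = suc e
    eq : + b ℤ.* + b ℤ.* k ≡ + d ℤ.* (i ℤ.* i)
    eq = ι-injective (begin
      ι (+ b ℤ.* + b ℤ.* k)                     ≡⟨ trans (ι-* (+ b ℤ.* + b) k) (cong (_* ι k) (ι-* (+ b) (+ b))) ⟩
      (ι (+ b) * ι (+ b)) * ι k                 ≡⟨ cong (ι (+ b) * ι (+ b) *_) h ⟨
      (ι (+ b) * ι (+ b)) * (ι (+ d) * (q * q)) ≡⟨ lem₂ (ι (+ b)) q (ι (+ d)) ⟩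
      ι (+ d) * ((ι (+ b) * q) * (ι (+ b) * q)) ≡⟨ cong (λ t → ι (+ d) * (t * t)) (↧*p≡↥p q) ⟩
      ι (+ d) * (ι i * ι i)                     ≡⟨ cong (ι (+ d) *_) (ι-* i i) ⟨
      ι (+ d) * ι (i ℤ.* i)                     ≡⟨ ι-* (+ d) (i ℤ.* i) ⟨
      ι (+ d ℤ.* (i ℤ.* i))                     ∎)
    sq : ∀ x → x ℕ.^ 2 ≡ x ℕ.* x
    sq x = cong (x ℕ.*_) (ℕ.*-identityʳ x)
    b²∣ : b ℕ.^ 2 ∣ d ℕ.* ℤ.∣ i ∣ ℕ.^ 2
    b²∣ = divides ℤ.∣ k ∣ (begin
      d ℕ.* ℤ.∣ i ∣ ℕ.^ 2           ≡⟨ cong (d ℕ.*_) (sq ℤ.∣ i ∣) ⟩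
      d ℕ.* (ℤ.∣ i ∣ ℕ.* ℤ.∣ i ∣)   ≡⟨ cong (d ℕ.*_) (ℤ.abs-* i i) ⟨
      d ℕ.* ℤ.∣ i ℤ.* i ∣           ≡⟨ ℤ.abs-* (+ d) (i ℤ.* i) ⟨
      ℤ.∣ + d ℤ.* (i ℤ.* i) ∣       ≡⟨ cong ℤ.∣_∣ eq ⟨
      ℤ.∣ + b ℤ.* + b ℤ.* k ∣       ≡⟨ ℤ.abs-* (+ b ℤ.* + b) k ⟩
      b ℕ.* b ℕ.* ℤ.∣ k ∣           ≡⟨ ℕ.*-comm (b ℕ.* b) ℤ.∣ k ∣ ⟩
      ℤ.∣ k ∣ ℕ.* (b ℕ.* b)         ≡⟨ cong (ℤ.∣ k ∣ ℕ.*_) (sq b) ⟨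
      ℤ.∣ k ∣ ℕ.* b ℕ.^ 2           ∎)
    b≡1 : b ≡ 1
    b≡1 = sf b (subst (_∣ d) (sq b) (coprime⇒^∣^⇒^∣ 2 2 d (Coprime.sym (Coprime.recompute c)) b²∣))

  module IntegralClosure (d : ℕ) where

    open QuadraticField d

    norm : K → ℚ
    norm z = re z * re z - dℚ * (im z * im z)

    norm-⊗ : ∀ z w → norm (z ⊗ w) ≡ norm z * norm w
    norm-⊗ (a +√ b) (c +√ e) = lem a b c e dℚ
      where
      lem : ∀ a b c e D → (a * c + D * (b * e)) * (a * c + D * (b * e)) - D * ((a * e + b * c) * (a * e + b * c))
        ≡ (a * a - D * (b * b)) * (c * c - D * (e * e))
      lem = solve-∀ ℚ-ring

    dℚ*ι : ∀ i → dℚ * ι i ≡ ι (+ d ℤ.* i)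
    dℚ*ι i = trans (cong (_* ι i) (sym (ι≡ (+ d)))) (sym (ι-* (+ d) i))

    -- With the length `k` fixed, the values `eval v z` form the ℤ-span of 1, z, ..., z^(k-1).
    eval : ∀ {k} → Vec ℤ k → K → K
    eval []      z = 0K
    eval (c ∷ v) z = fromℚ (ι c) ⊕ z ⊗ eval v z

    -- Division with remainder by a monic polynomial. The dividend is only one coefficient too long,
    -- so the quotient is a constant `l`. The quotient found for the tail serves the whole list, and
    -- the constant coefficient is corrected by `- l c`.
    eval-reduce : ∀ cs z (v : Vec ℤ (suc (length cs))) →
      ∃[ w ] ∃[ l ] eval v z ≡ eval {length cs} w z ⊕ fromℚ (ι l) ⊗ evalMonic cs z
    eval-reduce [] z (l ∷ []) = [] , l , cong₂ _+√_ (lem-re (ι l) (re z) (im z) dℚ) (lem-im (ι l) (re z) (im z))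
      where
      lem-re : ∀ l p q D → l + (p * 0ℚ + D * (q * 0ℚ)) ≡ 0ℚ + (l * 1ℚ + D * (0ℚ * 0ℚ))
      lem-re = solve-∀ ℚ-ring
      lem-im : ∀ l p q → 0ℚ + (p * 0ℚ + q * 0ℚ) ≡ 0ℚ + (l * 0ℚ + 0ℚ * 1ℚ)
      lem-im = solve-∀ ℚ-ring
    eval-reduce (c ∷ cs) z (v₀ ∷ v) with w , l , eq ← eval-reduce cs z v =
      (v₀ ℤ.- l ℤ.* c) ∷ w , l , cong₂ _+√_
        (trans (cong (λ t → ι v₀ + (re z * re t + dℚ * (im z * im t))) eq)
          (trans (lem-re (ι v₀) (ι l) (c / 1) (re z) (im z) dℚ (re W) (im W) (re E) (im E))
            (cong (λ t → t + _ + _) (sym v₀-lc))))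
        (trans (cong (λ t → 0ℚ + (re z * im t + im z * re t)) eq)
          (lem-im (ι l) (c / 1) (re z) (im z) dℚ (re W) (im W) (re E) (im E)))
      where
      W = eval w z
      E = evalMonic cs z
      v₀-lc : ι (v₀ ℤ.- l ℤ.* c) ≡ ι v₀ - ι l * (c / 1)
      v₀-lc = trans (ι-- v₀ (l ℤ.* c)) (cong (λ t → ι v₀ - t) (trans (ι-* l c) (cong (ι l *_) (ι≡ c))))
      lem-re : ∀ v l c p q D w₁ w₂ e₁ e₂ →
        v + (p * (w₁ + (l * e₁ + D * (0ℚ * e₂))) + D * (q * (w₂ + (l * e₂ + 0ℚ * e₁))))
        ≡ (v - l * c) + (p * w₁ + D * (q * w₂)) + (l * (c + (p * e₁ + D * (q * e₂))) + D * (0ℚ * (0ℚ + (p * e₂ + q * e₁))))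
      lem-re = solve-∀ ℚ-ring
      lem-im : ∀ l c p q D w₁ w₂ e₁ e₂ →
        0ℚ + (p * (w₂ + (l * e₂ + 0ℚ * e₁)) + q * (w₁ + (l * e₁ + D * (0ℚ * e₂))))
        ≡ 0ℚ + (p * w₂ + q * w₁) + (l * (0ℚ + (p * e₂ + q * e₁)) + 0ℚ * (c + (p * e₁ + D * (q * e₂))))
      lem-im = solve-∀ ℚ-ring

    eval-replicate-0 : ∀ k z → eval (Vec.replicate k (+ 0)) z ≡ 0K
    eval-replicate-0 zero    z = refl
    eval-replicate-0 (suc k) z rewrite eval-replicate-0 k z | ι-0 = cong₂ _+√_ (lem-re (re z) (im z) dℚ) (lem-im (re z) (im z))
      where
      lem-re : ∀ p q D → 0ℚ + (p * 0ℚ + D * (q * 0ℚ)) ≡ 0ℚ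
      lem-re = solve-∀ ℚ-ring
      lem-im : ∀ p q → 0ℚ + (p * 0ℚ + q * 0ℚ) ≡ 0ℚ
      lem-im = solve-∀ ℚ-ring

    eval-+ : ∀ {k} (v w : Vec ℤ k) z → eval (Vec.zipWith ℤ._+_ v w) z ≡ eval v z ⊕ eval w z
    eval-+ []      []      z = refl
    eval-+ (a ∷ v) (b ∷ w) z rewrite eval-+ v w z | ι-+ a b = cong₂ _+√_
      (lem-re (ι a) (ι b) (re z) (im z) dℚ (re (eval v z)) (im (eval v z)) (re (eval w z)) (im (eval w z)))
      (lem-im (re z) (im z) (re (eval v z)) (im (eval v z)) (re (eval w z)) (im (eval w z)))
      where
      lem-re : ∀ a b p q D v₁ v₂ w₁ w₂ → a + b + (p * (v₁ + w₁) + D * (q * (v₂ + w₂)))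
        ≡ a + (p * v₁ + D * (q * v₂)) + (b + (p * w₁ + D * (q * w₂)))
      lem-re = solve-∀ ℚ-ring
      lem-im : ∀ p q v₁ v₂ w₁ w₂ → 0ℚ + (p * (v₂ + w₂) + q * (v₁ + w₁))
        ≡ 0ℚ + (p * v₂ + q * v₁) + (0ℚ + (p * w₂ + q * w₁))
      lem-im = solve-∀ ℚ-ring

    eval-* : ∀ {k} s (v : Vec ℤ k) z → eval (Vec.map (s ℤ.*_) v) z ≡ fromℚ (ι s) ⊗ eval v z
    eval-* s []      z = cong₂ _+√_ (lem-re (ι s) dℚ) (lem-im (ι s))
      where
      lem-re : ∀ s D → 0ℚ ≡ s * 0ℚ + D * (0ℚ * 0ℚ)
      lem-re = solve-∀ ℚ-ring
      lem-im : ∀ s → 0ℚ ≡ s * 0ℚ + 0ℚ * 0ℚ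
      lem-im = solve-∀ ℚ-ring
    eval-* s (a ∷ v) z rewrite eval-* s v z | ι-* s a = cong₂ _+√_
      (lem-re (ι s) (ι a) (re z) (im z) dℚ (re (eval v z)) (im (eval v z)))
      (lem-im (ι s) (ι a) (re z) (im z) dℚ (re (eval v z)) (im (eval v z)))
      where
      lem-re : ∀ s a p q D v₁ v₂ → s * a + (p * (s * v₁ + D * (0ℚ * v₂)) + D * (q * (s * v₂ + 0ℚ * v₁)))
        ≡ s * (a + (p * v₁ + D * (q * v₂))) + D * (0ℚ * (0ℚ + (p * v₂ + q * v₁)))
      lem-re = solve-∀ ℚ-ring
      lem-im : ∀ s a p q D v₁ v₂ → 0ℚ + (p * (s * v₂ + 0ℚ * v₁) + q * (s * v₁ + D * (0ℚ * v₂)))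
        ≡ s * (0ℚ + (p * v₂ + q * v₁)) + 0ℚ * (a + (p * v₁ + D * (q * v₂)))
      lem-im = solve-∀ ℚ-ring

    Clears : ℤ → K → Set
    Clears N w = (∃[ a ] ι N * re w ≡ ι a) × (∃[ b ] ι N * im w ≡ ι b)

    clear-denominators : ∀ z → ∃[ k ] Clears (+ suc k) z
    clear-denominators z
      with k , a , ka ← clear-denominator (re z) | l , b , lb ← clear-denominator (im z) =
      l ℕ.+ k ℕ.* suc l ,
      (+ suc l ℤ.* a , (begin
        ι (+ suc k ℤ.* + suc l) * re z     ≡⟨ cong (_* re z) (ι-* (+ suc k) (+ suc l)) ⟩
        ι (+ suc k) * ι (+ suc l) * re z   ≡⟨ lem₁ (ι (+ suc k)) (ι (+ suc l)) (re z) ⟩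
        ι (+ suc l) * (ι (+ suc k) * re z) ≡⟨ cong (ι (+ suc l) *_) ka ⟩
        ι (+ suc l) * ι a                  ≡⟨ ι-* (+ suc l) a ⟨
        ι (+ suc l ℤ.* a)                  ∎)) ,
      (+ suc k ℤ.* b , (begin
        ι (+ suc k ℤ.* + suc l) * im z     ≡⟨ cong (_* im z) (ι-* (+ suc k) (+ suc l)) ⟩
        ι (+ suc k) * ι (+ suc l) * im z   ≡⟨ lem₂ (ι (+ suc k)) (ι (+ suc l)) (im z) ⟩
        ι (+ suc k) * (ι (+ suc l) * im z) ≡⟨ cong (ι (+ suc k) *_) lb ⟩
        ι (+ suc k) * ι b                  ≡⟨ ι-* (+ suc k) b ⟨
        ι (+ suc k ℤ.* b)                  ∎))
      where
      open ≡-Reasoning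
      lem₁ : ∀ k l p → k * l * p ≡ l * (k * p)
      lem₁ = solve-∀ ℚ-ring
      lem₂ : ∀ k l p → k * l * p ≡ k * (l * p)
      lem₂ = solve-∀ ℚ-ring

    -- One `N` must serve all coefficient vectors at once, since it later bounds the denominators of
    -- all powers of an integral element. Each Horner step costs one more denominator of `z`.
    eval-denominator : ∀ z k → ∃[ N ] N ≢ 0 × ∀ (v : Vec ℤ k) → Clears (+ N) (eval v z)
    eval-denominator z zero = 1 , (λ ()) , λ { [] → (+ 0 , zero-clears) , (+ 0 , zero-clears) }
      where
      zero-clears : ι (+ 1) * 0ℚ ≡ ι (+ 0)
      zero-clears = trans (ℚ.*-zeroʳ (ι (+ 1))) (sym ι-0)
    eval-denominator z (suc k) =
      suc l ℕ.* N , (λ eq → N≢0 (ℕ.m*n≡0⇒m≡0 N (suc l) (trans (ℕ.*-comm N (suc l)) eq))) , step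
      where
      open ≡-Reasoning
      z-clears : ∃[ l ] Clears (+ suc l) z
      z-clears = clear-denominators z
      IH : ∃[ N ] N ≢ 0 × ∀ (v : Vec ℤ k) → Clears (+ N) (eval v z)
      IH = eval-denominator z k
      l N : ℕ
      l = proj₁ z-clears
      N = proj₁ IH
      N≢0 = proj₁ (proj₂ IH)
      a b : ℤ
      a = proj₁ (proj₁ (proj₂ z-clears))
      b = proj₁ (proj₂ (proj₂ z-clears))
      la = proj₂ (proj₁ (proj₂ z-clears))
      lb = proj₂ (proj₂ (proj₂ z-clears))
      step : (v : Vec ℤ (suc k)) → Clears (+ (suc l ℕ.* N)) (eval v z)
      step (c ∷ v) =
        (+ suc l ℤ.* + N ℤ.* c ℤ.+ (a ℤ.* x ℤ.+ + d ℤ.* (b ℤ.* y)) , (begin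
          ι (+ (suc l ℕ.* N)) * re (eval (c ∷ v) z)
            ≡⟨ cong (_* re (eval (c ∷ v) z)) lN ⟩
          ι (+ suc l) * ι (+ N) * (ι c + (re z * re w + dℚ * (im z * im w)))
            ≡⟨ lem-re (ι (+ suc l)) (ι (+ N)) (ι c) (re z) (im z) (re w) (im w) dℚ ⟩
          ι (+ suc l) * ι (+ N) * ι c + (ι (+ suc l) * re z * (ι (+ N) * re w) + dℚ * (ι (+ suc l) * im z * (ι (+ N) * im w)))
            ≡⟨ cong₂ (λ s t → ι (+ suc l) * ι (+ N) * ι c + (s + dℚ * t)) (cong₂ _*_ la Nx) (cong₂ _*_ lb Ny) ⟩
          ι (+ suc l) * ι (+ N) * ι c + (ι a * ι x + dℚ * (ι b * ι y))
            ≡⟨ cong₂ _+_ (trans (cong (_* ι c) (sym (ι-* (+ suc l) (+ N)))) (sym (ι-* (+ suc l ℤ.* + N) c)))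
                 (cong₂ _+_ (sym (ι-* a x)) (trans (cong (dℚ *_) (sym (ι-* b y))) (dℚ*ι (b ℤ.* y)))) ⟩
          ι (+ suc l ℤ.* + N ℤ.* c) + (ι (a ℤ.* x) + ι (+ d ℤ.* (b ℤ.* y)))
            ≡⟨ cong (ι (+ suc l ℤ.* + N ℤ.* c) ℚ.+_) (ι-+ (a ℤ.* x) (+ d ℤ.* (b ℤ.* y))) ⟨
          ι (+ suc l ℤ.* + N ℤ.* c) + ι (a ℤ.* x ℤ.+ + d ℤ.* (b ℤ.* y))
            ≡⟨ ι-+ (+ suc l ℤ.* + N ℤ.* c) (a ℤ.* x ℤ.+ + d ℤ.* (b ℤ.* y)) ⟨
          ι (+ suc l ℤ.* + N ℤ.* c ℤ.+ (a ℤ.* x ℤ.+ + d ℤ.* (b ℤ.* y))) ∎)) ,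
        (a ℤ.* y ℤ.+ b ℤ.* x , (begin
          ι (+ (suc l ℕ.* N)) * im (eval (c ∷ v) z)
            ≡⟨ cong (_* im (eval (c ∷ v) z)) lN ⟩
          ι (+ suc l) * ι (+ N) * (0ℚ + (re z * im w + im z * re w))
            ≡⟨ lem-im (ι (+ suc l)) (ι (+ N)) (re z) (im z) (re w) (im w) ⟩
          ι (+ suc l) * re z * (ι (+ N) * im w) + ι (+ suc l) * im z * (ι (+ N) * re w)
            ≡⟨ cong₂ _+_ (cong₂ _*_ la Ny) (cong₂ _*_ lb Nx) ⟩
          ι a * ι y + ι b * ι x
            ≡⟨ cong₂ _+_ (sym (ι-* a y)) (sym (ι-* b x)) ⟩
          ι (a ℤ.* y) + ι (b ℤ.* x)
            ≡⟨ ι-+ (a ℤ.* y) (b ℤ.* x) ⟨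
          ι (a ℤ.* y ℤ.+ b ℤ.* x) ∎))
        where
        w = eval v z
        w-clears : Clears (+ N) w
        w-clears = proj₂ (proj₂ IH) v
        x y : ℤ
        x = proj₁ (proj₁ w-clears)
        y = proj₁ (proj₂ w-clears)
        Nx = proj₂ (proj₁ w-clears)
        Ny = proj₂ (proj₂ w-clears)
        lN : ι (+ (suc l ℕ.* N)) ≡ ι (+ suc l) * ι (+ N)
        lN = trans (cong ι (ℤ.pos-* (suc l) N)) (ι-* (+ suc l) (+ N))
        lem-re : ∀ l N c p q x y D → l * N * (c + (p * x + D * (q * y)))
          ≡ l * N * c + (l * p * (N * x) + D * (l * q * (N * y)))
        lem-re = solve-∀ ℚ-ring
        lem-im : ∀ l N p q x y → l * N * (0ℚ + (p * y + q * x))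
          ≡ l * p * (N * y) + l * q * (N * x)
        lem-im = solve-∀ ℚ-ring

    _^K_ : K → ℕ → K
    z ^K zero  = 1K
    z ^K suc j = z ⊗ z ^K j

    norm-^ : ∀ z j → norm (z ^K j) ≡ norm z ^ℚ j
    norm-^ z zero    = lem dℚ
      where
      lem : ∀ D → 1ℚ * 1ℚ - D * (0ℚ * 0ℚ) ≡ 1ℚ
      lem = solve-∀ ℚ-ring
    norm-^ z (suc j) = trans (norm-⊗ z (z ^K j)) (cong (norm z *_) (norm-^ z j))

    -- z + s is almost integral: all its powers lie in the ℤ-span of finitely many powers of z.
    integral⇒norm-integer : ∀ z → Integral z → ∀ s → ∃[ n ] norm (z ⊕ fromℚ (ι s)) ≡ ι n
    -- The empty list stands for the constant polynomial 1, which has no root.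
    integral⇒norm-integer z ([] , ())
    integral⇒norm-integer z (cs₀@(_ ∷ cs) , cs₀-root) s =
      -- The norm is quadratic, so clearing the denominators of its argument takes `N²`.
      almost-integral⇒integer (N ℕ.* N) {{ℕ.≢-nonZero (λ eq → N≢0 (N²≡0 eq))}} (norm y) λ j →
        let (v , eq) = powers j
            ((a , Na) , (b , Nb)) = clears v
        in a ℤ.* a ℤ.- + d ℤ.* (b ℤ.* b) , (begin
          ι (+ (N ℕ.* N)) * norm y ^ℚ j                  ≡⟨ cong₂ _*_ (trans (cong ι (ℤ.pos-* N N)) (ι-* (+ N) (+ N))) (sym (norm-^ y j)) ⟩
          ι (+ N) * ι (+ N) * norm (y ^K j)              ≡⟨ cong (λ t → ι (+ N) * ι (+ N) * norm t) eq ⟩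
          ι (+ N) * ι (+ N) * norm (eval v z)            ≡⟨ lem (ι (+ N)) (re (eval v z)) (im (eval v z)) dℚ ⟩
          ι (+ N) * re (eval v z) * (ι (+ N) * re (eval v z)) - dℚ * (ι (+ N) * im (eval v z) * (ι (+ N) * im (eval v z)))
                                                         ≡⟨ cong₂ (λ s t → s * s - dℚ * (t * t)) Na Nb ⟩
          ι a * ι a - dℚ * (ι b * ι b)                   ≡⟨ cong₂ _-_ (sym (ι-* a a)) (trans (cong (dℚ *_) (sym (ι-* b b))) (dℚ*ι (b ℤ.* b))) ⟩
          ι (a ℤ.* a) - ι (+ d ℤ.* (b ℤ.* b))            ≡⟨ cong (ι (a ℤ.* a) ℚ.+_) (ι-neg (+ d ℤ.* (b ℤ.* b))) ⟨
          ι (a ℤ.* a) + ι (ℤ.- (+ d ℤ.* (b ℤ.* b)))      ≡⟨ ι-+ (a ℤ.* a) (ℤ.- (+ d ℤ.* (b ℤ.* b))) ⟨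
          ι (a ℤ.* a ℤ.- + d ℤ.* (b ℤ.* b))              ∎)
      where
      open ≡-Reasoning
      denominator = eval-denominator z (length cs₀)
      N : ℕ
      N = proj₁ denominator
      N≢0 = proj₁ (proj₂ denominator)
      clears = proj₂ (proj₂ denominator)
      y : K
      y = z ⊕ fromℚ (ι s)
      N²≡0 : ∀ {N} → N ℕ.* N ≡ 0 → N ≡ 0
      N²≡0 {zero}  _ = refl
      lem : ∀ N p q D → N * N * (p * p - D * (q * q)) ≡ N * p * (N * p) - D * (N * q * (N * q))
      lem = solve-∀ ℚ-ring
      span : K → Set
      span w = ∃[ v ] w ≡ eval {length cs₀} v z
      one : span 1K
      one = (+ 1) ∷ Vec.replicate (length cs) (+ 0) , sym (trans (cong₂ (λ s t → fromℚ s ⊕ z ⊗ t) ι-1 (eval-replicate-0 (length cs) z))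
        (cong₂ _+√_ (lem-re (re z) (im z) dℚ) (lem-im (re z) (im z))))
        where
        lem-re : ∀ p q D → 1ℚ + (p * 0ℚ + D * (q * 0ℚ)) ≡ 1ℚ
        lem-re = solve-∀ ℚ-ring
        lem-im : ∀ p q → 0ℚ + (p * 0ℚ + q * 0ℚ) ≡ 0ℚ
        lem-im = solve-∀ ℚ-ring
      -- Multiplication by `z` puts a coefficient 0 in front; the list, now one too long, is
      -- shortened by the monic relation.
      shift : ∀ v → span (z ⊗ eval {length cs₀} v z)
      shift v = w , (begin
        z ⊗ V                             ≡⟨ cong₂ _+√_ (ℚ.+-identityˡ _) (ℚ.+-identityˡ _) ⟨
        0K ⊕ z ⊗ V                        ≡⟨ cong (λ t → fromℚ t ⊕ z ⊗ V) ι-0 ⟨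
        fromℚ (ι (+ 0)) ⊕ z ⊗ V           ≡⟨ proj₂ (proj₂ reduced) ⟩
        W ⊕ fromℚ (ι l) ⊗ evalMonic cs₀ z ≡⟨ cong (λ t → W ⊕ fromℚ (ι l) ⊗ t) cs₀-root ⟩
        W ⊕ fromℚ (ι l) ⊗ 0K              ≡⟨ cong₂ _+√_ (lem-re (re W) (ι l) dℚ) (lem-im (im W) (ι l)) ⟩
        W                                 ∎)
        where
        reduced = eval-reduce cs₀ z (+ 0 ∷ v)
        w = proj₁ reduced
        l = proj₁ (proj₂ reduced)
        V W : K
        V = eval v z
        W = eval w z
        lem-re : ∀ p l D → p + (l * 0ℚ + D * (0ℚ * 0ℚ)) ≡ p
        lem-re = solve-∀ ℚ-ring
        lem-im : ∀ p l → p + (l * 0ℚ + 0ℚ * 0ℚ) ≡ p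
        lem-im = solve-∀ ℚ-ring
      mul-y : ∀ w → span w → span (y ⊗ w)
      mul-y w (v , w≡) =
        Vec.zipWith ℤ._+_ u (Vec.map (s ℤ.*_) v) , (begin
          y ⊗ w                            ≡⟨ cong₂ _+√_ (lem-re (re z) (im z) (re w) (im w) (ι s) dℚ) (lem-im (re z) (im z) (re w) (im w) (ι s)) ⟩
          z ⊗ w ⊕ fromℚ (ι s) ⊗ w          ≡⟨ cong (λ w → z ⊗ w ⊕ fromℚ (ι s) ⊗ w) w≡ ⟩
          z ⊗ eval v z ⊕ fromℚ (ι s) ⊗ eval v z  ≡⟨ cong₂ _⊕_ (proj₂ (shift v)) (sym (eval-* s v z)) ⟩
          eval u z ⊕ eval (Vec.map (s ℤ.*_) v) z ≡⟨ eval-+ u _ z ⟨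
          eval (Vec.zipWith ℤ._+_ u (Vec.map (s ℤ.*_) v)) z ∎)
        where
        u = proj₁ (shift v)
        lem-re : ∀ p q x y s D → (p + s) * x + D * ((q + 0ℚ) * y) ≡ p * x + D * (q * y) + (s * x + D * (0ℚ * y))
        lem-re = solve-∀ ℚ-ring
        lem-im : ∀ p q x y s → (p + s) * y + (q + 0ℚ) * x ≡ p * y + q * x + (s * y + 0ℚ * x)
        lem-im = solve-∀ ℚ-ring
      powers : ∀ j → span (y ^K j)
      powers zero    = one
      powers (suc j) = mul-y (y ^K j) (powers j)

    -- The identity Tr z = N(z + 1) - N(z) - 1 turns two integral norms into an integral trace `t`.
    -- Then d (2 im z)² = t² - 4 N(z) is an integer, and square-freeness applies. The last equation
    -- keeps the norm `n` for the parity arguments modulo 4.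
    integral⇒half-integers : SquareFree d → ∀ z → Integral z →
      ∃[ t ] ∃[ s ] ∃[ n ] re z + re z ≡ ι t × im z + im z ≡ ι s × t ℤ.* t ≡ + d ℤ.* (s ℤ.* s) ℤ.+ + 4 ℤ.* n
    integral⇒half-integers sf z z-int =
      t , s , n₀ , 2p , proj₂ s-int , ι-injective (begin
        ι (t ℤ.* t)                            ≡⟨ ι-* t t ⟩
        ι t * ι t                              ≡⟨ t²≡ ⟩
        dℚ * (2q * 2q) + ι (+ 4 ℤ.* n₀)        ≡⟨ cong (λ q → dℚ * (q * q) + ι (+ 4 ℤ.* n₀)) (proj₂ s-int) ⟩
        dℚ * (ι s * ι s) + ι (+ 4 ℤ.* n₀)      ≡⟨ cong (_+ ι (+ 4 ℤ.* n₀)) (trans (cong (dℚ *_) (sym (ι-* s s))) (dℚ*ι (s ℤ.* s))) ⟩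
        ι (+ d ℤ.* (s ℤ.* s)) + ι (+ 4 ℤ.* n₀) ≡⟨ ι-+ (+ d ℤ.* (s ℤ.* s)) (+ 4 ℤ.* n₀) ⟨
        ι (+ d ℤ.* (s ℤ.* s) ℤ.+ + 4 ℤ.* n₀)   ∎)
      where
      open ≡-Reasoning
      norm₀ = integral⇒norm-integer z z-int (+ 0)
      norm₁ = integral⇒norm-integer z z-int (+ 1)
      n₀ n₁ : ℤ
      n₀ = proj₁ norm₀
      n₁ = proj₁ norm₁
      eq₀ : norm (z ⊕ fromℚ 0ℚ) ≡ ι n₀
      eq₀ = trans (cong (λ t → norm (z ⊕ fromℚ t)) (sym ι-0)) (proj₂ norm₀)
      eq₁ : norm (z ⊕ fromℚ 1ℚ) ≡ ι n₁
      eq₁ = trans (cong (λ t → norm (z ⊕ fromℚ t)) (sym ι-1)) (proj₂ norm₁)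
      t : ℤ
      t = n₁ ℤ.- n₀ ℤ.- + 1
      2q : ℚ
      2q = im z + im z
      four : ∀ n → ι n + ι n + (ι n + ι n) ≡ ι (+ 4 ℤ.* n)
      four n = trans (cong (λ x → x + x) (sym (ι-+ n n))) (trans (sym (ι-+ (n ℤ.+ n) (n ℤ.+ n))) (cong ι (lem n)))
        where
        lem : ∀ n → n ℤ.+ n ℤ.+ (n ℤ.+ n) ≡ + 4 ℤ.* n
        lem = ℤ.solve-∀
      2p : re z + re z ≡ ι t
      2p = sym (begin
        ι t                    ≡⟨ trans (ι-- (n₁ ℤ.- n₀) (+ 1)) (cong₂ _-_ (ι-- n₁ n₀) ι-1) ⟩
        ι n₁ - ι n₀ - 1ℚ       ≡⟨ cong₂ (λ x y → x - y - 1ℚ) eq₁ eq₀ ⟨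
        norm (z ⊕ fromℚ 1ℚ) - norm (z ⊕ fromℚ 0ℚ) - 1ℚ ≡⟨ lem (re z) (im z) dℚ ⟩
        re z + re z            ∎)
        where
        lem : ∀ p q D → (p + 1ℚ) * (p + 1ℚ) - D * ((q + 0ℚ) * (q + 0ℚ)) - ((p + 0ℚ) * (p + 0ℚ) - D * ((q + 0ℚ) * (q + 0ℚ))) - 1ℚ ≡ p + p
        lem = solve-∀ ℚ-ring
      t²≡ : ι t * ι t ≡ dℚ * (2q * 2q) + ι (+ 4 ℤ.* n₀)
      t²≡ = begin
        ι t * ι t                               ≡⟨ cong (λ x → x * x) 2p ⟨
        (re z + re z) * (re z + re z)           ≡⟨ lem (re z) (im z) dℚ ⟩
        dℚ * (2q * 2q) + four-fold (norm (z ⊕ fromℚ 0ℚ)) ≡⟨ cong (λ x → dℚ * (2q * 2q) + four-fold x) eq₀ ⟩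
        dℚ * (2q * 2q) + four-fold (ι n₀)       ≡⟨ cong (dℚ * (2q * 2q) ℚ.+_) (four n₀) ⟩
        dℚ * (2q * 2q) + ι (+ 4 ℤ.* n₀)         ∎
        where
        four-fold : ℚ → ℚ
        four-fold x = x + x + (x + x)
        lem : ∀ p q D → (p + p) * (p + p) ≡ D * ((q + q) * (q + q)) + (((p + 0ℚ) * (p + 0ℚ) - D * ((q + 0ℚ) * (q + 0ℚ))) + ((p + 0ℚ) * (p + 0ℚ) - D * ((q + 0ℚ) * (q + 0ℚ))) + (((p + 0ℚ) * (p + 0ℚ) - D * ((q + 0ℚ) * (q + 0ℚ))) + ((p + 0ℚ) * (p + 0ℚ) - D * ((q + 0ℚ) * (q + 0ℚ)))))
        lem = solve-∀ ℚ-ring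
      s-int : ∃[ s ] 2q ≡ ι s
      s-int = integral-square⇒integer d sf 2q (t ℤ.* t ℤ.- + 4 ℤ.* n₀) (begin
        ι (+ d) * (2q * 2q)                           ≡⟨ cong (_* (2q * 2q)) (ι≡ (+ d)) ⟩
        dℚ * (2q * 2q)                                ≡⟨ lem (dℚ * (2q * 2q)) (ι (+ 4 ℤ.* n₀)) ⟩
        dℚ * (2q * 2q) + ι (+ 4 ℤ.* n₀) - ι (+ 4 ℤ.* n₀) ≡⟨ cong (_- ι (+ 4 ℤ.* n₀)) t²≡ ⟨
        ι t * ι t - ι (+ 4 ℤ.* n₀)                    ≡⟨ cong (_- ι (+ 4 ℤ.* n₀)) (ι-* t t) ⟨
        ι (t ℤ.* t) - ι (+ 4 ℤ.* n₀)                  ≡⟨ ι-- (t ℤ.* t) (+ 4 ℤ.* n₀) ⟨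
        ι (t ℤ.* t ℤ.- + 4 ℤ.* n₀)                    ∎)
        where
        lem : ∀ x y → x ≡ x + y - y
        lem = solve-∀ ℚ-ring
      s : ℤ
      s = proj₁ s-int

  0<p+p⇒0<p : ∀ {p} → 0ℚ < p + p → 0ℚ < p
  0<p+p⇒0<p {p} 0<2p with 0ℚ ℚ.<? p
  ... | yes 0<p = 0<p
  ... | no  0≮p = contradiction (ℚ.<-≤-trans 0<2p (ℚ.+-mono-≤ (ℚ.≮⇒≥ 0≮p) (ℚ.≮⇒≥ 0≮p))) (ℚ.<-irrefl refl)

  0≤p+p⇒0≤p : ∀ {p} → 0ℚ ≤ p + p → 0ℚ ≤ p
  0≤p+p⇒0≤p {p} 0≤2p with 0ℚ ℚ.≤? p
  ... | yes 0≤p = 0≤p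
  ... | no  0≰p = contradiction (ℚ.≤-<-trans 0≤2p (ℚ.+-mono-< (ℚ.≰⇒> 0≰p) (ℚ.≰⇒> 0≰p))) (ℚ.<-irrefl refl)

  0<p²⇒0<p : ∀ {p} → 0ℚ ≤ p → 0ℚ < p * p → 0ℚ < p
  0<p²⇒0<p {p} 0≤p 0<p² with ℚ.<-cmp 0ℚ p
  ... | tri< 0<p _ _ = 0<p
  ... | tri≈ _ refl _ = contradiction 0<p² (ℚ.<-irrefl refl)
  ... | tri> _ _ p<0 = contradiction (ℚ.≤-<-trans 0≤p p<0) (ℚ.<-irrefl refl)

  p≢0⇒0<p² : ∀ {p} → p ≢ 0ℚ → 0ℚ < p * p
  p≢0⇒0<p² {p} p≢0 with ℚ.<-cmp 0ℚ p
  ... | tri< 0<p _ _ = 0<* 0<p 0<p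
  ... | tri≈ _ eq _ = contradiction (sym eq) p≢0
  ... | tri> _ _ p<0 = subst (0ℚ <_) (lem p) (0<* (0<diff p<0) (0<diff p<0))
    where
    lem : ∀ p → (0ℚ - p) * (0ℚ - p) ≡ p * p
    lem = solve-∀ ℚ-ring

  -- The trace form and total positivity

  module Field (d : ℕ) (0<d : 0 ℕ.< d) where

    open QuadraticField d
    open IntegralClosure d using (norm; norm-⊗)

    0<dℚ : 0ℚ < dℚ
    0<dℚ = subst₂ _<_ ι-0 (ι≡ (+ d)) (ι-mono-< (ℤ.+<+ 0<d))

    ⊗-assoc : ∀ x y z → (x ⊗ y) ⊗ z ≡ x ⊗ (y ⊗ z)
    ⊗-assoc x y z = cong₂ _+√_ (lem-re (re x) (im x) (re y) (im y) (re z) (im z) dℚ) (lem-im (re x) (im x) (re y) (im y) (re z) (im z) dℚ)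
      where
      lem-re : ∀ a b c e f g D → (a * c + D * (b * e)) * f + D * ((a * e + b * c) * g) ≡ a * (c * f + D * (e * g)) + D * (b * (c * g + e * f))
      lem-re = solve-∀ ℚ-ring
      lem-im : ∀ a b c e f g D → (a * c + D * (b * e)) * g + (a * e + b * c) * f ≡ a * (c * g + e * f) + b * (c * f + D * (e * g))
      lem-im = solve-∀ ℚ-ring

    ⊗-comm : ∀ x y → x ⊗ y ≡ y ⊗ x
    ⊗-comm x y = cong₂ _+√_ (lem-re (re x) (im x) (re y) (im y) dℚ) (lem-im (re x) (im x) (re y) (im y))
      where
      lem-re : ∀ a b c e D → a * c + D * (b * e) ≡ c * a + D * (e * b)
      lem-re = solve-∀ ℚ-ring
      lem-im : ∀ a b c e → a * e + b * c ≡ c * b + e * a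
      lem-im = solve-∀ ℚ-ring

    ⊗-identityʳ : ∀ x → x ⊗ 1K ≡ x
    ⊗-identityʳ x = cong₂ _+√_ (lem-re (re x) (im x) dℚ) (lem-im (re x) (im x))
      where
      lem-re : ∀ a b D → a * 1ℚ + D * (b * 0ℚ) ≡ a
      lem-re = solve-∀ ℚ-ring
      lem-im : ∀ a b → a * 0ℚ + b * 1ℚ ≡ b
      lem-im = solve-∀ ℚ-ring

    ⊗-identityˡ : ∀ x → 1K ⊗ x ≡ x
    ⊗-identityˡ x = trans (⊗-comm 1K x) (⊗-identityʳ x)

    ⊗-zeroʳ : ∀ x → x ⊗ 0K ≡ 0K
    ⊗-zeroʳ x = cong₂ _+√_ (lem-re (re x) (im x) dℚ) (lem-im (re x) (im x))
      where
      lem-re : ∀ a b D → a * 0ℚ + D * (b * 0ℚ) ≡ 0ℚ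
      lem-re = solve-∀ ℚ-ring
      lem-im : ∀ a b → a * 0ℚ + b * 0ℚ ≡ 0ℚ
      lem-im = solve-∀ ℚ-ring

    ⊗-interchange : ∀ x y z w → (x ⊗ y) ⊗ (z ⊗ w) ≡ (x ⊗ z) ⊗ (y ⊗ w)
    ⊗-interchange x y z w = begin
      (x ⊗ y) ⊗ (z ⊗ w) ≡⟨ ⊗-assoc x y (z ⊗ w) ⟩
      x ⊗ (y ⊗ (z ⊗ w)) ≡⟨ cong (x ⊗_) (⊗-assoc y z w) ⟨
      x ⊗ ((y ⊗ z) ⊗ w) ≡⟨ cong (λ t → x ⊗ (t ⊗ w)) (⊗-comm y z) ⟩
      x ⊗ ((z ⊗ y) ⊗ w) ≡⟨ cong (x ⊗_) (⊗-assoc z y w) ⟩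
      x ⊗ (z ⊗ (y ⊗ w)) ≡⟨ ⊗-assoc x z (y ⊗ w) ⟨
      (x ⊗ z) ⊗ (y ⊗ w) ∎
      where open ≡-Reasoning

    fromℚ-⊗ : ∀ r x → fromℚ r ⊗ x ≡ (r * re x +√ r * im x)
    fromℚ-⊗ r x = cong₂ _+√_ (lem-re r (re x) (im x) dℚ) (lem-im r (re x) (im x))
      where
      lem-re : ∀ r a b D → r * a + D * (0ℚ * b) ≡ r * a
      lem-re = solve-∀ ℚ-ring
      lem-im : ∀ r a b → r * b + 0ℚ * a ≡ r * b
      lem-im = solve-∀ ℚ-ring

    fromℚ-* : ∀ r s → fromℚ (r * s) ≡ fromℚ r ⊗ fromℚ s
    fromℚ-* r s = trans (cong (r * s +√_) (sym (ℚ.*-zeroʳ r))) (sym (fromℚ-⊗ r (fromℚ s)))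

    Tr≡ : ∀ x → Tr x ≡ re x + re x
    Tr≡ x = lem (re x) (im x) dℚ
      where
      lem : ∀ a b D → (a * 1ℚ + D * (b * 0ℚ)) + (a * 1ℚ + b * 0ℚ) ≡ a + a
      lem = solve-∀ ℚ-ring

    trForm≡ : ∀ a x → trForm a x ≡
      re a * (re x * re x + dℚ * (im x * im x)) + dℚ * (im a * (re x * im x + im x * re x)) +
      (re a * (re x * re x + dℚ * (im x * im x)) + dℚ * (im a * (re x * im x + im x * re x)))
    trForm≡ a x = Tr≡ (a ⊗ x ²)

    trForm-1K : ∀ a → trForm a 1K ≡ Tr a
    trForm-1K a = cong Tr (trans (cong (a ⊗_) (⊗-identityʳ 1K)) (⊗-identityʳ a))

    trForm-0K : ∀ a → trForm a 0K ≡ 0ℚ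
    trForm-0K a = trans (cong Tr (trans (cong (a ⊗_) (⊗-zeroʳ 0K)) (⊗-zeroʳ a))) (Tr≡ 0K)

    trForm-⊗² : ∀ a u x → trForm (a ⊗ u ²) x ≡ trForm a (u ⊗ x)
    trForm-⊗² a u x = cong Tr (trans (⊗-assoc a (u ²) (x ²)) (cong (a ⊗_) (⊗-interchange u u x x)))

    trForm-scale : ∀ r a x → trForm (fromℚ r ⊗ a) x ≡ r * trForm a x
    trForm-scale r a x = begin
      Tr ((fromℚ r ⊗ a) ⊗ x ²)         ≡⟨ cong Tr (trans (⊗-assoc (fromℚ r) a (x ²)) (fromℚ-⊗ r (a ⊗ x ²))) ⟩
      Tr (r * re (a ⊗ x ²) +√ r * im (a ⊗ x ²)) ≡⟨ Tr≡ (r * re (a ⊗ x ²) +√ r * im (a ⊗ x ²)) ⟩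
      r * re (a ⊗ x ²) + r * re (a ⊗ x ²) ≡⟨ ℚ.*-distribˡ-+ r _ _ ⟨
      r * (re (a ⊗ x ²) + re (a ⊗ x ²)) ≡⟨ cong (r *_) (Tr≡ (a ⊗ x ²)) ⟨
      r * Tr (a ⊗ x ²)                 ∎
      where open ≡-Reasoning

    conj-involutive : ∀ x → conj (conj x) ≡ x
    conj-involutive x = cong (re x +√_) (lem (im x))
      where
      lem : ∀ b → - - b ≡ b
      lem = solve-∀ ℚ-ring

    trForm-conj : ∀ a x → trForm (conj a) x ≡ trForm a (conj x)
    trForm-conj a x = trans (trForm≡ (conj a) x) (trans (lem (re a) (im a) (re x) (im x) dℚ) (sym (trForm≡ a (conj x))))
      where
      lem : ∀ p q a b D →
        p * (a * a + D * (b * b)) + D * (- q * (a * b + b * a)) + (p * (a * a + D * (b * b)) + D * (- q * (a * b + b * a)))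
        ≡ p * (a * a + D * (- b * - b)) + D * (q * (a * - b + - b * a)) + (p * (a * a + D * (- b * - b)) + D * (q * (a * - b + - b * a)))
      lem = solve-∀ ℚ-ring

    trForm-neg : ∀ a x y → re y ≡ - re x → im y ≡ - im x → trForm a y ≡ trForm a x
    trForm-neg a x (.(- re x) +√ .(- im x)) refl refl =
      trans (trForm≡ a (- re x +√ - im x)) (trans (lem (re a) (im a) (re x) (im x) dℚ) (sym (trForm≡ a x)))
      where
      lem : ∀ p q a b D →
        p * (- a * - a + D * (- b * - b)) + D * (q * (- a * - b + - b * - a)) + (p * (- a * - a + D * (- b * - b)) + D * (q * (- a * - b + - b * - a)))
        ≡ p * (a * a + D * (b * b)) + D * (q * (a * b + b * a)) + (p * (a * a + D * (b * b)) + D * (q * (a * b + b * a)))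
      lem = solve-∀ ℚ-ring

    -- For `q ≥ 0` let `v` be a rational upper bound of √d with p - q v > 0. Then p = (p - q v) + q
    -- v, and p² - d q² is a sum of (p - q v)² and nonnegative terms, because v² > d. For `q ≤ 0`
    -- the same is applied to -q and the bound from the other embedding.
    TotallyPositive⇒ : ∀ a → TotallyPositive a → 0ℚ < re a × 0ℚ < norm a
    TotallyPositive⇒ (p +√ q) ((_ , u , _ , (0≤u , D<u²) , _ , 0<p+qu) , (_ , v , _ , (0≤v , D<v²) , _ , 0<p-qv)) =
      [ bound v 0≤v D<v² 0<p-qv , bound′ ]′ (ℚ.≤-total 0ℚ q)
      where
      lem : ∀ p q v D → p * p - D * (q * q) ≡ (p + - q * v) * (p + - q * v) + ((p + - q * v) * (q * v) + (p + - q * v) * (q * v)) + q * q * (v * v - D)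
      lem = solve-∀ ℚ-ring
      lem₂ : ∀ p q v → p ≡ (p + - q * v) + q * v
      lem₂ = solve-∀ ℚ-ring
      bound : ∀ {q} v → 0ℚ ≤ v → dℚ < v * v → 0ℚ < p + - q * v → 0ℚ ≤ q → 0ℚ < p × 0ℚ < p * p - dℚ * (q * q)
      bound {q} v 0≤v D<v² 0<p-qv 0≤q =
        subst (0ℚ <_) (sym (lem₂ p q v)) (0<+ 0<p-qv (0≤* 0≤q 0≤v)) ,
        subst (0ℚ <_) (sym (lem p q v dℚ))
          (0<+ (0<+ (0<* 0<p-qv 0<p-qv) (0≤+ (0≤* (ℚ.<⇒≤ 0<p-qv) (0≤* 0≤q 0≤v)) (0≤* (ℚ.<⇒≤ 0<p-qv) (0≤* 0≤q 0≤v))))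
               (0≤* (0≤² q) (0≤diff (ℚ.<⇒≤ D<v²))))
      lem₃ : ∀ p q u → p + q * u ≡ p + - - q * u
      lem₃ = solve-∀ ℚ-ring
      lem₄ : ∀ p q D → p * p - D * (- q * - q) ≡ p * p - D * (q * q)
      lem₄ = solve-∀ ℚ-ring
      lem₅ : ∀ q → 0ℚ - q ≡ - q
      lem₅ = solve-∀ ℚ-ring
      bound′ : q ≤ 0ℚ → 0ℚ < p × 0ℚ < p * p - dℚ * (q * q)
      bound′ q≤0 =
        let 0<p , 0<N = bound { - q } u 0≤u D<u² (subst (0ℚ <_) (lem₃ p q u) 0<p+qu) (subst (0ℚ ≤_) (lem₅ q) (0≤diff q≤0))
        in 0<p , subst (0ℚ <_) (lem₄ p q dℚ) 0<N

    -- A rational number between √d and p / ∣q∣, for q ≠ 0 the mean of p / ∣q∣ and d ∣q∣ / p.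
    upper-end : ∀ p q → 0ℚ < p → 0ℚ < p * p - dℚ * (q * q) →
      ∃[ u ] (0ℚ ≤ u × dℚ < u * u) × 0ℚ < p + q * u × 0ℚ < p + - q * u
    upper-end p q 0<p 0<N = cases (ℚ.<-cmp 0ℚ q)
      where
      negate : ∀ {q} → ∃[ u ] (0ℚ ≤ u × dℚ < u * u) × 0ℚ < p + - q * u × 0ℚ < p + - - q * u →
        ∃[ u ] (0ℚ ≤ u × dℚ < u * u) × 0ℚ < p + q * u × 0ℚ < p + - q * u
      negate {q} (u , hu , h₁ , h₂) = u , hu , subst (0ℚ <_) (lem p q u) h₂ , h₁
        where
        lem : ∀ p q u → p + - - q * u ≡ p + q * u
        lem = solve-∀ ℚ-ring
      positive-case : ∀ q → 0ℚ < q → 0ℚ < p * p - dℚ * (q * q) →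
        ∃[ u ] (0ℚ ≤ u × dℚ < u * u) × 0ℚ < p + q * u × 0ℚ < p + - q * u
      positive-case q 0<q 0<N = u , (0≤u , <-by-diff u²-D (0<* (0<* 0<N 0<N) (0<* 0<i 0<i))) ,
          0<+ 0<p (0≤* (ℚ.<⇒≤ 0<q) 0≤u) , subst (0ℚ <_) (sym p-qu) (0<* 0<N (0<* 0<q 0<i))
        where
        0<2pq : 0ℚ < p * q + p * q
        0<2pq = 0<+ (0<* 0<p 0<q) (ℚ.<⇒≤ (0<* 0<p 0<q))
        i : ℚ
        i = proj₁ (pos-inverse 0<2pq)
        0<i = proj₁ (proj₂ (pos-inverse 0<2pq))
        i-inv : i * (p * q + p * q) ≡ 1ℚ
        i-inv = proj₂ (proj₂ (pos-inverse 0<2pq))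
        u : ℚ
        u = (p * p + dℚ * (q * q)) * i
        0≤u : 0ℚ ≤ u
        0≤u = 0≤* (0≤+ (0≤² p) (0≤* (ℚ.<⇒≤ 0<dℚ) (0≤² q))) (ℚ.<⇒≤ 0<i)
        p-qu : p + - q * u ≡ (p * p - dℚ * (q * q)) * (q * i)
        p-qu = trans (cong (_+ - q * u) (trans (sym (ℚ.*-identityʳ p)) (cong (p *_) (sym i-inv)))) (lem p q i dℚ)
          where
          lem : ∀ p q i D → p * (i * (p * q + p * q)) + - q * ((p * p + D * (q * q)) * i) ≡ (p * p - D * (q * q)) * (q * i)
          lem = solve-∀ ℚ-ring
        -- The gap in the inequality of arithmetic and geometric means, as the two averaged numbers
        -- have product d.
        u²-D : u * u - dℚ ≡ (p * p - dℚ * (q * q)) * (p * p - dℚ * (q * q)) * (i * i)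
        u²-D = trans (cong (λ x → u * u - x) (trans (lem₁ dℚ) (cong (λ x → dℚ * (x * x)) (sym i-inv)))) (lem p q i dℚ)
          where
          lem₁ : ∀ D → D ≡ D * (1ℚ * 1ℚ)
          lem₁ = solve-∀ ℚ-ring
          lem : ∀ p q i D → (p * p + D * (q * q)) * i * ((p * p + D * (q * q)) * i) - D * (i * (p * q + p * q) * (i * (p * q + p * q)))
            ≡ (p * p - D * (q * q)) * (p * p - D * (q * q)) * (i * i)
          lem = solve-∀ ℚ-ring
      cases : _ → ∃[ u ] (0ℚ ≤ u × dℚ < u * u) × 0ℚ < p + q * u × 0ℚ < p + - q * u
      cases (tri< 0<q _ _) = positive-case q 0<q 0<N
      cases (tri> _ _ q<0) = negate {q} (positive-case (- q) (subst (0ℚ <_) (lem₁ q) (0<diff q<0)) (subst (0ℚ <_) (lem₂ p q dℚ) 0<N))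
        where
        lem₁ : ∀ q → 0ℚ - q ≡ - q
        lem₁ = solve-∀ ℚ-ring
        lem₂ : ∀ p q D → p * p - D * (q * q) ≡ p * p - D * (- q * - q)
        lem₂ = solve-∀ ℚ-ring
      -- For q = 0 any `u` with u² > d will do.
      cases (tri≈ _ 0≡q _) = dℚ + 1ℚ , (ℚ.<⇒≤ (0<+ 0<dℚ (ℚ.nonNegative⁻¹ 1ℚ)) , <-by-diff (lem dℚ) (0<+ (0<+ (ℚ.positive⁻¹ 1ℚ) (ℚ.<⇒≤ 0<dℚ)) (0≤² dℚ))) ,
          subst (0ℚ <_) (trans (lem₁ p (dℚ + 1ℚ)) (cong (λ q → p + q * (dℚ + 1ℚ)) 0≡q)) 0<p ,
          subst (0ℚ <_) (trans (lem₂ p (dℚ + 1ℚ)) (cong (λ q → p + - q * (dℚ + 1ℚ)) 0≡q)) 0<p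
        where
        lem : ∀ D → (D + 1ℚ) * (D + 1ℚ) - D ≡ 1ℚ + D + D * D
        lem = solve-∀ ℚ-ring
        lem₁ : ∀ p u → p ≡ p + 0ℚ * u
        lem₁ = solve-∀ ℚ-ring
        lem₂ : ∀ p u → p ≡ p + - 0ℚ * u
        lem₂ = solve-∀ ℚ-ring

    -- The lower end can be 0 in both embeddings: there the affine function takes the value `re a`.
    ⇒TotallyPositive : ∀ a → 0ℚ < re a → 0ℚ < norm a → TotallyPositive a
    ⇒TotallyPositive (p +√ q) 0<p 0<N =
      let u , u-upper , h₁ , h₂ = upper-end p q 0<p 0<N
      in (0ℚ , u , (ℚ.≤-refl , 0<dℚ) , u-upper , subst (0ℚ <_) (lem p q) 0<p , h₁) ,
         (0ℚ , u , (ℚ.≤-refl , 0<dℚ) , u-upper , subst (0ℚ <_) (lem p (- q)) 0<p , h₂)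
      where
      lem : ∀ p q → p ≡ p + q * 0ℚ
      lem = solve-∀ ℚ-ring

    TotallyPositive-conj : ∀ a → TotallyPositive a → TotallyPositive (conj a)
    TotallyPositive-conj a (pos , pos-conj) = pos-conj , subst Positive (sym (conj-involutive a)) pos

    TotallyPositive-scale : ∀ r a → 0ℚ < r → TotallyPositive a → TotallyPositive (fromℚ r ⊗ a)
    TotallyPositive-scale r a 0<r tp = ⇒TotallyPositive (fromℚ r ⊗ a)
      (subst (0ℚ <_) (cong re (sym (fromℚ-⊗ r a))) (0<* 0<r 0<re))
      (subst (0ℚ <_) (sym (norm-⊗ (fromℚ r) a)) (0<* (subst (0ℚ <_) (lem r dℚ) (0<* 0<r 0<r)) 0<norm))
      where
      0<re = proj₁ (TotallyPositive⇒ a tp)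
      0<norm = proj₂ (TotallyPositive⇒ a tp)
      lem : ∀ r D → r * r ≡ r * r - D * (0ℚ * 0ℚ)
      lem = solve-∀ ℚ-ring

    -- Completing the square: with a = p + q √d and x = x₁ + x₂ √d, the product p Tr (a x²) equals 2
    -- ((p x₁ + d q x₂)² + d x₂² N(a)).
    0≤trForm : ∀ a → TotallyPositive a → ∀ x → 0ℚ ≤ trForm a x
    0≤trForm a tp x = *-cancelˡ-≤ 0<re (subst₂ _≤_ (sym (ℚ.*-zeroʳ (re a))) (sym (trans (cong (re a *_) (trForm≡ a x)) (lem (re a) (im a) (re x) (im x) dℚ)))
        (0≤+ half half))
      where
      0<re = proj₁ (TotallyPositive⇒ a tp)
      0<norm = proj₂ (TotallyPositive⇒ a tp)
      half : 0ℚ ≤ (re a * re x + dℚ * (im a * im x)) * (re a * re x + dℚ * (im a * im x)) + dℚ * ((im x * im x) * (re a * re a - dℚ * (im a * im a)))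
      half = 0≤+ (0≤² (re a * re x + dℚ * (im a * im x))) (0≤* (ℚ.<⇒≤ 0<dℚ) (0≤* (0≤² (im x)) (ℚ.<⇒≤ 0<norm)))
      lem : ∀ p q a b D → p * (p * (a * a + D * (b * b)) + D * (q * (a * b + b * a)) + (p * (a * a + D * (b * b)) + D * (q * (a * b + b * a))))
        ≡ ((p * a + D * (q * b)) * (p * a + D * (q * b)) + D * ((b * b) * (p * p - D * (q * q))))
        + ((p * a + D * (q * b)) * (p * a + D * (q * b)) + D * ((b * b) * (p * p - D * (q * q))))
      lem = solve-∀ ℚ-ring

    -- The norm is multiplicative, hence positive. The real part is half a value of the trace form
    -- of `a`, so it is nonnegative, and a positive norm keeps it from vanishing.
    TotallyPositive-⊗² : ∀ a u → TotallyPositive a → norm u ≢ 0ℚ → TotallyPositive (a ⊗ u ²)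
    TotallyPositive-⊗² a u tp norm≢0 = ⇒TotallyPositive b (0<p²⇒0<p 0≤re 0<re²) 0<norm-b
      where
      b : K
      b = a ⊗ u ²
      0<norm-b : 0ℚ < norm b
      0<norm-b = subst (0ℚ <_) (sym (trans (norm-⊗ a (u ²)) (cong (norm a *_) (norm-⊗ u u))))
        (0<* (proj₂ (TotallyPositive⇒ a tp)) (p≢0⇒0<p² norm≢0))
      0≤re : 0ℚ ≤ re b
      0≤re = 0≤p+p⇒0≤p (subst (0ℚ ≤_) (Tr≡ b) (0≤trForm a tp u))
      0<re² : 0ℚ < re b * re b
      0<re² = subst (0ℚ <_) (lem (re b) (im b) dℚ) (0<+ 0<norm-b (0≤* (ℚ.<⇒≤ 0<dℚ) (0≤² (im b))))
        where
        lem : ∀ p q D → p * p - D * (q * q) + D * (q * q) ≡ p * p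
        lem = solve-∀ ℚ-ring

    IsMinimum-unique : ∀ {S f m₁ m₂} → IsMinimum S f m₁ → IsMinimum S f m₂ → m₁ ≡ m₂
    IsMinimum-unique ((x , Sx , refl) , min₁) ((y , Sy , refl) , min₂) = ℚ.≤-antisym (min₁ y Sy) (min₂ x Sx)

  -- The ring ℤ[ξ], ξ = h + g √d a root of X² − T X − n, in the basis 1, ξ.
  module Basis (d : ℕ) (0<d : 0 ℕ.< d) (T n : ℤ) (h g g⁻¹ : ℚ)
    (h+h≡T : h + h ≡ ι T)
    (g²d≡h²+n : g * g * QuadraticField.dℚ d ≡ h * h + ι n)
    (g⁻¹*g≡1 : g⁻¹ * g ≡ 1ℚ)
    where

    open QuadraticField d
    open IntegralClosure d using (norm; norm-⊗)
    open Field d 0<d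

    -- `Δ` is the discriminant of X² - T X - n.
    t ν Δ : ℚ
    t = ι T
    ν = ι n
    Δ = t * t + (ν + ν + (ν + ν))

    ⟪_,_⟫ : ℚ → ℚ → K
    ⟪ p , q ⟫ = p + q * h +√ q * g

    ξ : K
    ξ = ⟪ 0ℚ , 1ℚ ⟫

    ⟪⟫-⊗ : ∀ p q r s → ⟪ p , q ⟫ ⊗ ⟪ r , s ⟫ ≡ ⟪ p * r + ν * (q * s) , p * s + q * r + t * (q * s) ⟫
    ⟪⟫-⊗ p q r s = cong₂ _+√_
      (trans (lem₁ p q r s h g dℚ)
        (trans (cong (λ x → p * r + (p * s + q * r) * h + q * s * (h * h) + q * s * x) g²d≡h²+n)
          (trans (lem₂ p q r s h ν) (cong (λ x → p * r + ν * (q * s) + (p * s + q * r + x * (q * s)) * h) h+h≡T))))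
      (trans (lem₃ p q r s h g) (cong (λ x → (p * s + q * r + x * (q * s)) * g) h+h≡T))
      where
      lem₁ : ∀ p q r s h g D → (p + q * h) * (r + s * h) + D * (q * g * (s * g))
        ≡ p * r + (p * s + q * r) * h + q * s * (h * h) + q * s * (g * g * D)
      lem₁ = solve-∀ ℚ-ring
      lem₂ : ∀ p q r s h ν → p * r + (p * s + q * r) * h + q * s * (h * h) + q * s * (h * h + ν)
        ≡ p * r + ν * (q * s) + (p * s + q * r + (h + h) * (q * s)) * h
      lem₂ = solve-∀ ℚ-ring
      lem₃ : ∀ p q r s h g → (p + q * h) * (s * g) + q * g * (r + s * h) ≡ (p * s + q * r + (h + h) * (q * s)) * g
      lem₃ = solve-∀ ℚ-ring

    ⟪⟫-⊕ : ∀ p q r s → ⟪ p , q ⟫ ⊕ ⟪ r , s ⟫ ≡ ⟪ p + r , q + s ⟫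
    ⟪⟫-⊕ p q r s = cong₂ _+√_ (lem₁ p q r s h) (lem₂ q s g)
      where
      lem₁ : ∀ p q r s h → p + q * h + (r + s * h) ≡ p + r + (q + s) * h
      lem₁ = solve-∀ ℚ-ring
      lem₂ : ∀ q s g → q * g + s * g ≡ (q + s) * g
      lem₂ = solve-∀ ℚ-ring

    ⟪⟫-fromℚ : ∀ p → fromℚ p ≡ ⟪ p , 0ℚ ⟫
    ⟪⟫-fromℚ p = cong₂ _+√_ (lem₁ p h) (lem₂ g)
      where
      lem₁ : ∀ p h → p ≡ p + 0ℚ * h
      lem₁ = solve-∀ ℚ-ring
      lem₂ : ∀ g → 0ℚ ≡ 0ℚ * g
      lem₂ = solve-∀ ℚ-ring

    conj-⟪⟫ : ∀ p q → conj ⟪ p , q ⟫ ≡ ⟪ p + t * q , - q ⟫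
    conj-⟪⟫ p q = cong₂ _+√_ (trans (lem₁ p q h) (cong (λ x → p + x * q + - q * h) h+h≡T)) (lem₂ q g)
      where
      lem₁ : ∀ p q h → p + q * h ≡ p + (h + h) * q + - q * h
      lem₁ = solve-∀ ℚ-ring
      lem₂ : ∀ q g → - (q * g) ≡ - q * g
      lem₂ = solve-∀ ℚ-ring

    coordinates : ∀ a → ∃[ p ] ∃[ q ] a ≡ ⟪ p , q ⟫
    coordinates a = re a - im a * g⁻¹ * h , im a * g⁻¹ , cong₂ _+√_ (lem₁ (re a) (im a) g⁻¹ h)
      (sym (trans (ℚ.*-assoc (im a) g⁻¹ g) (trans (cong (im a *_) g⁻¹*g≡1) (ℚ.*-identityʳ (im a)))))
      where
      lem₁ : ∀ a b g h → a ≡ a - b * g * h + b * g * h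
      lem₁ = solve-∀ ℚ-ring

    -- This reduces statements about K to polynomial identities in `t`, `ν` and two coordinates,
    -- free of `h`, `g` and `d`.
    by-coordinates : (R : K → Set) → (∀ p q → R ⟪ p , q ⟫) → ∀ a → R a
    by-coordinates R r a = subst R (sym (proj₂ (proj₂ (coordinates a)))) (r (proj₁ (coordinates a)) (proj₁ (proj₂ (coordinates a))))

    Tr-⟪⟫ : ∀ p q → Tr ⟪ p , q ⟫ ≡ p + p + t * q
    Tr-⟪⟫ p q = trans (Tr≡ ⟪ p , q ⟫) (trans (lem p q h) (cong (λ x → p + p + x * q) h+h≡T))
      where
      lem : ∀ p q h → p + q * h + (p + q * h) ≡ p + p + (h + h) * q
      lem = solve-∀ ℚ-ring

    Trξ : K → ℚ
    Trξ a = Tr (a ⊗ ξ)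

    Trξ-⟪⟫ : ∀ p q → Trξ ⟪ p , q ⟫ ≡ t * p + (t * t + (ν + ν)) * q
    Trξ-⟪⟫ p q = trans (cong Tr (⟪⟫-⊗ p q 0ℚ 1ℚ)) (trans (Tr-⟪⟫ (p * 0ℚ + ν * (q * 1ℚ)) (p * 1ℚ + q * 0ℚ + t * (q * 1ℚ))) (lem p q t ν))
      where
      lem : ∀ p q t ν → p * 0ℚ + ν * (q * 1ℚ) + (p * 0ℚ + ν * (q * 1ℚ)) + t * (p * 1ℚ + q * 0ℚ + t * (q * 1ℚ))
        ≡ t * p + (t * t + (ν + ν)) * q
      lem = solve-∀ ℚ-ring

    -- The value at α + β ξ of the trace form of a, where A = Tr a and B = Tr (a ξ).
    Q : (A B α β : ℚ) → ℚ
    Q A B α β = A * (α * α) + (B + B) * (α * β) + (t * B + ν * A) * (β * β)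

    Q-scale : ∀ r A B α β → r * Q A B α β ≡ Q (r * A) (r * B) α β
    Q-scale r A B α β = lem r A B α β t ν
      where
      lem : ∀ κ A B α β t ν → κ * (A * (α * α) + (B + B) * (α * β) + (t * B + ν * A) * (β * β))
        ≡ κ * A * (α * α) + (κ * B + κ * B) * (α * β) + (t * (κ * B) + ν * (κ * A)) * (β * β)
      lem = solve-∀ ℚ-ring

    -- The coefficient of β² is Tr (a ξ²), which the equation of ξ turns into t Tr (a ξ) + ν Tr a.
    trForm-Q : ∀ a α β → trForm a ⟪ α , β ⟫ ≡ Q (Tr a) (Trξ a) α β
    trForm-Q = by-coordinates (λ a → ∀ α β → trForm a ⟪ α , β ⟫ ≡ Q (Tr a) (Trξ a) α β) λ p q α β → begin
      Tr (⟪ p , q ⟫ ⊗ ⟪ α , β ⟫ ²)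
        ≡⟨ cong (λ y → Tr (⟪ p , q ⟫ ⊗ y)) (⟪⟫-⊗ α β α β) ⟩
      Tr (⟪ p , q ⟫ ⊗ ⟪ α * α + ν * (β * β) , α * β + β * α + t * (β * β) ⟫)
        ≡⟨ cong Tr (⟪⟫-⊗ p q (α * α + ν * (β * β)) (α * β + β * α + t * (β * β))) ⟩
      Tr ⟪ p * (α * α + ν * (β * β)) + ν * (q * (α * β + β * α + t * (β * β)))
         , p * (α * β + β * α + t * (β * β)) + q * (α * α + ν * (β * β)) + t * (q * (α * β + β * α + t * (β * β))) ⟫
        ≡⟨ Tr-⟪⟫ (p * (α * α + ν * (β * β)) + ν * (q * (α * β + β * α + t * (β * β))))
             (p * (α * β + β * α + t * (β * β)) + q * (α * α + ν * (β * β)) + t * (q * (α * β + β * α + t * (β * β)))) ⟩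
      _ ≡⟨ lem p q α β t ν ⟩
      Q (p + p + t * q) (t * p + (t * t + (ν + ν)) * q) α β
        ≡⟨ cong₂ (λ A B → Q A B α β) (Tr-⟪⟫ p q) (Trξ-⟪⟫ p q) ⟨
      Q (Tr ⟪ p , q ⟫) (Trξ ⟪ p , q ⟫) α β ∎
      where
      open ≡-Reasoning
      lem : ∀ p q α β t ν →
        p * (α * α + ν * (β * β)) + ν * (q * (α * β + β * α + t * (β * β)))
        + (p * (α * α + ν * (β * β)) + ν * (q * (α * β + β * α + t * (β * β))))
        + t * (p * (α * β + β * α + t * (β * β)) + q * (α * α + ν * (β * β)) + t * (q * (α * β + β * α + t * (β * β))))
        ≡ (p + p + t * q) * (α * α) + (t * p + (t * t + (ν + ν)) * q + (t * p + (t * t + (ν + ν)) * q)) * (α * β)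
        + (t * (t * p + (t * t + (ν + ν)) * q) + ν * (p + p + t * q)) * (β * β)
      lem = solve-∀ ℚ-ring

    Tr-conj : ∀ a → Tr (conj a) ≡ Tr a
    Tr-conj a = trans (Tr≡ (conj a)) (sym (Tr≡ a))

    Trξ-conj : ∀ a → Trξ (conj a) ≡ t * Tr a - Trξ a
    Trξ-conj = by-coordinates (λ a → Trξ (conj a) ≡ t * Tr a - Trξ a) λ p q →
      trans (cong Trξ (conj-⟪⟫ p q)) (trans (Trξ-⟪⟫ (p + t * q) (- q)) (trans (lem p q t ν)
        (sym (cong₂ (λ A B → t * A - B) (Tr-⟪⟫ p q) (Trξ-⟪⟫ p q)))))
      where
      lem : ∀ p q t ν → t * (p + t * q) + (t * t + (ν + ν)) * - q ≡ t * (p + p + t * q) - (t * p + (t * t + (ν + ν)) * q)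
      lem = solve-∀ ℚ-ring

    -- Together with `trForm-Q`, which gives Tr (a u²), this describes how multiplication by a
    -- square acts on the pair (`Tr`, `Trξ`).
    Trξ-⊗² : ∀ a α β → Trξ (a ⊗ ⟪ α , β ⟫ ²) ≡
      ν * (α * β + α * β + t * (β * β)) * Tr a + (α * α + ν * (β * β) + t * (α * β + α * β) + t * t * (β * β)) * Trξ a
    Trξ-⊗² = by-coordinates (λ a → ∀ α β → Trξ (a ⊗ ⟪ α , β ⟫ ²) ≡
      ν * (α * β + α * β + t * (β * β)) * Tr a + (α * α + ν * (β * β) + t * (α * β + α * β) + t * t * (β * β)) * Trξ a) λ p q α β → begin
      Trξ (⟪ p , q ⟫ ⊗ ⟪ α , β ⟫ ²)
        ≡⟨ cong (λ y → Trξ (⟪ p , q ⟫ ⊗ y)) (⟪⟫-⊗ α β α β) ⟩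
      Trξ (⟪ p , q ⟫ ⊗ ⟪ α * α + ν * (β * β) , α * β + β * α + t * (β * β) ⟫)
        ≡⟨ cong Trξ (⟪⟫-⊗ p q (α * α + ν * (β * β)) (α * β + β * α + t * (β * β))) ⟩
      Trξ ⟪ p * (α * α + ν * (β * β)) + ν * (q * (α * β + β * α + t * (β * β)))
         , p * (α * β + β * α + t * (β * β)) + q * (α * α + ν * (β * β)) + t * (q * (α * β + β * α + t * (β * β))) ⟫
        ≡⟨ Trξ-⟪⟫ (p * (α * α + ν * (β * β)) + ν * (q * (α * β + β * α + t * (β * β))))
             (p * (α * β + β * α + t * (β * β)) + q * (α * α + ν * (β * β)) + t * (q * (α * β + β * α + t * (β * β)))) ⟩
      _ ≡⟨ lem p q α β t ν ⟩
      ν * (α * β + α * β + t * (β * β)) * (p + p + t * q)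
        + (α * α + ν * (β * β) + t * (α * β + α * β) + t * t * (β * β)) * (t * p + (t * t + (ν + ν)) * q)
        ≡⟨ cong₂ (λ A B → ν * (α * β + α * β + t * (β * β)) * A + (α * α + ν * (β * β) + t * (α * β + α * β) + t * t * (β * β)) * B)
             (Tr-⟪⟫ p q) (Trξ-⟪⟫ p q) ⟨
      ν * (α * β + α * β + t * (β * β)) * Tr ⟪ p , q ⟫
        + (α * α + ν * (β * β) + t * (α * β + α * β) + t * t * (β * β)) * Trξ ⟪ p , q ⟫ ∎
      where
      open ≡-Reasoning
      lem : ∀ p q α β t ν →
        t * (p * (α * α + ν * (β * β)) + ν * (q * (α * β + β * α + t * (β * β))))
        + (t * t + (ν + ν)) * (p * (α * β + β * α + t * (β * β)) + q * (α * α + ν * (β * β)) + t * (q * (α * β + β * α + t * (β * β))))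
        ≡ ν * (α * β + α * β + t * (β * β)) * (p + p + t * q)
        + (α * α + ν * (β * β) + t * (α * β + α * β) + t * t * (β * β)) * (t * p + (t * t + (ν + ν)) * q)
      lem = solve-∀ ℚ-ring

    Tr-scale : ∀ r a → Tr (fromℚ r ⊗ a) ≡ r * Tr a
    Tr-scale r a = trans (sym (trForm-1K (fromℚ r ⊗ a))) (trans (trForm-scale r a 1K) (cong (r *_) (trForm-1K a)))

    Trξ-scale : ∀ r a → Trξ (fromℚ r ⊗ a) ≡ r * Trξ a
    Trξ-scale r a = trans (cong Tr (⊗-assoc (fromℚ r) a ξ)) (Tr-scale r (a ⊗ ξ))

    -- In the coordinates p, q of the basis 1, ξ the pair (Tr a, Tr (a ξ)) is a linear system of
    -- determinant `Δ`; eliminating p gives Δ q = 2 Tr (a ξ) - t Tr a.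
    Tr-Trξ-injective : 0ℚ < Δ → ∀ a b → Tr a ≡ Tr b → Trξ a ≡ Trξ b → a ≡ b
    Tr-Trξ-injective 0<Δ a b = by-coordinates (λ a → ∀ b → Tr a ≡ Tr b → Trξ a ≡ Trξ b → a ≡ b)
      (λ p q → by-coordinates (λ b → Tr ⟪ p , q ⟫ ≡ Tr b → Trξ ⟪ p , q ⟫ ≡ Trξ b → ⟪ p , q ⟫ ≡ b)
      λ p′ q′ eqA eqB → main p q p′ q′
        (trans (sym (Tr-⟪⟫ p q)) (trans eqA (Tr-⟪⟫ p′ q′)))
        (trans (sym (Trξ-⟪⟫ p q)) (trans eqB (Trξ-⟪⟫ p′ q′)))) a b
      where
      lem₁ : ∀ p q t ν → (t * t + (ν + ν + (ν + ν))) * q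
        ≡ t * p + (t * t + (ν + ν)) * q + (t * p + (t * t + (ν + ν)) * q) - t * (p + p + t * q)
      lem₁ = solve-∀ ℚ-ring
      lem₂ : ∀ p q t → (1ℚ + 1ℚ) * p ≡ p + p + t * q - t * q
      lem₂ = solve-∀ ℚ-ring
      main : ∀ p q p′ q′ → p + p + t * q ≡ p′ + p′ + t * q′ →
        t * p + (t * t + (ν + ν)) * q ≡ t * p′ + (t * t + (ν + ν)) * q′ → ⟪ p , q ⟫ ≡ ⟪ p′ , q′ ⟫
      main p q p′ q′ eqA eqB = cong₂ ⟪_,_⟫ p≡p′ q≡q′
        where
        q≡q′ : q ≡ q′
        q≡q′ = *-cancelˡ-≡ 0<Δ (trans (lem₁ p q t ν) (trans (cong₂ (λ A B → B + B - t * A) eqA eqB) (sym (lem₁ p′ q′ t ν))))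
        p≡p′ : p ≡ p′
        p≡p′ = *-cancelˡ-≡ {1ℚ + 1ℚ} (ℚ.positive⁻¹ (1ℚ + 1ℚ)) (trans (lem₂ p q t) (trans (cong₂ (λ A x → A - t * x) eqA q≡q′) (sym (lem₂ p′ q′ t))))

    norm-⟪⟫ : ∀ p q → norm ⟪ p , q ⟫ ≡ p * p + t * (p * q) - ν * (q * q)
    norm-⟪⟫ p q = trans (lem₁ p q h g dℚ)
      (trans (cong (λ x → p * p + (p * q + p * q) * h + q * q * (h * h) - q * q * x) g²d≡h²+n)
        (trans (lem₂ p q h ν) (cong (λ x → p * p + x * (p * q) - ν * (q * q)) h+h≡T)))
      where
      lem₁ : ∀ p q h g D → (p + q * h) * (p + q * h) - D * (q * g * (q * g))
        ≡ p * p + (p * q + p * q) * h + q * q * (h * h) - q * q * (g * g * D)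
      lem₁ = solve-∀ ℚ-ring
      lem₂ : ∀ p q h ν → p * p + (p * q + p * q) * h + q * q * (h * h) - q * q * (h * h + ν)
        ≡ p * p + (h + h) * (p * q) - ν * (q * q)
      lem₂ = solve-∀ ℚ-ring

    Lattice : K → Set
    Lattice z = ∃[ α ] ∃[ β ] z ≡ ⟪ ι α , ι β ⟫

    Lattice-1K : Lattice 1K
    Lattice-1K = + 1 , + 0 , trans (⟪⟫-fromℚ 1ℚ) (sym (cong₂ ⟪_,_⟫ ι-1 ι-0))

    Lattice-⊗ : ∀ x y → Lattice x → Lattice y → Lattice (x ⊗ y)
    Lattice-⊗ x y (α , β , x≡) (γ , δ , y≡) =
      α ℤ.* γ ℤ.+ n ℤ.* (β ℤ.* δ) , α ℤ.* δ ℤ.+ β ℤ.* γ ℤ.+ T ℤ.* (β ℤ.* δ) ,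
      trans (cong₂ _⊗_ x≡ y≡) (trans (⟪⟫-⊗ (ι α) (ι β) (ι γ) (ι δ)) (cong₂ ⟪_,_⟫
        (sym (trans (ι-+ (α ℤ.* γ) (n ℤ.* (β ℤ.* δ))) (cong₂ _+_ (ι-* α γ) (trans (ι-* n (β ℤ.* δ)) (cong (ν *_) (ι-* β δ))))))
        (sym (trans (ι-+ (α ℤ.* δ ℤ.+ β ℤ.* γ) (T ℤ.* (β ℤ.* δ))) (cong₂ _+_
          (trans (ι-+ (α ℤ.* δ) (β ℤ.* γ)) (cong₂ _+_ (ι-* α δ) (ι-* β γ)))
          (trans (ι-* T (β ℤ.* δ)) (cong (t *_) (ι-* β δ))))))))

    Lattice-conj : ∀ x → Lattice x → Lattice (conj x)
    Lattice-conj x (α , β , x≡) = α ℤ.+ T ℤ.* β , ℤ.- β ,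
      trans (cong conj x≡) (trans (conj-⟪⟫ (ι α) (ι β)) (cong₂ ⟪_,_⟫
        (sym (trans (ι-+ α (T ℤ.* β)) (cong (ι α ℚ.+_) (ι-* T β)))) (sym (ι-neg β))))

    -- `z` is a root of its characteristic polynomial X² - (Tr z) X + N z, whose coefficients are
    -- integers.
    Lattice⇒Integral : ∀ z → Lattice z → Integral z
    Lattice⇒Integral z (α , β , refl) = c₀ ∷ c₁ ∷ [] , (begin
      fromℚ (c₀ / 1) ⊕ z ⊗ (fromℚ (c₁ / 1) ⊕ z ⊗ 1K)
        ≡⟨ cong₂ (λ x y → fromℚ x ⊕ z ⊗ (fromℚ y ⊕ z ⊗ 1K)) (trans (sym (ι≡ c₀)) ι-c₀) (trans (sym (ι≡ c₁)) ι-c₁) ⟩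
      fromℚ a₀ ⊕ z ⊗ (fromℚ a₁ ⊕ z ⊗ 1K)
        ≡⟨ cong₂ _⊕_ (⟪⟫-fromℚ a₀) (cong (z ⊗_) (cong₂ _⊕_ (⟪⟫-fromℚ a₁) (⊗-identityʳ z))) ⟩
      ⟪ a₀ , 0ℚ ⟫ ⊕ z ⊗ (⟪ a₁ , 0ℚ ⟫ ⊕ z)
        ≡⟨ cong (λ x → ⟪ a₀ , 0ℚ ⟫ ⊕ z ⊗ x) (⟪⟫-⊕ a₁ 0ℚ p q) ⟩
      ⟪ a₀ , 0ℚ ⟫ ⊕ z ⊗ ⟪ a₁ + p , 0ℚ + q ⟫
        ≡⟨ cong (⟪ a₀ , 0ℚ ⟫ ⊕_) (⟪⟫-⊗ p q (a₁ + p) (0ℚ + q)) ⟩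
      ⟪ a₀ , 0ℚ ⟫ ⊕ ⟪ p * (a₁ + p) + ν * (q * (0ℚ + q)) , p * (0ℚ + q) + q * (a₁ + p) + t * (q * (0ℚ + q)) ⟫
        ≡⟨ ⟪⟫-⊕ a₀ 0ℚ (p * (a₁ + p) + ν * (q * (0ℚ + q))) (p * (0ℚ + q) + q * (a₁ + p) + t * (q * (0ℚ + q))) ⟩
      ⟪ a₀ + (p * (a₁ + p) + ν * (q * (0ℚ + q))) , 0ℚ + (p * (0ℚ + q) + q * (a₁ + p) + t * (q * (0ℚ + q))) ⟫
        ≡⟨ cong₂ ⟪_,_⟫ (lem₀ p q t ν) (lem₁ p q t) ⟩
      ⟪ 0ℚ , 0ℚ ⟫
        ≡⟨ ⟪⟫-fromℚ 0ℚ ⟨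
      0K ∎)
      where
      open ≡-Reasoning
      p q a₀ a₁ : ℚ
      p = ι α
      q = ι β
      a₀ = p * p + t * (p * q) - ν * (q * q)
      a₁ = - (p + p + t * q)
      c₀ c₁ : ℤ
      c₀ = α ℤ.* α ℤ.+ T ℤ.* (α ℤ.* β) ℤ.- n ℤ.* (β ℤ.* β)
      c₁ = ℤ.- (α ℤ.+ α ℤ.+ T ℤ.* β)
      ι-c₀ : ι c₀ ≡ a₀
      ι-c₀ = trans (ι-- (α ℤ.* α ℤ.+ T ℤ.* (α ℤ.* β)) (n ℤ.* (β ℤ.* β))) (cong₂ _-_
        (trans (ι-+ (α ℤ.* α) (T ℤ.* (α ℤ.* β))) (cong₂ _+_ (ι-* α α) (trans (ι-* T (α ℤ.* β)) (cong (t *_) (ι-* α β)))))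
        (trans (ι-* n (β ℤ.* β)) (cong (ν *_) (ι-* β β))))
      ι-c₁ : ι c₁ ≡ a₁
      ι-c₁ = trans (ι-neg (α ℤ.+ α ℤ.+ T ℤ.* β)) (cong -_ (trans (ι-+ (α ℤ.+ α) (T ℤ.* β)) (cong₂ _+_ (ι-+ α α) (ι-* T β))))
      lem₀ : ∀ p q t ν → p * p + t * (p * q) - ν * (q * q) + (p * (- (p + p + t * q) + p) + ν * (q * (0ℚ + q))) ≡ 0ℚ
      lem₀ = solve-∀ ℚ-ring
      lem₁ : ∀ p q t → 0ℚ + (p * (0ℚ + q) + q * (- (p + p + t * q) + p) + t * (q * (0ℚ + q))) ≡ 0ℚ
      lem₁ = solve-∀ ℚ-ring

  -- Lower bounds for quadratic forms at nonzero integer points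

  ι≢0 : ∀ {i} → i ≢ + 0 → ι i ≢ 0ℚ
  ι≢0 i≢0 eq = i≢0 (ι-injective (trans eq (sym ι-0)))

  -- Twice the form is p² + q² + (p + q)².
  0<p²+pq+q² : ∀ {p q} → p ≢ 0ℚ ⊎ q ≢ 0ℚ → 0ℚ < p * p + p * q + q * q
  0<p²+pq+q² {p} {q} h = 0<p+p⇒0<p (subst (0ℚ <_) (lem p q) (0<+ (sum h) (0≤² (p + q))))
    where
    lem : ∀ p q → p * p + q * q + (p + q) * (p + q) ≡ p * p + p * q + q * q + (p * p + p * q + q * q)
    lem = solve-∀ ℚ-ring
    sum : p ≢ 0ℚ ⊎ q ≢ 0ℚ → 0ℚ < p * p + q * q
    sum (inj₁ p≢0) = 0<+ (p≢0⇒0<p² p≢0) (0≤² q)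
    sum (inj₂ q≢0) = subst (0ℚ <_) (ℚ.+-comm (q * q) (p * p)) (0<+ (p≢0⇒0<p² q≢0) (0≤² p))

  0<ι⇒1≤ι : ∀ i → 0ℚ < ι i → 1ℚ ≤ ι i
  0<ι⇒1≤ι i 0<i = subst (_≤ ι i) ι-1 (ι-mono-≤ (ℤ.i<j⇒suc[i]≤j (ι-cancel-< (subst (_< ι i) (sym ι-0) 0<i))))

  ι-form : ∀ α β → ι (α ℤ.* α ℤ.+ α ℤ.* β ℤ.+ β ℤ.* β) ≡ ι α * ι α + ι α * ι β + ι β * ι β
  ι-form α β = trans (ι-+ (α ℤ.* α ℤ.+ α ℤ.* β) (β ℤ.* β)) (cong₂ _+_
    (trans (ι-+ (α ℤ.* α) (α ℤ.* β)) (cong₂ _+_ (ι-* α α) (ι-* α β))) (ι-* β β))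

  1≤α²+αβ+β² : ∀ α β → α ≢ + 0 ⊎ β ≢ + 0 → 1ℚ ≤ ι α * ι α + ι α * ι β + ι β * ι β
  1≤α²+αβ+β² α β h = subst (1ℚ ≤_) (ι-form α β) (0<ι⇒1≤ι (α ℤ.* α ℤ.+ α ℤ.* β ℤ.+ β ℤ.* β)
    (subst (0ℚ <_) (sym (ι-form α β)) (0<p²+pq+q² (nonzero h))))
    where
    nonzero : α ≢ + 0 ⊎ β ≢ + 0 → ι α ≢ 0ℚ ⊎ ι β ≢ 0ℚ
    nonzero (inj₁ α≢0) = inj₁ (ι≢0 α≢0)
    nonzero (inj₂ β≢0) = inj₂ (ι≢0 β≢0)

  1≤α²-αβ+β² : ∀ α β → α ≢ + 0 ⊎ β ≢ + 0 → 1ℚ ≤ ι α * ι α - ι α * ι β + ι β * ι β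
  1≤α²-αβ+β² α β h = subst (1ℚ ≤_) (trans (cong (λ b → ι α * ι α + ι α * b + b * b) (ι-neg β)) (lem (ι α) (ι β)))
    (1≤α²+αβ+β² α (ℤ.- β) (nonzero h))
    where
    lem : ∀ p q → p * p + p * - q + - q * - q ≡ p * p - p * q + q * q
    lem = solve-∀ ℚ-ring
    nonzero : α ≢ + 0 ⊎ β ≢ + 0 → α ≢ + 0 ⊎ ℤ.- β ≢ + 0
    nonzero (inj₁ α≢0) = inj₁ α≢0
    nonzero (inj₂ β≢0) = inj₂ λ eq → β≢0 (ℤ.neg-injective eq)

  2≤bound : ∀ T n → n ≢ + 0 → n ℤ.+ n ℤ.≤ T → + 2 ℤ.- (n ℤ.+ n) ℤ.≤ T → + 2 ℤ.≤ T
  2≤bound T (+ zero)  n≢0 _    _      = contradiction refl n≢0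
  2≤bound T (+ suc k) _   2n≤T _      = ℤ.≤-trans (ℤ.+≤+ (ℕ.s≤s (subst (1 ℕ.≤_) (sym (ℕ.+-suc k k)) (ℕ.s≤s ℕ.z≤n)))) 2n≤T
  2≤bound T -[1+ k ]  _   _    2-2n≤T = ℤ.≤-trans (ℤ.+≤+ (ℕ.s≤s (ℕ.s≤s ℕ.z≤n))) 2-2n≤T

  -- The two perfect forms

  module Forms (d : ℕ) (0<d : 0 ℕ.< d) (T n e : ℤ) (h g g⁻¹ : ℚ)
    (h+h≡T : h + h ≡ ι T)
    (g²d≡h²+n : g * g * QuadraticField.dℚ d ≡ h * h + ι n)
    (g⁻¹*g≡1 : g⁻¹ * g ≡ 1ℚ)
    (T≡en : T ≡ e ℤ.* n)
    (n≢0 : n ≢ + 0)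
    (2n≤T : n ℤ.+ n ℤ.≤ T)
    (2-2n≤T : + 2 ℤ.- (n ℤ.+ n) ℤ.≤ T)
    (Integral⇒Lattice : ∀ z → QuadraticField.Integral d z → Basis.Lattice d 0<d T n h g g⁻¹ h+h≡T g²d≡h²+n g⁻¹*g≡1 z)
    where

    open QuadraticField d
    open IntegralClosure d using (norm; norm-⊗)
    open Field d 0<d
    open Basis d 0<d T n h g g⁻¹ h+h≡T g²d≡h²+n g⁻¹*g≡1

    -- Signs of the constants built from `T` and `n`

    2ℚ η τ : ℚ
    2ℚ = 1ℚ + 1ℚ
    η = ι e
    τ = t * Δ

    t≡ην : t ≡ η * ν
    t≡ην = trans (cong ι T≡en) (ι-* e n)

    ι-2 : ι (+ 2) ≡ 2ℚ
    ι-2 = trans (ι-+ (+ 1) (+ 1)) (cong₂ _+_ ι-1 ι-1)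

    0≤t-2 : 0ℚ ≤ t - 2ℚ
    0≤t-2 = 0≤diff (subst (_≤ t) ι-2 (ι-mono-≤ (2≤bound T n n≢0 2n≤T 2-2n≤T)))

    0≤t-2ν : 0ℚ ≤ t - (ν + ν)
    0≤t-2ν = 0≤diff (subst (_≤ t) (ι-+ n n) (ι-mono-≤ 2n≤T))

    0≤t-2+2ν : 0ℚ ≤ t - 2ℚ + (ν + ν)
    0≤t-2+2ν = subst (0ℚ ≤_) (lem t 2ℚ (ν + ν)) (0≤diff (subst (_≤ t)
        (trans (ι-- (+ 2) (n ℤ.+ n)) (cong₂ _-_ ι-2 (ι-+ n n))) (ι-mono-≤ 2-2n≤T)))
      where
      lem : ∀ t c x → t - (c - x) ≡ t - c + x
      lem = solve-∀ ℚ-ring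

    0<1ℚ : 0ℚ < 1ℚ
    0<1ℚ = ℚ.positive⁻¹ 1ℚ

    0<t : 0ℚ < t
    0<t = subst (0ℚ <_) (lem t) (0<+ (ℚ.positive⁻¹ 2ℚ) 0≤t-2)
      where
      lem : ∀ t → 1ℚ + 1ℚ + (t - (1ℚ + 1ℚ)) ≡ t
      lem = solve-∀ ℚ-ring

    0<Δ : 0ℚ < Δ
    0<Δ = subst (0ℚ <_) (lem t ν) (0<+ (0<+ (0<+ (ℚ.positive⁻¹ (1ℚ + 1ℚ + 1ℚ)) (0≤² (t - 1ℚ))) 0≤t-2+2ν) 0≤t-2+2ν)
      where
      lem : ∀ t ν → 1ℚ + 1ℚ + 1ℚ + (t - 1ℚ) * (t - 1ℚ) + (t - (1ℚ + 1ℚ) + (ν + ν)) + (t - (1ℚ + 1ℚ) + (ν + ν))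
        ≡ t * t + (ν + ν + (ν + ν))
      lem = solve-∀ ℚ-ring

    0<τ : 0ℚ < τ
    0<τ = 0<* 0<t 0<Δ

    -- Up to the factor `τ`, this is the scale `κ` in the cone of `P₁` and `P₂`; its positivity also
    -- separates these two forms.
    0<t²-2+2ν : 0ℚ < t * t - 2ℚ + (ν + ν)
    0<t²-2+2ν = subst (0ℚ <_) (lem t ν) (0<+ (0<+ 0<t (0≤* (ℚ.<⇒≤ 0<t) 0≤t-2)) 0≤t-2+2ν)
      where
      lem : ∀ t ν → t + t * (t - (1ℚ + 1ℚ)) + (t - (1ℚ + 1ℚ) + (ν + ν)) ≡ t * t - (1ℚ + 1ℚ) + (ν + ν)
      lem = solve-∀ ℚ-ring

    -- This is N(P₁) / Δ. Four times it is the product of 2 t - 2 + 2 ν and 2 t + 2 - 2 ν.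
    0<t²-[1-ν]² : 0ℚ < t * t - (1ℚ - ν) * (1ℚ - ν)
    0<t²-[1-ν]² = 0<p+p⇒0<p (0<p+p⇒0<p (subst (0ℚ <_) (lem t ν)
        (0<* (0<+ 0<t 0≤t-2+2ν) (0<+ (0<+ 0<t 0≤t-2ν) (ℚ.nonNegative⁻¹ 2ℚ)))))
      where
      lem : ∀ t ν → (t + (t - (1ℚ + 1ℚ) + (ν + ν))) * (t + (t - (ν + ν)) + (1ℚ + 1ℚ))
        ≡ t * t - (1ℚ - ν) * (1ℚ - ν) + (t * t - (1ℚ - ν) * (1ℚ - ν)) + (t * t - (1ℚ - ν) * (1ℚ - ν) + (t * t - (1ℚ - ν) * (1ℚ - ν)))
      lem = solve-∀ ℚ-ring

    -- Up to the factor `Δ`, this is the scale `κ` in the cone of `P₁` and `P₃`. The sign of η = t /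
    -- ν is not known, so the inequality is first multiplied by ν², which turns it into t (t² - 2 ν²
    -- + 2 ν) > 0.
    0<η²t-2t+2η : 0ℚ < η * η * t - (t + t) + (η + η)
    0<η²t-2t+2η = *-cancelˡ-< 0<ν² (subst₂ _<_ (sym (ℚ.*-zeroʳ (ν * ν))) (sym eq)
        (0<* 0<t (0<p+p⇒0<p (subst (0ℚ <_) (lem₂ t ν) (0<+ (0<+ (0<* 0<t 0<t) (0≤+ (ℚ.<⇒≤ 0<t) (ℚ.<⇒≤ 0<t))) (0≤* 0≤t-2ν 0≤t-2+2ν))))))
      where
      0<ν² : 0ℚ < ν * ν
      0<ν² = p≢0⇒0<p² (ι≢0 n≢0)
      lem₁ : ∀ η ν t → ν * ν * (η * η * t - (t + t) + (η + η)) ≡ (η * ν) * (η * ν) * t - (ν * ν * t + ν * ν * t) + (ν * (η * ν) + ν * (η * ν))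
      lem₁ = solve-∀ ℚ-ring
      lem₃ : ∀ ν t → t * t * t - (ν * ν * t + ν * ν * t) + (ν * t + ν * t) ≡ t * (t * t - (ν * ν + ν * ν) + (ν + ν))
      lem₃ = solve-∀ ℚ-ring
      eq : ν * ν * (η * η * t - (t + t) + (η + η)) ≡ t * (t * t - (ν * ν + ν * ν) + (ν + ν))
      eq = trans (lem₁ η ν t) (trans (cong (λ x → x * x * t - (ν * ν * t + ν * ν * t) + (ν * x + ν * x)) (sym t≡ην)) (lem₃ ν t))
      lem₂ : ∀ t ν → t * t + (t + t) + (t - (ν + ν)) * (t - (1ℚ + 1ℚ) + (ν + ν))
        ≡ t * t - (ν * ν + ν * ν) + (ν + ν) + (t * t - (ν * ν + ν * ν) + (ν + ν))
      lem₂ = solve-∀ ℚ-ring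

    injective : ∀ a b → Tr a ≡ Tr b → Trξ a ≡ Trξ b → a ≡ b
    injective = Tr-Trξ-injective 0<Δ

    -- The solution of Tr P₁ = t Δ and Tr (P₁ ξ) = (1 - ν) Δ, chosen so that the trace form is Δ (t
    -- α² + 2 (1 - ν) α β + t β²). The factor `Δ` is the determinant of the system and spares the
    -- denominators.
    P₁ : K
    P₁ = ⟪ t * (t * t + (ν + ν + ν) - 1ℚ) , 2ℚ - (ν + ν) - t * t ⟫

    Tr-P₁ : Tr P₁ ≡ τ
    Tr-P₁ = trans (Tr-⟪⟫ (t * (t * t + (ν + ν + ν) - 1ℚ)) (2ℚ - (ν + ν) - t * t)) (lem t ν)
      where
      lem : ∀ t ν → t * (t * t + (ν + ν + ν) - 1ℚ) + t * (t * t + (ν + ν + ν) - 1ℚ) + t * (1ℚ + 1ℚ - (ν + ν) - t * t)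
        ≡ t * (t * t + (ν + ν + (ν + ν)))
      lem = solve-∀ ℚ-ring

    Trξ-P₁ : Trξ P₁ ≡ (1ℚ - ν) * Δ
    Trξ-P₁ = trans (Trξ-⟪⟫ (t * (t * t + (ν + ν + ν) - 1ℚ)) (2ℚ - (ν + ν) - t * t)) (lem t ν)
      where
      lem : ∀ t ν → t * (t * (t * t + (ν + ν + ν) - 1ℚ)) + (t * t + (ν + ν)) * (1ℚ + 1ℚ - (ν + ν) - t * t)
        ≡ (1ℚ - ν) * (t * t + (ν + ν + (ν + ν)))
      lem = solve-∀ ℚ-ring

    trForm-P₁ : ∀ α β → trForm P₁ ⟪ α , β ⟫ ≡ Q τ ((1ℚ - ν) * Δ) α β
    trForm-P₁ α β = trans (trForm-Q P₁ α β) (cong₂ (λ A B → Q A B α β) Tr-P₁ Trξ-P₁)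

    -- With w = 2 − 2ν the form t α² + w α β + t β² is the mean of α² + α β + β²
    -- and α² − α β + β² with the nonnegative weights t + w and t − w.
    Q-P₁-excess : ∀ α β → Q τ ((1ℚ - ν) * Δ) α β - τ + (Q τ ((1ℚ - ν) * Δ) α β - τ) ≡
      Δ * ((2ℚ + (t - (ν + ν))) * (α * α + α * β + β * β - 1ℚ) + (t - 2ℚ + (ν + ν)) * (α * α - α * β + β * β - 1ℚ))
    Q-P₁-excess = lem t ν Δ
      where
      lem : ∀ t ν Δ α β →
        t * Δ * (α * α) + ((1ℚ - ν) * Δ + (1ℚ - ν) * Δ) * (α * β) + (t * ((1ℚ - ν) * Δ) + ν * (t * Δ)) * (β * β) - t * Δ
        + (t * Δ * (α * α) + ((1ℚ - ν) * Δ + (1ℚ - ν) * Δ) * (α * β) + (t * ((1ℚ - ν) * Δ) + ν * (t * Δ)) * (β * β) - t * Δ)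
        ≡ Δ * ((1ℚ + 1ℚ + (t - (ν + ν))) * (α * α + α * β + β * β - 1ℚ) + (t - (1ℚ + 1ℚ) + (ν + ν)) * (α * α - α * β + β * β - 1ℚ))
      lem = solve-∀ ℚ-ring

    -- Closure under products is not visible from the monic polynomials of the factors; it comes
    -- from the multiplication table of the lattice.
    Integral-⊗ : ∀ x y → Integral x → Integral y → Integral (x ⊗ y)
    Integral-⊗ x y x-int y-int = Lattice⇒Integral (x ⊗ y) (Lattice-⊗ x y (Integral⇒Lattice x x-int) (Integral⇒Lattice y y-int))

    Integral-conj : ∀ x → Integral x → Integral (conj x)
    Integral-conj x x-int = Lattice⇒Integral (conj x) (Lattice-conj x (Integral⇒Lattice x x-int))

    Integral-1K : Integral 1K
    Integral-1K = Lattice⇒Integral 1K Lattice-1K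

    1K≢0K : 1K ≢ 0K
    1K≢0K eq = ℚ.1≢0 (cong re eq)

    Unit-⊗ : ∀ {u v} → Unit u → Unit v → Unit (u ⊗ v)
    Unit-⊗ {u} {v} (u-int , u′ , u′-int , uu′≡1) (v-int , v′ , v′-int , vv′≡1) =
      Integral-⊗ u v u-int v-int , u′ ⊗ v′ , Integral-⊗ u′ v′ u′-int v′-int ,
      trans (⊗-interchange u v u′ v′) (trans (cong₂ _⊗_ uu′≡1 vv′≡1) (⊗-identityʳ 1K))

    Unit-1K : Unit 1K
    Unit-1K = Integral-1K , 1K , Integral-1K , ⊗-identityʳ 1K

    _⁻¹ᵁ : ∀ {u} → Unit u → K
    (_ , u′ , _) ⁻¹ᵁ = u′

    Unit-inverse : ∀ {u} (u-unit : Unit u) → Unit (u-unit ⁻¹ᵁ)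
    Unit-inverse {u} (u-int , u′ , u′-int , uu′≡1) = u′-int , u , u-int , trans (⊗-comm u′ u) uu′≡1

    Unit⇒norm≢0 : ∀ {u} → Unit u → norm u ≢ 0ℚ
    Unit⇒norm≢0 {u} (_ , u′ , _ , uu′≡1) eq = ℚ.1≢0 (begin
      1ℚ                ≡⟨ lem dℚ ⟩
      norm 1K           ≡⟨ cong norm uu′≡1 ⟨
      norm (u ⊗ u′)     ≡⟨ norm-⊗ u u′ ⟩
      norm u * norm u′  ≡⟨ cong (_* norm u′) eq ⟩
      0ℚ * norm u′      ≡⟨ ℚ.*-zeroˡ (norm u′) ⟩
      0ℚ                ∎)
      where
      open ≡-Reasoning
      lem : ∀ D → 1ℚ ≡ 1ℚ * 1ℚ - D * (0ℚ * 0ℚ)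
      lem = solve-∀ ℚ-ring

    cancel-unit : ∀ {u} (u-unit : Unit u) x → u ⊗ (u-unit ⁻¹ᵁ ⊗ x) ≡ x
    cancel-unit {u} (_ , u′ , _ , uu′≡1) x = trans (sym (⊗-assoc u u′ x)) (trans (cong (_⊗ x) uu′≡1) (⊗-identityˡ x))

    cancel-unit² : ∀ {u} (u-unit : Unit u) a → (a ⊗ (u-unit ⁻¹ᵁ) ²) ⊗ u ² ≡ a
    cancel-unit² {u} (_ , u′ , _ , uu′≡1) a = begin
      (a ⊗ u′ ²) ⊗ u ²       ≡⟨ ⊗-assoc a (u′ ²) (u ²) ⟩
      a ⊗ (u′ ² ⊗ u ²)       ≡⟨ cong (a ⊗_) (⊗-interchange u′ u′ u u) ⟩
      a ⊗ (u′ ⊗ u) ²         ≡⟨ cong (λ x → a ⊗ x ²) (trans (⊗-comm u′ u) uu′≡1) ⟩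
      a ⊗ 1K ²               ≡⟨ cong (a ⊗_) (⊗-identityʳ 1K) ⟩
      a ⊗ 1K                 ≡⟨ ⊗-identityʳ a ⟩
      a                      ∎
      where open ≡-Reasoning

    NonZeroIntegral-⊗ : ∀ {u} → Unit u → ∀ x → NonZeroIntegral x → NonZeroIntegral (u ⊗ x)
    NonZeroIntegral-⊗ {u} u-unit@(u-int , u′ , _ , uu′≡1) x (x-int , x≢0) =
      Integral-⊗ u x u-int x-int , λ ux≡0 → x≢0 (begin
        x              ≡⟨ cancel-unit {u′} (Unit-inverse u-unit) x ⟨
        u′ ⊗ (u ⊗ x)   ≡⟨ cong (u′ ⊗_) ux≡0 ⟩
        u′ ⊗ 0K        ≡⟨ ⊗-zeroʳ u′ ⟩
        0K             ∎)
      where open ≡-Reasoning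

    NonZeroIntegral-1K : NonZeroIntegral 1K
    NonZeroIntegral-1K = Integral-1K , 1K≢0K

    Unit⇒NonZeroIntegral : ∀ {u} → Unit u → NonZeroIntegral u
    Unit⇒NonZeroIntegral {u} u-unit = subst NonZeroIntegral (⊗-identityʳ u) (NonZeroIntegral-⊗ u-unit 1K NonZeroIntegral-1K)

    NonZeroIntegral-conj : ∀ x → NonZeroIntegral x → NonZeroIntegral (conj x)
    NonZeroIntegral-conj x (x-int , x≢0) = Integral-conj x x-int , λ eq → x≢0 (trans (sym (conj-involutive x)) (cong conj eq))

    NonZeroIntegral⇒ : ∀ x → NonZeroIntegral x → ∃[ α ] ∃[ β ] x ≡ ⟪ ι α , ι β ⟫ × (α ≢ + 0 ⊎ β ≢ + 0)
    NonZeroIntegral⇒ x (x-int , x≢0) = α , β , x≡ , nonzero (α ℤ.≟ + 0) (β ℤ.≟ + 0)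
      where
      α β : ℤ
      α = proj₁ (Integral⇒Lattice x x-int)
      β = proj₁ (proj₂ (Integral⇒Lattice x x-int))
      x≡ = proj₂ (proj₂ (Integral⇒Lattice x x-int))
      nonzero : Dec (α ≡ + 0) → Dec (β ≡ + 0) → α ≢ + 0 ⊎ β ≢ + 0
      nonzero (no α≢0) _        = inj₁ α≢0
      nonzero _        (no β≢0) = inj₂ β≢0
      nonzero (yes α≡0) (yes β≡0) = contradiction
        (trans x≡ (trans (cong₂ ⟪_,_⟫ (trans (cong ι α≡0) ι-0) (trans (cong ι β≡0) ι-0)) (sym (⟪⟫-fromℚ 0ℚ)))) x≢0

    BoundedBelow : K → Set
    BoundedBelow a = ∀ y → NonZeroIntegral y → τ ≤ trForm a y

    -- Both α² + α β + β² and α² - α β + β² are at least 1 at nonzero integer points, so both terms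
    -- of `Q-P₁-excess` are nonnegative.
    P₁-bounded : BoundedBelow P₁
    P₁-bounded y y-nz = subst (τ ≤_) (sym (trans (cong (trForm P₁) y≡) (trForm-P₁ (ι α) (ι β)))) (≤-by-diff refl (0≤p+p⇒0≤p
        (subst (0ℚ ≤_) (sym (Q-P₁-excess (ι α) (ι β))) (0≤* (ℚ.<⇒≤ 0<Δ)
          (0≤+ (0≤* (0≤+ (ℚ.nonNegative⁻¹ 2ℚ) 0≤t-2ν) (0≤diff (1≤α²+αβ+β² α β αβ≢0)))
               (0≤* 0≤t-2+2ν (0≤diff (1≤α²-αβ+β² α β αβ≢0))))))))
      where
      rep = NonZeroIntegral⇒ y y-nz
      α β : ℤ
      α = proj₁ rep
      β = proj₁ (proj₂ rep)
      y≡ = proj₁ (proj₂ (proj₂ rep))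
      αβ≢0 = proj₂ (proj₂ (proj₂ rep))

    BoundedBelow-conj : ∀ a → BoundedBelow a → BoundedBelow (conj a)
    BoundedBelow-conj a a-bd y y-nz = subst (τ ≤_) (sym (trForm-conj a y)) (a-bd (conj y) (NonZeroIntegral-conj y y-nz))

    BoundedBelow-⊗² : ∀ a {u} → Unit u → BoundedBelow a → BoundedBelow (a ⊗ u ²)
    BoundedBelow-⊗² a {u} u-unit a-bd y y-nz = subst (τ ≤_) (sym (trForm-⊗² a u y)) (a-bd (u ⊗ y) (NonZeroIntegral-⊗ u-unit y y-nz))

    -- ε = ξ² / n.
    ε ε̄ : K
    ε = ⟪ 1ℚ , η ⟫
    ε̄ = ⟪ 1ℚ + η * t , - η ⟫

    -- `ε̄` is the conjugate of `ε`, so the product is the norm 1 + t η - ν η², and t = η ν cancels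
    -- the last two terms.
    ε⊗ε̄ : ε ⊗ ε̄ ≡ 1K
    ε⊗ε̄ = trans (⟪⟫-⊗ 1ℚ η (1ℚ + η * t) (- η)) (trans (cong₂ ⟪_,_⟫
        (trans (cong (λ t → 1ℚ * (1ℚ + η * t) + ν * (η * - η)) t≡ην) (lem₁ η ν)) (lem₂ η t)) (sym (⟪⟫-fromℚ 1ℚ)))
      where
      lem₁ : ∀ η ν → 1ℚ * (1ℚ + η * (η * ν)) + ν * (η * - η) ≡ 1ℚ
      lem₁ = solve-∀ ℚ-ring
      lem₂ : ∀ η t → 1ℚ * - η + η * (1ℚ + η * t) + t * (η * - η) ≡ 0ℚ
      lem₂ = solve-∀ ℚ-ring

    ε-Integral : Integral ε
    ε-Integral = Lattice⇒Integral ε (+ 1 , e , cong ⟪_, η ⟫ (sym ι-1))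

    ε̄-Integral : Integral ε̄
    ε̄-Integral = Lattice⇒Integral ε̄ (+ 1 ℤ.+ e ℤ.* T , ℤ.- e , sym (cong₂ ⟪_,_⟫
      (trans (ι-+ (+ 1) (e ℤ.* T)) (cong₂ _+_ ι-1 (ι-* e T))) (ι-neg e)))

    ε-Unit : Unit ε
    ε-Unit = ε-Integral , ε̄ , ε̄-Integral , ε⊗ε̄

    ε̄-Unit : Unit ε̄
    ε̄-Unit = Unit-inverse ε-Unit

    trForm-ξ : ∀ a → trForm a ξ ≡ t * Trξ a + ν * Tr a
    trForm-ξ a = trans (trForm-Q a 0ℚ 1ℚ) (lem (Tr a) (Trξ a) t ν)
      where
      lem : ∀ A B t ν → A * (0ℚ * 0ℚ) + (B + B) * (0ℚ * 1ℚ) + (t * B + ν * A) * (1ℚ * 1ℚ) ≡ t * B + ν * A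
      lem = solve-∀ ℚ-ring

    -- Since `ε̄` sends ξ to - conj ξ and ε to 1, the form `P₃` takes the value `τ` at ξ and ε. It
    -- thus shares the vector ξ with `P₁`, just as `P₂` shares the vector 1.
    P₂ P₃ : K
    P₂ = conj P₁
    P₃ = P₂ ⊗ ε̄ ²

    Tr-P₂ : Tr P₂ ≡ τ
    Tr-P₂ = trans (Tr-conj P₁) Tr-P₁

    Trξ-P₂ : Trξ P₂ ≡ t * τ - (1ℚ - ν) * Δ
    Trξ-P₂ = trans (Trξ-conj P₁) (cong₂ (λ A B → t * A - B) Tr-P₁ Trξ-P₁)

    Tr-P₃ : Tr P₃ ≡ (η * η * t - t + (η + η)) * Δ
    Tr-P₃ = trans (sym (trForm-1K P₃)) (trans (trForm-⊗² P₂ ε̄ 1K) (trans (cong (trForm P₂) (⊗-identityʳ ε̄))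
      (trans (trForm-Q P₂ (1ℚ + η * t) (- η)) (trans (cong₂ (λ A B → Q A B (1ℚ + η * t) (- η)) Tr-P₂ Trξ-P₂)
        (lem t ν Δ η t≡ην)))))
      where
      lem₀ : ∀ ν Δ η → ((η * ν) * Δ) * ((1ℚ + η * (η * ν)) * (1ℚ + η * (η * ν))) + (((η * ν) * ((η * ν) * Δ) - (1ℚ - ν) * Δ) + ((η * ν) * ((η * ν) * Δ) - (1ℚ - ν) * Δ)) * ((1ℚ + η * (η * ν)) * - η) + ((η * ν) * ((η * ν) * ((η * ν) * Δ) - (1ℚ - ν) * Δ) + ν * ((η * ν) * Δ)) * (- η * - η)
        ≡ (η * η * (η * ν) - (η * ν) + (η + η)) * Δ
      lem₀ = solve-∀ ℚ-ring
      -- The identity holds only modulo t = η ν, so `t` is eliminated before the ring solver is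
      -- called.
      lem : ∀ t ν Δ η → t ≡ η * ν → (t * Δ) * ((1ℚ + η * t) * (1ℚ + η * t)) + ((t * (t * Δ) - (1ℚ - ν) * Δ) + (t * (t * Δ) - (1ℚ - ν) * Δ)) * ((1ℚ + η * t) * - η) + (t * (t * (t * Δ) - (1ℚ - ν) * Δ) + ν * (t * Δ)) * (- η * - η)
        ≡ (η * η * t - t + (η + η)) * Δ
      lem t ν Δ η refl = lem₀ ν Δ η

    Trξ-P₃ : Trξ P₃ ≡ (ν - 1ℚ - η * t) * Δ
    Trξ-P₃ = trans (Trξ-⊗² P₂ (1ℚ + η * t) (- η)) (trans (cong₂ (λ A B →
        ν * ((1ℚ + η * t) * - η + (1ℚ + η * t) * - η + t * (- η * - η)) * A
        + ((1ℚ + η * t) * (1ℚ + η * t) + ν * (- η * - η) + t * ((1ℚ + η * t) * - η + (1ℚ + η * t) * - η) + t * t * (- η * - η)) * B) Tr-P₂ Trξ-P₂)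
        (lem t ν Δ η t≡ην))
      where
      lem₀ : ∀ ν Δ η → ν * ((1ℚ + η * (η * ν)) * - η + (1ℚ + η * (η * ν)) * - η + (η * ν) * (- η * - η)) * ((η * ν) * Δ) + ((1ℚ + η * (η * ν)) * (1ℚ + η * (η * ν)) + ν * (- η * - η) + (η * ν) * ((1ℚ + η * (η * ν)) * - η + (1ℚ + η * (η * ν)) * - η) + (η * ν) * (η * ν) * (- η * - η)) * ((η * ν) * ((η * ν) * Δ) - (1ℚ - ν) * Δ)
        ≡ (ν - 1ℚ - η * (η * ν)) * Δ
      lem₀ = solve-∀ ℚ-ring
      lem : ∀ t ν Δ η → t ≡ η * ν → ν * ((1ℚ + η * t) * - η + (1ℚ + η * t) * - η + t * (- η * - η)) * (t * Δ) + ((1ℚ + η * t) * (1ℚ + η * t) + ν * (- η * - η) + t * ((1ℚ + η * t) * - η + (1ℚ + η * t) * - η) + t * t * (- η * - η)) * (t * (t * Δ) - (1ℚ - ν) * Δ)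
        ≡ (ν - 1ℚ - η * t) * Δ
      lem t ν Δ η refl = lem₀ ν Δ η

    trForm-P₁-1K : trForm P₁ 1K ≡ τ
    trForm-P₁-1K = trans (trForm-1K P₁) Tr-P₁

    trForm-P₂-1K : trForm P₂ 1K ≡ τ
    trForm-P₂-1K = trans (trForm-1K P₂) Tr-P₂

    trForm-P₁-ξ : trForm P₁ ξ ≡ τ
    trForm-P₁-ξ = trans (trForm-ξ P₁) (trans (cong₂ (λ A B → t * B + ν * A) Tr-P₁ Trξ-P₁) (lem t ν Δ))
      where
      lem : ∀ t ν Δ → t * ((1ℚ - ν) * Δ) + ν * (t * Δ) ≡ t * Δ
      lem = solve-∀ ℚ-ring

    NonZeroIntegral-ξ : NonZeroIntegral ξ
    NonZeroIntegral-ξ = Lattice⇒Integral ξ (+ 0 , + 1 , sym (cong₂ ⟪_,_⟫ ι-0 ι-1)) , λ eq →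
      ℚ.<-irrefl (trans (sym (trForm-0K P₁)) (trans (cong (trForm P₁) (sym eq)) trForm-P₁-ξ)) 0<τ

    trForm-P₃-ξ : trForm P₃ ξ ≡ τ
    trForm-P₃-ξ = trans (trForm-ξ P₃) (trans (cong₂ (λ A B → t * B + ν * A) Tr-P₃ Trξ-P₃) (lem t ν Δ η t≡ην))
      where
      lem₀ : ∀ ν Δ η → (η * ν) * ((ν - 1ℚ - η * (η * ν)) * Δ) + ν * ((η * η * (η * ν) - (η * ν) + (η + η)) * Δ) ≡ (η * ν) * Δ
      lem₀ = solve-∀ ℚ-ring
      lem : ∀ t ν Δ η → t ≡ η * ν → t * ((ν - 1ℚ - η * t) * Δ) + ν * ((η * η * t - t + (η + η)) * Δ) ≡ t * Δ
      lem t ν Δ η refl = lem₀ ν Δ η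

    P₁-TotallyPositive : TotallyPositive P₁
    P₁-TotallyPositive = ⇒TotallyPositive P₁
        (0<p+p⇒0<p (subst (0ℚ <_) (trans (sym Tr-P₁) (Tr≡ P₁)) 0<τ))
        (subst (0ℚ <_) (sym (trans (norm-⟪⟫ p q) (lem t ν))) (0<* 0<Δ 0<t²-[1-ν]²))
      where
      p q : ℚ
      p = t * (t * t + (ν + ν + ν) - 1ℚ)
      q = 2ℚ - (ν + ν) - t * t
      lem : ∀ t ν →
        t * (t * t + (ν + ν + ν) - 1ℚ) * (t * (t * t + (ν + ν + ν) - 1ℚ))
        + t * (t * (t * t + (ν + ν + ν) - 1ℚ) * (1ℚ + 1ℚ - (ν + ν) - t * t))
        - ν * ((1ℚ + 1ℚ - (ν + ν) - t * t) * (1ℚ + 1ℚ - (ν + ν) - t * t))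
        ≡ (t * t + (ν + ν + (ν + ν))) * (t * t - (1ℚ - ν) * (1ℚ - ν))
      lem = solve-∀ ℚ-ring

    -- Perfect forms and the cones between neighbouring ones

    -- Multiplication by the inverse `ū` carries the minimal vectors of `a` to those of a u², and a
    -- competitor `b` of a u² is carried back to the competitor b ū² of `a`.
    Perfect-⊗² : ∀ {a u} → Unit u → Perfect a → Perfect (a ⊗ u ²)
    Perfect-⊗² {a} {u} u-unit (a-tp , m , ((x , x-nz , ax≡m) , m-min) , unique) =
      TotallyPositive-⊗² a u a-tp (Unit⇒norm≢0 u-unit) , m ,
      ((ū ⊗ x , NonZeroIntegral-⊗ ū-unit x x-nz , trans (trForm-⊗² a u (ū ⊗ x)) (trans (cong (trForm a) (cancel-unit u-unit x)) ax≡m)) ,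
        λ y y-nz → subst (m ≤_) (sym (trForm-⊗² a u y)) (m-min (u ⊗ y) (NonZeroIntegral-⊗ u-unit y y-nz))) ,
      λ b b-tp bv≡m → begin
        b                    ≡⟨ cancel-unit² u-unit b ⟨
        (b ⊗ ū ²) ⊗ u ²      ≡⟨ cong (_⊗ u ²) (unique (b ⊗ ū ²) (TotallyPositive-⊗² b ū b-tp (Unit⇒norm≢0 ū-unit))
                                  (λ v v∈ → trans (trForm-⊗² b ū v) (bv≡m (ū ⊗ v) (shift v v∈)))) ⟩
        a ⊗ u ²              ∎
      where
      open ≡-Reasoning
      ū : K
      ū = u-unit ⁻¹ᵁ
      ū-unit = Unit-inverse u-unit
      au²-ūv : ∀ v → trForm (a ⊗ u ²) (ū ⊗ v) ≡ trForm a v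
      au²-ūv v = trans (trForm-⊗² a u (ū ⊗ v)) (cong (trForm a) (cancel-unit u-unit v))
      shift : ∀ v → ℳ a v → ℳ (a ⊗ u ²) (ū ⊗ v)
      shift v (v-int , (y , y-nz , ay≡av) , v-min) = Integral-⊗ ū v (proj₁ ū-unit) v-int ,
        (ū ⊗ y , NonZeroIntegral-⊗ ū-unit y y-nz , trans (au²-ūv y) (trans ay≡av (sym (au²-ūv v)))) ,
        λ z z-nz → subst₂ _≤_ (sym (au²-ūv v)) (sym (trForm-⊗² a u z)) (v-min (u ⊗ z) (NonZeroIntegral-⊗ u-unit z z-nz))

    Perfect-conj : ∀ {a} → Perfect a → Perfect (conj a)
    Perfect-conj {a} (a-tp , m , ((x , x-nz , ax≡m) , m-min) , unique) =
      TotallyPositive-conj a a-tp , m ,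
      ((conj x , NonZeroIntegral-conj x x-nz , trans (conj-form x) ax≡m) ,
        λ y y-nz → subst (m ≤_) (sym (trForm-conj a y)) (m-min (conj y) (NonZeroIntegral-conj y y-nz))) ,
      λ b b-tp bv≡m → trans (sym (conj-involutive b)) (cong conj (unique (conj b) (TotallyPositive-conj b b-tp)
        λ v v∈ → trans (trForm-conj b v) (bv≡m (conj v) (shift v v∈))))
      where
      conj-form : ∀ v → trForm (conj a) (conj v) ≡ trForm a v
      conj-form v = trans (trForm-conj a (conj v)) (cong (trForm a) (conj-involutive v))
      shift : ∀ v → ℳ a v → ℳ (conj a) (conj v)
      shift v (v-int , (y , y-nz , ay≡av) , v-min) = Integral-conj v v-int ,
        (conj y , NonZeroIntegral-conj y y-nz , trans (conj-form y) (trans ay≡av (sym (conj-form v)))) ,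
        λ z z-nz → subst₂ _≤_ (sym (conj-form v)) (sym (trForm-conj a z)) (v-min (conj z) (NonZeroIntegral-conj z z-nz))

    -- The value at 1 fixes Tr b, and then, because t is positive, the value t Tr (b ξ) + ν Tr b at
    -- ξ fixes Tr (b ξ).
    Perfect-P₁ : Perfect P₁
    Perfect-P₁ = P₁-TotallyPositive , τ , ((1K , NonZeroIntegral-1K , trForm-P₁-1K) , P₁-bounded) , unique
      where
      minimal : ∀ v → NonZeroIntegral v → trForm P₁ v ≡ τ → ℳ P₁ v
      minimal v v-nz eq = proj₁ v-nz , (v , v-nz , refl) , λ y y-nz → subst (_≤ trForm P₁ y) (sym eq) (P₁-bounded y y-nz)
      unique : ∀ b → TotallyPositive b → (∀ v → ℳ P₁ v → trForm b v ≡ τ) → b ≡ P₁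
      unique b _ bv≡τ = injective b P₁ (trans Tr-b (sym Tr-P₁)) (*-cancelˡ-≡ 0<t (begin
        t * Trξ b                          ≡⟨ lem (t * Trξ b) (ν * τ) ⟩
        t * Trξ b + ν * τ - ν * τ          ≡⟨ cong (λ A → t * Trξ b + ν * A - ν * τ) Tr-b ⟨
        t * Trξ b + ν * Tr b - ν * τ       ≡⟨ cong (_- ν * τ) (trForm-ξ b) ⟨
        trForm b ξ - ν * τ                 ≡⟨ cong (_- ν * τ) (trans (bv≡τ ξ (minimal ξ NonZeroIntegral-ξ trForm-P₁-ξ)) (sym trForm-P₁-ξ)) ⟩
        trForm P₁ ξ - ν * τ                ≡⟨ cong (_- ν * τ) (trForm-ξ P₁) ⟩
        t * Trξ P₁ + ν * Tr P₁ - ν * τ     ≡⟨ cong (λ A → t * Trξ P₁ + ν * A - ν * τ) Tr-P₁ ⟩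
        t * Trξ P₁ + ν * τ - ν * τ         ≡⟨ lem (t * Trξ P₁) (ν * τ) ⟨
        t * Trξ P₁                         ∎))
        where
        open ≡-Reasoning
        Tr-b : Tr b ≡ τ
        Tr-b = trans (sym (trForm-1K b)) (bv≡τ 1K (minimal 1K NonZeroIntegral-1K trForm-P₁-1K))
        lem : ∀ x y → x ≡ x + y - y
        lem = solve-∀ ℚ-ring

    Perfect-P₂ : Perfect P₂
    Perfect-P₂ = Perfect-conj Perfect-P₁

    -- Tr-eq and Trξ-eq together say κ a = s P + s′ P′.
    record Cone (a P P′ v : K) : Set where
      field
        {κ s s′}    : ℚ
        -- The scale lets the coefficients be plain differences of values of `a`, with no division.
        0<κ         : 0ℚ < κ
        0≤s         : 0ℚ ≤ s
        0≤s′        : 0ℚ ≤ s′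
        Tr-eq       : κ * Tr a ≡ s * Tr P + s′ * Tr P′
        Trξ-eq      : κ * Trξ a ≡ s * Trξ P + s′ * Trξ P′
        P-bounded   : BoundedBelow P
        P′-bounded  : BoundedBelow P′
        v-nz        : NonZeroIntegral v
        Pv≡τ        : trForm P v ≡ τ
        P′v≡τ       : trForm P′ v ≡ τ

      scaled : ∀ y → κ * trForm a y ≡ s * trForm P y + s′ * trForm P′ y
      scaled = by-coordinates (λ y → κ * trForm a y ≡ s * trForm P y + s′ * trForm P′ y) λ α β → begin
        κ * trForm a ⟪ α , β ⟫                         ≡⟨ cong (κ *_) (trForm-Q a α β) ⟩
        κ * Q (Tr a) (Trξ a) α β                       ≡⟨ Q-scale κ (Tr a) (Trξ a) α β ⟩
        Q (κ * Tr a) (κ * Trξ a) α β                   ≡⟨ cong₂ (λ A B → Q A B α β) Tr-eq Trξ-eq ⟩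
        Q (s * Tr P + s′ * Tr P′) (s * Trξ P + s′ * Trξ P′) α β ≡⟨ lem s s′ (Tr P) (Tr P′) (Trξ P) (Trξ P′) α β t ν ⟩
        s * Q (Tr P) (Trξ P) α β + s′ * Q (Tr P′) (Trξ P′) α β
          ≡⟨ cong₂ (λ x y → s * x + s′ * y) (trForm-Q P α β) (trForm-Q P′ α β) ⟨
        s * trForm P ⟪ α , β ⟫ + s′ * trForm P′ ⟪ α , β ⟫ ∎
        where
        open ≡-Reasoning
        lem : ∀ s s′ A A′ B B′ α β t ν →
          (s * A + s′ * A′) * (α * α) + (s * B + s′ * B′ + (s * B + s′ * B′)) * (α * β) + (t * (s * B + s′ * B′) + ν * (s * A + s′ * A′)) * (β * β)
          ≡ s * (A * (α * α) + (B + B) * (α * β) + (t * B + ν * A) * (β * β)) + s′ * (A′ * (α * α) + (B′ + B′) * (α * β) + (t * B′ + ν * A′) * (β * β))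
        lem = solve-∀ ℚ-ring

      scaled-v : κ * trForm a v ≡ (s + s′) * τ
      scaled-v = trans (scaled v) (trans (cong₂ (λ x y → s * x + s′ * y) Pv≡τ P′v≡τ) (sym (ℚ.*-distribʳ-+ τ s s′)))

      -- Both ends have minimum `τ` and attain it at `v`, hence so does every nonnegative
      -- combination, up to scale.
      minimal : ∀ y → NonZeroIntegral y → trForm a v ≤ trForm a y
      minimal y y-nz = *-cancelˡ-≤ 0<κ (subst₂ _≤_ (trans (sym (ℚ.*-distribʳ-+ τ s s′)) (sym scaled-v)) (sym (scaled y))
        (ℚ.+-mono-≤ (*-monoˡ-≤ 0≤s (P-bounded y y-nz)) (*-monoˡ-≤ 0≤s′ (P′-bounded y y-nz))))

      isμ : Isμ a (trForm a v)
      isμ = (v , v-nz , refl) , minimal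

      κ⁻¹ : ℚ
      κ⁻¹ = proj₁ (pos-inverse 0<κ)

      0<κ⁻¹ : 0ℚ < κ⁻¹
      0<κ⁻¹ = proj₁ (proj₂ (pos-inverse 0<κ))

      unscale : ∀ {x y} → κ * x ≡ y → x ≡ κ⁻¹ * y
      unscale {x} {y} eq = trans (trans (lem₁ x) (cong (_* x) (sym (proj₂ (proj₂ (pos-inverse 0<κ))))))
        (trans (ℚ.*-assoc κ⁻¹ κ x) (cong (κ⁻¹ *_) eq))
        where
        lem₁ : ∀ x → x ≡ 1ℚ * x
        lem₁ = solve-∀ ℚ-ring

      -- Only `s′ P′` remains, and `s′ = 0` would make Tr a vanish.
      multiple-of-P′ : TotallyPositive a → 0ℚ ≡ s → ∃[ r ] 0ℚ < r × a ≡ fromℚ r ⊗ P′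
      multiple-of-P′ a-tp 0≡s = κ⁻¹ * s′ , 0<* 0<κ⁻¹ 0<s′ ,
        injective a (fromℚ (κ⁻¹ * s′) ⊗ P′)
          (trans (unscale (trans Tr-eq (drop (Tr P) (Tr P′)))) (trans (sym (ℚ.*-assoc κ⁻¹ s′ (Tr P′))) (sym (Tr-scale (κ⁻¹ * s′) P′))))
          (trans (unscale (trans Trξ-eq (drop (Trξ P) (Trξ P′)))) (trans (sym (ℚ.*-assoc κ⁻¹ s′ (Trξ P′))) (sym (Trξ-scale (κ⁻¹ * s′) P′))))
        where
        lem : ∀ x y → 0ℚ * x + y ≡ y
        lem = solve-∀ ℚ-ring
        drop : ∀ x y → s * x + s′ * y ≡ s′ * y
        drop x y = trans (cong (λ s → s * x + s′ * y) (sym 0≡s)) (lem x (s′ * y))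
        0<Tr : 0ℚ < Tr a
        0<Tr = subst (0ℚ <_) (sym (Tr≡ a)) (0<+ (proj₁ (TotallyPositive⇒ a a-tp)) (ℚ.<⇒≤ (proj₁ (TotallyPositive⇒ a a-tp))))
        positive : Tri (0ℚ < s′) (0ℚ ≡ s′) (s′ < 0ℚ) → 0ℚ < s′
        positive (tri< 0<s′ _ _) = 0<s′
        positive (tri> _ _ s′<0) = contradiction (ℚ.≤-<-trans 0≤s′ s′<0) (ℚ.<-irrefl refl)
        positive (tri≈ _ 0≡s′ _) = contradiction (0<* 0<κ 0<Tr) (ℚ.<-irrefl (sym (trans Tr-eq (trans (drop (Tr P) (Tr P′))
          (trans (cong (_* Tr P′) (sym 0≡s′)) (ℚ.*-zeroˡ (Tr P′)))))))
        0<s′ : 0ℚ < s′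
        0<s′ = positive (ℚ.<-cmp 0ℚ s′)

      -- If 0 < s, every minimal vector of a is one of P, so perfection of a forces a ∈ ℚ P.
      multiple-of-P : TotallyPositive P → Perfect a → 0ℚ < s → ∃[ r ] 0ℚ < r × a ≡ fromℚ r ⊗ P
      multiple-of-P P-tp (a-tp , m , m-μ , unique) 0<s =
        r , 0<r , sym (unique (fromℚ r ⊗ P) (TotallyPositive-scale r P 0<r P-tp) λ w w∈ → begin
          trForm (fromℚ r ⊗ P) w ≡⟨ trForm-scale r P w ⟩
          r * trForm P w         ≡⟨ cong (r *_) (Pw≡τ w w∈) ⟩
          r * τ                  ≡⟨ ℚ.*-assoc κ⁻¹ (s + s′) τ ⟩
          κ⁻¹ * ((s + s′) * τ)   ≡⟨ unscale scaled-v ⟨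
          trForm a v             ≡⟨ IsMinimum-unique {NonZeroIntegral} {trForm a} isμ m-μ ⟩
          m                      ∎)
        where
        open ≡-Reasoning
        r : ℚ
        r = κ⁻¹ * (s + s′)
        0<s+s′ : 0ℚ < s + s′
        0<s+s′ = 0<+ 0<s 0≤s′
        0<r : 0ℚ < r
        0<r = 0<* 0<κ⁻¹ 0<s+s′
        module _ (w : K) (w∈ : ℳ a w) where
          aw≡av : trForm a w ≡ trForm a v
          aw≡av = IsMinimum-unique {NonZeroIntegral} {trForm a} (proj₂ w∈) isμ
          w-nz : NonZeroIntegral w
          w-nz = proj₁ w∈ , λ w≡0 → ℚ.<-irrefl (begin
            0ℚ                     ≡⟨ ℚ.*-zeroʳ κ ⟨
            κ * 0ℚ                 ≡⟨ cong (κ *_) (trans (sym (trForm-0K a)) (cong (trForm a) (sym w≡0))) ⟩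
            κ * trForm a w         ≡⟨ cong (κ *_) aw≡av ⟩
            κ * trForm a v         ≡⟨ scaled-v ⟩
            (s + s′) * τ           ∎) (0<* 0<s+s′ 0<τ)
          -- At a minimal vector `w` of `a` the combination has the value (s + s′) τ. The shortfall
          -- of `P` at `w` is thus paid for by the nonnegative excess of `P′`; as `P` cannot drop
          -- below `τ` either, P w = τ.
          balance : s * τ - s * trForm P w ≡ s′ * (trForm P′ w - τ)
          balance = begin
            s * τ - s * trForm P w
              ≡⟨ lem₁ s s′ τ (trForm P w) ⟩
            (s + s′) * τ - s′ * τ - s * trForm P w
              ≡⟨ cong (λ x → x - s′ * τ - s * trForm P w) (trans (sym scaled-v) (trans (cong (κ *_) (sym aw≡av)) (scaled w))) ⟩
            s * trForm P w + s′ * trForm P′ w - s′ * τ - s * trForm P w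
              ≡⟨ lem₂ (s * trForm P w) s′ (trForm P′ w) τ ⟩
            s′ * (trForm P′ w - τ) ∎
            where
            lem₁ : ∀ s s′ τ x → s * τ - s * x ≡ (s + s′) * τ - s′ * τ - s * x
            lem₁ = solve-∀ ℚ-ring
            lem₂ : ∀ x s′ y τ → x + s′ * y - s′ * τ - x ≡ s′ * (y - τ)
            lem₂ = solve-∀ ℚ-ring
          Pw≡τ : trForm P w ≡ τ
          Pw≡τ = ℚ.≤-antisym (*-cancelˡ-≤ 0<s (≤-by-diff balance (0≤* 0≤s′ (0≤diff (P′-bounded w w-nz))))) (P-bounded w w-nz)

      endpoint : TotallyPositive P → Perfect a → (∃[ r ] 0ℚ < r × a ≡ fromℚ r ⊗ P) ⊎ (∃[ r ] 0ℚ < r × a ≡ fromℚ r ⊗ P′)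
      endpoint P-tp a-perfect = cases (ℚ.<-cmp 0ℚ s)
        where
        cases : Tri (0ℚ < s) (0ℚ ≡ s) (s < 0ℚ) → _
        cases (tri< 0<s _ _) = inj₁ (multiple-of-P P-tp a-perfect 0<s)
        cases (tri≈ _ 0≡s _) = inj₂ (multiple-of-P′ (proj₁ a-perfect) 0≡s)
        cases (tri> _ _ s<0) = contradiction (ℚ.≤-<-trans 0≤s s<0) (ℚ.<-irrefl refl)

    -- The coefficient of `P₁` has to be a linear functional of `b` vanishing at `P₂`. Since `P₂`
    -- takes equal values at 1 and conj ξ, the difference of the values of `b` there is one; for the
    -- coefficient of `P₂` the vectors are 1 and ξ.
    cone₁₂ : ∀ b → Tr b ≤ trForm b ξ → Tr b ≤ trForm b (conj ξ) → Cone b P₁ P₂ 1K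
    cone₁₂ b A≤C A≤C′ = record
      { 0<κ = 0<* 0<τ 0<t²-2+2ν
      ; 0≤s = 0≤diff A≤C′
      ; 0≤s′ = 0≤diff A≤C
      ; Tr-eq = trans (lem₁ t ν Δ (Tr b) (Trξ b))
          (sym (cong₂ _+_ (cong₂ (λ x y → (x - Tr b) * y) C′≡ Tr-P₁) (cong₂ (λ x y → (x - Tr b) * y) (trForm-ξ b) Tr-P₂)))
      ; Trξ-eq = trans (lem₂ t ν Δ (Tr b) (Trξ b))
          (sym (cong₂ _+_ (cong₂ (λ x y → (x - Tr b) * y) C′≡ Trξ-P₁) (cong₂ (λ x y → (x - Tr b) * y) (trForm-ξ b) Trξ-P₂)))
      ; P-bounded = P₁-bounded
      ; P′-bounded = BoundedBelow-conj P₁ P₁-bounded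
      ; v-nz = NonZeroIntegral-1K
      ; Pv≡τ = trForm-P₁-1K
      ; P′v≡τ = trForm-P₂-1K
      }
      where
      C′≡ : trForm b (conj ξ) ≡ t * (t * Tr b - Trξ b) + ν * Tr b
      C′≡ = trans (sym (trForm-conj b ξ)) (trans (trForm-ξ (conj b)) (cong₂ (λ A B → t * B + ν * A) (Tr-conj b) (Trξ-conj b)))
      lem₁ : ∀ t ν Δ A B → t * Δ * (t * t - (1ℚ + 1ℚ) + (ν + ν)) * A ≡
        (t * (t * A - B) + ν * A - A) * (t * Δ) + (t * B + ν * A - A) * (t * Δ)
      lem₁ = solve-∀ ℚ-ring
      lem₂ : ∀ t ν Δ A B → t * Δ * (t * t - (1ℚ + 1ℚ) + (ν + ν)) * B ≡
        (t * (t * A - B) + ν * A - A) * ((1ℚ - ν) * Δ) + (t * B + ν * A - A) * (t * (t * Δ) - (1ℚ - ν) * Δ)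
      lem₂ = solve-∀ ℚ-ring

    -- As in `cone₁₂`, now with shared vector ξ: `P₃` takes equal values at ξ and ε, which gives the
    -- coefficient of `P₁`, and `P₁` takes equal values at ξ and 1, which gives that of `P₃`.
    cone₁₃ : ∀ b → trForm b ξ ≤ Tr b → trForm b ξ ≤ trForm b ε → Cone b P₁ P₃ ξ
    cone₁₃ b C≤A C≤E = record
      { 0<κ = 0<* 0<η²t-2t+2η 0<Δ
      ; 0≤s = 0≤diff C≤E
      ; 0≤s′ = 0≤diff C≤A
      ; Tr-eq = trans (lem₁ t ν Δ η (Tr b) (Trξ b) t≡ην)
          (sym (cong₂ _+_ (cong₂ _*_ (cong₂ _-_ (trForm-Q b 1ℚ η) (trForm-ξ b)) Tr-P₁) (cong₂ (λ x y → (Tr b - x) * y) (trForm-ξ b) Tr-P₃)))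
      ; Trξ-eq = trans (lem₂ t ν Δ η (Tr b) (Trξ b) t≡ην)
          (sym (cong₂ _+_ (cong₂ _*_ (cong₂ _-_ (trForm-Q b 1ℚ η) (trForm-ξ b)) Trξ-P₁) (cong₂ (λ x y → (Tr b - x) * y) (trForm-ξ b) Trξ-P₃)))
      ; P-bounded = P₁-bounded
      ; P′-bounded = BoundedBelow-⊗² P₂ ε̄-Unit (BoundedBelow-conj P₁ P₁-bounded)
      ; v-nz = NonZeroIntegral-ξ
      ; Pv≡τ = trForm-P₁-ξ
      ; P′v≡τ = trForm-P₃-ξ
      }
      where
      lem₁′ : ∀ ν Δ η A B → (η * η * (η * ν) - ((η * ν) + (η * ν)) + (η + η)) * Δ * A ≡
        (A * (1ℚ * 1ℚ) + (B + B) * (1ℚ * η) + ((η * ν) * B + ν * A) * (η * η) - ((η * ν) * B + ν * A)) * ((η * ν) * Δ) + (A - ((η * ν) * B + ν * A)) * ((η * η * (η * ν) - (η * ν) + (η + η)) * Δ)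
      lem₁′ = solve-∀ ℚ-ring
      lem₁ : ∀ t ν Δ η A B → t ≡ η * ν → (η * η * t - (t + t) + (η + η)) * Δ * A ≡
        (A * (1ℚ * 1ℚ) + (B + B) * (1ℚ * η) + (t * B + ν * A) * (η * η) - (t * B + ν * A)) * (t * Δ) + (A - (t * B + ν * A)) * ((η * η * t - t + (η + η)) * Δ)
      lem₁ t ν Δ η A B refl = lem₁′ ν Δ η A B
      lem₂′ : ∀ ν Δ η A B → (η * η * (η * ν) - ((η * ν) + (η * ν)) + (η + η)) * Δ * B ≡
        (A * (1ℚ * 1ℚ) + (B + B) * (1ℚ * η) + ((η * ν) * B + ν * A) * (η * η) - ((η * ν) * B + ν * A)) * ((1ℚ - ν) * Δ) + (A - ((η * ν) * B + ν * A)) * ((ν - 1ℚ - η * (η * ν)) * Δ)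
      lem₂′ = solve-∀ ℚ-ring
      lem₂ : ∀ t ν Δ η A B → t ≡ η * ν → (η * η * t - (t + t) + (η + η)) * Δ * B ≡
        (A * (1ℚ * 1ℚ) + (B + B) * (1ℚ * η) + (t * B + ν * A) * (η * η) - (t * B + ν * A)) * ((1ℚ - ν) * Δ) + (A - (t * B + ν * A)) * ((ν - 1ℚ - η * t) * Δ)
      lem₂ t ν Δ η A B refl = lem₂′ ν Δ η A B

    -- Descent on Tr (a u²) over the units u

    module Descent (a : K) (a-tp : TotallyPositive a) where

      k₁ k₂ : ℕ
      k₁ = proj₁ (clear-denominator (Tr a))
      k₂ = proj₁ (clear-denominator (Trξ a))
      i j : ℤ
      i = proj₁ (proj₂ (clear-denominator (Tr a)))
      j = proj₁ (proj₂ (clear-denominator (Trξ a)))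

      M : ℚ
      M = ι (+ suc k₁) * ι (+ suc k₂)

      0<ι-suc : ∀ k → 0ℚ < ι (+ suc k)
      0<ι-suc k = subst (_< ι (+ suc k)) ι-0 (ι-mono-< (ℤ.+<+ (ℕ.s≤s ℕ.z≤n)))

      0<M : 0ℚ < M
      0<M = 0<* (0<ι-suc k₁) (0<ι-suc k₂)

      M*Tr : M * Tr a ≡ ι (+ suc k₂ ℤ.* i)
      M*Tr = trans (lem (ι (+ suc k₁)) (ι (+ suc k₂)) (Tr a))
        (trans (cong (ι (+ suc k₂) *_) (proj₂ (proj₂ (clear-denominator (Tr a))))) (sym (ι-* (+ suc k₂) i)))
        where
        lem : ∀ x y z → x * y * z ≡ y * (x * z)
        lem = solve-∀ ℚ-ring

      M*Trξ : M * Trξ a ≡ ι (+ suc k₁ ℤ.* j)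
      M*Trξ = trans (lem (ι (+ suc k₁)) (ι (+ suc k₂)) (Trξ a))
        (trans (cong (ι (+ suc k₁) *_) (proj₂ (proj₂ (clear-denominator (Trξ a))))) (sym (ι-* (+ suc k₁) j)))
        where
        lem : ∀ x y z → x * y * z ≡ x * (y * z)
        lem = solve-∀ ℚ-ring

      ι-Q : ∀ i j α β → Q (ι i) (ι j) (ι α) (ι β) ≡ ι (i ℤ.* (α ℤ.* α) ℤ.+ (j ℤ.+ j) ℤ.* (α ℤ.* β) ℤ.+ (T ℤ.* j ℤ.+ n ℤ.* i) ℤ.* (β ℤ.* β))
      ι-Q i j α β = sym (trans (ι-+ (i ℤ.* (α ℤ.* α) ℤ.+ (j ℤ.+ j) ℤ.* (α ℤ.* β)) ((T ℤ.* j ℤ.+ n ℤ.* i) ℤ.* (β ℤ.* β)))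
        (cong₂ _+_ (trans (ι-+ (i ℤ.* (α ℤ.* α)) ((j ℤ.+ j) ℤ.* (α ℤ.* β))) (cong₂ _+_
            (trans (ι-* i (α ℤ.* α)) (cong (ι i *_) (ι-* α α)))
            (trans (ι-* (j ℤ.+ j) (α ℤ.* β)) (cong₂ _*_ (ι-+ j j) (ι-* α β)))))
          (trans (ι-* (T ℤ.* j ℤ.+ n ℤ.* i) (β ℤ.* β)) (cong₂ _*_ (trans (ι-+ (T ℤ.* j) (n ℤ.* i)) (cong₂ _+_ (ι-* T j) (ι-* n i))) (ι-* β β)))))

      -- The denominator `M` depends on `a` alone, since `Q` has integer coefficients in everything
      -- but Tr a and Tr (a ξ). This makes the descent terminate.
      M*trForm-integer : ∀ u → Lattice u → ∃[ z ] M * trForm a u ≡ ι z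
      M*trForm-integer u (α , β , u≡) = _ , (begin
        M * trForm a u                             ≡⟨ cong (λ u → M * trForm a u) u≡ ⟩
        M * trForm a ⟪ ι α , ι β ⟫                 ≡⟨ cong (M *_) (trForm-Q a (ι α) (ι β)) ⟩
        M * Q (Tr a) (Trξ a) (ι α) (ι β)           ≡⟨ Q-scale M (Tr a) (Trξ a) (ι α) (ι β) ⟩
        Q (M * Tr a) (M * Trξ a) (ι α) (ι β)       ≡⟨ cong₂ (λ A B → Q A B (ι α) (ι β)) M*Tr M*Trξ ⟩
        Q (ι (+ suc k₂ ℤ.* i)) (ι (+ suc k₁ ℤ.* j)) (ι α) (ι β) ≡⟨ ι-Q (+ suc k₂ ℤ.* i) (+ suc k₁ ℤ.* j) α β ⟩
        ι _                                        ∎)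
        where
        open ≡-Reasoning

      M*trForm-natural : ∀ u → Unit u → ∃[ k ] M * trForm a u ≡ ι (+ k)
      M*trForm-natural u u-unit = ℤ.∣ z ∣ , trans eq (cong ι (sym (ℤ.0≤i⇒+∣i∣≡i (ι-cancel-≤
          (subst₂ _≤_ (sym ι-0) eq (0≤* (ℚ.<⇒≤ 0<M) (0≤trForm a a-tp u)))))))
        where
        z : ℤ
        z = proj₁ (M*trForm-integer u (Integral⇒Lattice u (proj₁ u-unit)))
        eq : M * trForm a u ≡ ι z
        eq = proj₂ (M*trForm-integer u (Integral⇒Lattice u (proj₁ u-unit)))

      LocalMinimum : Set
      LocalMinimum = ∃[ u ] Unit u × trForm a u ≤ trForm a (u ⊗ ε) × trForm a u ≤ trForm a (u ⊗ ε̄)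

      descend : ∀ k → Acc ℕ._<_ k → ∀ u → Unit u → M * trForm a u ≡ ι (+ k) → LocalMinimum
      descend k (acc rs) u u-unit eq = step (trForm a u ℚ.≤? trForm a (u ⊗ ε)) (trForm a u ℚ.≤? trForm a (u ⊗ ε̄))
        where
        smaller : ∀ v → Unit v → ¬ trForm a u ≤ trForm a (u ⊗ v) → LocalMinimum
        smaller v v-unit u≰uv = descend l (rs (ℤ.drop‿+<+ (ι-cancel-< (subst₂ _<_ (proj₂ (M*trForm-natural (u ⊗ v) uv-unit)) eq
            (*-monoˡ-< 0<M (ℚ.≰⇒> u≰uv)))))) (u ⊗ v) uv-unit (proj₂ (M*trForm-natural (u ⊗ v) uv-unit))
          where
          uv-unit = Unit-⊗ u-unit v-unit
          l : ℕ
          l = proj₁ (M*trForm-natural (u ⊗ v) uv-unit)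
        step : Dec (trForm a u ≤ trForm a (u ⊗ ε)) → Dec (trForm a u ≤ trForm a (u ⊗ ε̄)) → LocalMinimum
        step (yes p) (yes q) = u , u-unit , p , q
        step (no ¬p) _       = smaller ε ε-Unit ¬p
        step _       (no ¬q) = smaller ε̄ ε̄-Unit ¬q

      local-minimum : LocalMinimum
      local-minimum = descend (proj₁ start) (<-wellFounded (proj₁ start)) 1K Unit-1K (proj₂ start)
        where start = M*trForm-natural 1K Unit-1K

    InCone : K → Set
    InCone b = Cone b P₁ P₂ 1K ⊎ Cone b P₁ P₃ ξ

    -- After the descent the value of b = a u² at 1 is at most those at ε and `ε̄`. If neither ξ nor
    -- conj ξ does better than 1, then `b` lies between `P₁` and `P₂`; otherwise `b` or its
    -- translate by `ε̄` lies between `P₁` and `P₃`.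
    reduce : ∀ a → TotallyPositive a → ∃[ u ] Unit u × InCone (a ⊗ u ²)
    reduce a a-tp = cases (Tr b ℚ.≤? trForm b ξ) (Tr b ℚ.≤? trForm b (conj ξ))
      where
      u : K
      u = proj₁ (Descent.local-minimum a a-tp)
      u-unit = proj₁ (proj₂ (Descent.local-minimum a a-tp))
      b b̄ : K
      b = a ⊗ u ²
      b̄ = a ⊗ (u ⊗ ε̄) ²
      Tr-b : Tr b ≡ trForm a u
      Tr-b = trans (sym (trForm-1K b)) (trans (trForm-⊗² a u 1K) (cong (trForm a) (⊗-identityʳ u)))
      Tr-b̄ : Tr b̄ ≡ trForm a (u ⊗ ε̄)
      Tr-b̄ = trans (sym (trForm-1K b̄)) (trans (trForm-⊗² a (u ⊗ ε̄) 1K) (cong (trForm a) (⊗-identityʳ (u ⊗ ε̄))))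
      Tr-b≤ε : Tr b ≤ trForm b ε
      Tr-b≤ε = subst₂ _≤_ (sym Tr-b) (sym (trForm-⊗² a u ε)) (proj₁ (proj₂ (proj₂ (Descent.local-minimum a a-tp))))
      Tr-b≤Tr-b̄ : Tr b ≤ Tr b̄
      Tr-b≤Tr-b̄ = subst₂ _≤_ (sym Tr-b) (sym Tr-b̄) (proj₂ (proj₂ (proj₂ (Descent.local-minimum a a-tp))))
      b̄-ε : trForm b̄ ε ≡ Tr b
      b̄-ε = trans (trForm-⊗² a (u ⊗ ε̄) ε) (trans (cong (trForm a) (trans (⊗-assoc u ε̄ ε)
        (trans (cong (u ⊗_) (trans (⊗-comm ε̄ ε) ε⊗ε̄)) (⊗-identityʳ u)))) (sym Tr-b))
      conj-ξ : conj ξ ≡ ⟪ t , - 1ℚ ⟫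
      conj-ξ = trans (conj-⟪⟫ 0ℚ 1ℚ) (cong ⟪_, - 1ℚ ⟫ (lem t))
        where
        lem : ∀ t → 0ℚ + t * 1ℚ ≡ t
        lem = solve-∀ ℚ-ring
      -- The right-hand side is - conj ξ.
      ε̄ξ : ε̄ ⊗ ξ ≡ ⟪ - t , 1ℚ ⟫
      ε̄ξ = trans (⟪⟫-⊗ (1ℚ + η * t) (- η) 0ℚ 1ℚ) (cong₂ ⟪_,_⟫
          (trans (lem₁ η t ν) (cong -_ (sym t≡ην))) (lem₂ η t))
        where
        lem₁ : ∀ η t ν → (1ℚ + η * t) * 0ℚ + ν * (- η * 1ℚ) ≡ - (η * ν)
        lem₁ = solve-∀ ℚ-ring
        lem₂ : ∀ η t → (1ℚ + η * t) * 1ℚ + - η * 0ℚ + t * (- η * 1ℚ) ≡ 1ℚ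
        lem₂ = solve-∀ ℚ-ring
      b̄-ξ : trForm b̄ ξ ≡ trForm b (conj ξ)
      b̄-ξ = begin
        trForm b̄ ξ                     ≡⟨ trForm-⊗² a (u ⊗ ε̄) ξ ⟩
        trForm a ((u ⊗ ε̄) ⊗ ξ)         ≡⟨ cong (trForm a) (⊗-assoc u ε̄ ξ) ⟩
        trForm a (u ⊗ (ε̄ ⊗ ξ))         ≡⟨ trForm-⊗² a u (ε̄ ⊗ ξ) ⟨
        trForm b (ε̄ ⊗ ξ)               ≡⟨ cong (trForm b) ε̄ξ ⟩
        trForm b ⟪ - t , 1ℚ ⟫          ≡⟨ trForm-neg b ⟪ t , - 1ℚ ⟫ ⟪ - t , 1ℚ ⟫ (lem₁ t h) (lem₂ g) ⟩
        trForm b ⟪ t , - 1ℚ ⟫          ≡⟨ cong (trForm b) conj-ξ ⟨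
        trForm b (conj ξ)              ∎
        where
        open ≡-Reasoning
        lem₁ : ∀ t h → - t + 1ℚ * h ≡ - (t + - 1ℚ * h)
        lem₁ = solve-∀ ℚ-ring
        lem₂ : ∀ g → 1ℚ * g ≡ - (- 1ℚ * g)
        lem₂ = solve-∀ ℚ-ring
      cases : Dec (Tr b ≤ trForm b ξ) → Dec (Tr b ≤ trForm b (conj ξ)) → ∃[ u ] Unit u × InCone (a ⊗ u ²)
      cases (yes p) (yes q) = u , u-unit , inj₁ (cone₁₂ b p q)
      cases (no ¬p) _       = u , u-unit , inj₂ (cone₁₃ b (ℚ.<⇒≤ (ℚ.≰⇒> ¬p)) (ℚ.≤-trans (ℚ.<⇒≤ (ℚ.≰⇒> ¬p)) Tr-b≤ε))
      -- The form b̄ takes at ξ the value of `b` at conj ξ, which is below Tr b. Its value at ε is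
      -- Tr b, and its value at 1 is at least Tr b by the choice of `u`; so ξ beats both 1 and ε for
      -- b̄.
      cases _       (no ¬q) = u ⊗ ε̄ , Unit-⊗ u-unit ε̄-Unit , inj₂ (cone₁₃ b̄
        (ℚ.≤-trans (ℚ.≤-reflexive b̄-ξ) (ℚ.≤-trans (ℚ.<⇒≤ (ℚ.≰⇒> ¬q)) Tr-b≤Tr-b̄))
        (ℚ.≤-trans (ℚ.≤-reflexive b̄-ξ) (ℚ.≤-trans (ℚ.<⇒≤ (ℚ.≰⇒> ¬q)) (ℚ.≤-reflexive (sym b̄-ε)))))

    -- Classification and counting

    infix 4 _∼_

    -- A normal form for the generated equivalence: scalars commute with squares of units, so every
    -- chain of steps collapses to one homothety and one unit. Inequivalence can then be refuted on
    -- a single witness.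
    record _∼_ (a b : K) : Set where
      constructor related
      field
        scale      : ℚ
        0<scale    : 0ℚ < scale
        unit       : K
        unit-Unit  : Unit unit
        eq         : b ≡ fromℚ scale ⊗ (a ⊗ unit ²)

    ∼-compose : ∀ s r a w v → fromℚ s ⊗ ((fromℚ r ⊗ (a ⊗ w ²)) ⊗ v ²) ≡ fromℚ (s * r) ⊗ (a ⊗ (w ⊗ v) ²)
    ∼-compose s r a w v = begin
      fromℚ s ⊗ ((fromℚ r ⊗ (a ⊗ w ²)) ⊗ v ²)   ≡⟨ cong (fromℚ s ⊗_) (⊗-assoc (fromℚ r) (a ⊗ w ²) (v ²)) ⟩
      fromℚ s ⊗ (fromℚ r ⊗ ((a ⊗ w ²) ⊗ v ²))   ≡⟨ ⊗-assoc (fromℚ s) (fromℚ r) ((a ⊗ w ²) ⊗ v ²) ⟨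
      (fromℚ s ⊗ fromℚ r) ⊗ ((a ⊗ w ²) ⊗ v ²)   ≡⟨ cong₂ _⊗_ (sym (fromℚ-* s r)) (trans (⊗-assoc a (w ²) (v ²)) (cong (a ⊗_) (⊗-interchange w w v v))) ⟩
      fromℚ (s * r) ⊗ (a ⊗ (w ⊗ v) ²)           ∎
      where open ≡-Reasoning

    ∼-unit : ∀ a → fromℚ 1ℚ ⊗ (a ⊗ 1K ²) ≡ a
    ∼-unit a = trans (⊗-identityˡ (a ⊗ 1K ²)) (trans (cong (a ⊗_) (⊗-identityʳ 1K)) (⊗-identityʳ a))

    ∼-isEquivalence : IsEquivalence _∼_
    ∼-isEquivalence = record { refl = ∼-refl ; sym = ∼-sym ; trans = ∼-trans }
      where
      ∼-refl : ∀ {a} → a ∼ a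
      ∼-refl {a} = related 1ℚ 0<1ℚ 1K Unit-1K $ sym (∼-unit a)
      ∼-sym : ∀ {a b} → a ∼ b → b ∼ a
      ∼-sym {a} {b} (related r 0<r w w-unit b≡) = related r⁻¹ (proj₁ (proj₂ (pos-inverse 0<r))) w̄ (Unit-inverse w-unit) $ sym (begin
        fromℚ r⁻¹ ⊗ (b ⊗ w̄ ²)                       ≡⟨ cong (λ b → fromℚ r⁻¹ ⊗ (b ⊗ w̄ ²)) b≡ ⟩
        fromℚ r⁻¹ ⊗ ((fromℚ r ⊗ (a ⊗ w ²)) ⊗ w̄ ²)   ≡⟨ ∼-compose r⁻¹ r a w w̄ ⟩
        fromℚ (r⁻¹ * r) ⊗ (a ⊗ (w ⊗ w̄) ²)           ≡⟨ cong₂ (λ s v → fromℚ s ⊗ (a ⊗ v ²)) (proj₂ (proj₂ (pos-inverse 0<r))) (proj₂ (proj₂ (proj₂ w-unit))) ⟩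
        fromℚ 1ℚ ⊗ (a ⊗ 1K ²)                       ≡⟨ ∼-unit a ⟩
        a                                           ∎)
        where
        open ≡-Reasoning
        r⁻¹ : ℚ
        r⁻¹ = proj₁ (pos-inverse 0<r)
        w̄ : K
        w̄ = w-unit ⁻¹ᵁ
      ∼-trans : ∀ {a b c} → a ∼ b → b ∼ c → a ∼ c
      ∼-trans {a} {b} (related r 0<r w w-unit b≡) (related s 0<s v v-unit c≡) =
        related (s * r) (0<* 0<s 0<r) (w ⊗ v) (Unit-⊗ w-unit v-unit) $
        trans c≡ (trans (cong (λ b → fromℚ s ⊗ (b ⊗ v ²)) b≡) (∼-compose s r a w v))

    open IsEquivalence ∼-isEquivalence using () renaming (refl to ∼-refl; sym to ∼-sym; trans to ∼-trans)

    homothetic⇒∼ : ∀ {a b r} → 0ℚ < r → b ≡ fromℚ r ⊗ a → a ∼ b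
    homothetic⇒∼ {a} {b} {r} 0<r b≡ = related r 0<r 1K Unit-1K $ trans b≡ (cong (fromℚ r ⊗_)
      (sym (trans (cong (a ⊗_) (⊗-identityʳ 1K)) (⊗-identityʳ a))))

    equivalent⇒∼ : ∀ {a b u} → Unit u → b ≡ a ⊗ u ² → a ∼ b
    equivalent⇒∼ {a} {b} {u} u-unit b≡ = related 1ℚ 0<1ℚ u u-unit $ trans b≡ (sym (⊗-identityˡ (a ⊗ u ²)))

    closure⇒∼ : ∀ {a b} → EqClosure (Equivalent ∪ Homothetic) a b → a ∼ b
    closure⇒∼ = EqClosure.fold ∼-isEquivalence step
      where
      step : ∀ {a b} → (Equivalent ∪ Homothetic) a b → a ∼ b
      step {a} {b} (inj₁ (u , u-unit , b≡)) = equivalent⇒∼ {a} {b} {u} u-unit b≡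
      step {a} {b} (inj₂ (r , 0<r , b≡))    = homothetic⇒∼ {a} {b} {r} 0<r b≡

    ∼⇒closure : ∀ {a b} → a ∼ b → EqClosure (Equivalent ∪ Homothetic) a b
    ∼⇒closure {a} {b} (related r 0<r w w-unit b≡) = EqClosure.transitive _
      (EqClosure.return {y = fromℚ r ⊗ a} (inj₂ (r , 0<r , refl)))
      (EqClosure.return (inj₁ (w , w-unit , trans b≡ (sym (⊗-assoc (fromℚ r) a (w ²))))))

    P : Fin 2 → K
    P zero       = P₁
    P (suc zero) = P₂

    -- Opaque, so that P (proj₁ (classify p)) does not unfold the whole descent.
    opaque
      classify : ∀ {a} → Perfect a → ∃[ i ] P i ∼ a
      classify {a} a-perfect = cases (proj₂ (proj₂ reduction))
        where
        reduction : ∃[ u ] Unit u × InCone (a ⊗ u ²)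
        reduction = reduce a (proj₁ a-perfect)
        u : K
        u = proj₁ reduction
        u-unit : Unit u
        u-unit = proj₁ (proj₂ reduction)
        back : ∀ {c} → c ∼ a ⊗ u ² → c ∼ a
        back c∼ = ∼-trans c∼ (∼-sym (equivalent⇒∼ {a} {a ⊗ u ²} {u} u-unit refl))
        au²-perfect : Perfect (a ⊗ u ²)
        au²-perfect = Perfect-⊗² u-unit a-perfect
        Multiple : K → Set
        Multiple c = ∃[ r ] 0ℚ < r × a ⊗ u ² ≡ fromℚ r ⊗ c
        cases₁₂ : Multiple P₁ ⊎ Multiple P₂ → ∃[ i ] P i ∼ a
        cases₁₂ (inj₁ (r , 0<r , eq)) = zero , back (homothetic⇒∼ {P₁} {a ⊗ u ²} {r} 0<r eq)
        cases₁₂ (inj₂ (r , 0<r , eq)) = suc zero , back (homothetic⇒∼ {P₂} {a ⊗ u ²} {r} 0<r eq)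
        cases₁₃ : Multiple P₁ ⊎ Multiple P₃ → ∃[ i ] P i ∼ a
        cases₁₃ (inj₁ (r , 0<r , eq)) = zero , back (homothetic⇒∼ {P₁} {a ⊗ u ²} {r} 0<r eq)
        -- `P₃` is the translate of `P₂` by `ε̄`, so it adds no class.
        cases₁₃ (inj₂ (r , 0<r , eq)) = suc zero , back (related r 0<r ε̄ ε̄-Unit eq)
        cases : InCone (a ⊗ u ²) → ∃[ i ] P i ∼ a
        cases (inj₁ cone) = cases₁₂ (Cone.endpoint cone P₁-TotallyPositive au²-perfect)
        cases (inj₂ cone) = cases₁₃ (Cone.endpoint cone P₁-TotallyPositive au²-perfect)

    -- From ξ (ξ - t) = ν the inverse of ξ is (ξ - t) / ν, and 1 / ν = ν when ν² = 1.
    ξ-Unit : ν * ν ≡ 1ℚ → Unit ξ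
    ξ-Unit ν²≡1 = Lattice⇒Integral ξ (+ 0 , + 1 , sym (cong₂ ⟪_,_⟫ ι-0 ι-1)) , ⟪ - (t * ν) , ν ⟫ ,
      Lattice⇒Integral ⟪ - (t * ν) , ν ⟫ (ℤ.- (T ℤ.* n) , n , cong ⟪_, ν ⟫ (sym (trans (ι-neg (T ℤ.* n)) (cong -_ (ι-* T n))))) ,
      trans (⟪⟫-⊗ 0ℚ 1ℚ (- (t * ν)) ν) (trans (cong₂ ⟪_,_⟫ (trans (lem₁ t ν) ν²≡1) (lem₂ t ν)) (sym (⟪⟫-fromℚ 1ℚ)))
      where
      lem₁ : ∀ t ν → 0ℚ * - (t * ν) + ν * (1ℚ * ν) ≡ ν * ν
      lem₁ = solve-∀ ℚ-ring
      lem₂ : ∀ t ν → 0ℚ * ν + 1ℚ * - (t * ν) + t * (1ℚ * ν) ≡ 0ℚ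
      lem₂ = solve-∀ ℚ-ring

    -- The reduced form has its minimum at the shared vector of its cone, 1 or ξ, and both are units
    -- here. Multiplication by `u` brings this minimum back to `a`.
    ν²≡1⇒UnitReducible : ν * ν ≡ 1ℚ → UnitReducible
    ν²≡1⇒UnitReducible ν²≡1 a a-tp = cases (proj₂ (proj₂ reduction))
      where
      reduction = reduce a a-tp
      u : K
      u = proj₁ reduction
      u-unit = proj₁ (proj₂ reduction)
      minimum : ∀ {P P′ v} → Cone (a ⊗ u ²) P P′ v → Unit v → ∃[ m ] Isμ a m × IsMinimum Unit (trForm a) m
      minimum {v = v} cone v-unit = trForm a (u ⊗ v) ,
        ((u ⊗ v , Unit⇒NonZeroIntegral uv-unit , refl) , bound) ,
        ((u ⊗ v , uv-unit , refl) , λ w w-unit → bound w (Unit⇒NonZeroIntegral w-unit))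
        where
        uv-unit = Unit-⊗ u-unit v-unit
        ū : K
        ū = u-unit ⁻¹ᵁ
        bound : ∀ y → NonZeroIntegral y → trForm a (u ⊗ v) ≤ trForm a y
        bound y y-nz = subst₂ _≤_ (trForm-⊗² a u v) (trans (trForm-⊗² a u (ū ⊗ y)) (cong (trForm a) (cancel-unit u-unit y)))
          (Cone.minimal cone (ū ⊗ y) (NonZeroIntegral-⊗ (Unit-inverse u-unit) y y-nz))
      cases : InCone (a ⊗ u ²) → ∃[ m ] Isμ a m × IsMinimum Unit (trForm a) m
      cases (inj₁ cone) = minimum cone Unit-1K
      cases (inj₂ cone) = minimum cone (ξ-Unit ν²≡1)

    -- Norms of units and the inequivalence of `P₁` and `P₂`

    Unit-norm² : ∀ {u} → Unit u → norm u * norm u ≡ 1ℚ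
    Unit-norm² {u} u-unit@(u-int , u′ , u′-int , uu′≡1) = begin
      norm u * norm u     ≡⟨ cong₂ _*_ N≡ N≡ ⟩
      ι N * ι N           ≡⟨ ι-* N N ⟨
      ι (N ℤ.* N)         ≡⟨ cong ι N²≡1 ⟩
      ι (+ 1)             ≡⟨ ι-1 ⟩
      1ℚ                  ∎
      where
      open ≡-Reasoning
      norm-integer : ∀ x → Lattice x → ∃[ N ] norm x ≡ ι N
      norm-integer x (α , β , x≡) = α ℤ.* α ℤ.+ T ℤ.* (α ℤ.* β) ℤ.- n ℤ.* (β ℤ.* β) ,
        trans (cong norm x≡) (trans (norm-⟪⟫ (ι α) (ι β)) (sym (trans (ι-- (α ℤ.* α ℤ.+ T ℤ.* (α ℤ.* β)) (n ℤ.* (β ℤ.* β))) (cong₂ _-_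
          (trans (ι-+ (α ℤ.* α) (T ℤ.* (α ℤ.* β))) (cong₂ _+_ (ι-* α α) (trans (ι-* T (α ℤ.* β)) (cong (t *_) (ι-* α β)))))
          (trans (ι-* n (β ℤ.* β)) (cong (ν *_) (ι-* β β)))))))
      N N′ : ℤ
      N = proj₁ (norm-integer u (Integral⇒Lattice u u-int))
      N′ = proj₁ (norm-integer u′ (Integral⇒Lattice u′ u′-int))
      N≡ : norm u ≡ ι N
      N≡ = proj₂ (norm-integer u (Integral⇒Lattice u u-int))
      N′≡ : norm u′ ≡ ι N′
      N′≡ = proj₂ (norm-integer u′ (Integral⇒Lattice u′ u′-int))
      norm-1K : norm 1K ≡ 1ℚ
      norm-1K = lem dℚ
        where
        lem : ∀ D → 1ℚ * 1ℚ - D * (0ℚ * 0ℚ) ≡ 1ℚ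
        lem = solve-∀ ℚ-ring
      NN′≡1 : N ℤ.* N′ ≡ + 1
      NN′≡1 = ι-injective (trans (ι-* N N′) (trans (cong₂ _*_ (sym N≡) (sym N′≡))
        (trans (sym (norm-⊗ u u′)) (trans (cong norm uu′≡1) (trans norm-1K (sym ι-1))))))
      ∣N∣≡1 : ℤ.∣ N ∣ ≡ 1
      ∣N∣≡1 = ℕ.m*n≡1⇒m≡1 ℤ.∣ N ∣ ℤ.∣ N′ ∣ (trans (sym (ℤ.abs-* N N′)) (cong ℤ.∣_∣ NN′≡1))
      N²≡1 : N ℤ.* N ≡ + 1
      N²≡1 = square N ∣N∣≡1
        where
        square : ∀ i → ℤ.∣ i ∣ ≡ 1 → i ℤ.* i ≡ + 1
        square (+ .1) refl = refl
        square -[1+ zero ] refl = refl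

    norm-⟪0,⟫ : ∀ β → norm ⟪ 0ℚ , β ⟫ ≡ - (ν * (β * β))
    norm-⟪0,⟫ β = trans (norm-⟪⟫ 0ℚ β) (lem t ν β)
      where
      lem : ∀ t ν β → 0ℚ * 0ℚ + t * (0ℚ * β) - ν * (β * β) ≡ - (ν * (β * β))
      lem = solve-∀ ℚ-ring

    -- The minimal vectors of P₁ are ±1, ±ξ and, if t = 2 − 2ν, also ±(ξ − 1), of norms 1, −ν and ν − 1.
    minimal-unit : ν * ν ≢ 1ℚ → ∀ {w} → Unit w → trForm P₁ w ≡ τ → w ² ≡ 1K
    minimal-unit ν²≢1 {w} w-unit P₁w≡τ = cases (α ℤ.≟ + 0) (β ℤ.≟ + 0)
      where
      open ≡-Reasoning
      rep = NonZeroIntegral⇒ w (Unit⇒NonZeroIntegral w-unit)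
      α β : ℤ
      α = proj₁ rep
      β = proj₁ (proj₂ rep)
      w≡ : w ≡ ⟪ ι α , ι β ⟫
      w≡ = proj₁ (proj₂ (proj₂ rep))
      αβ≢0 = proj₂ (proj₂ (proj₂ rep))
      x y q₊ q₋ c₊ c₋ : ℚ
      x = ι α
      y = ι β
      q₊ = x * x + x * y + y * y - 1ℚ
      q₋ = x * x - x * y + y * y - 1ℚ
      c₊ = 2ℚ + (t - (ν + ν))
      c₋ = t - 2ℚ + (ν + ν)
      0≤q₊ : 0ℚ ≤ q₊
      0≤q₊ = 0≤diff (1≤α²+αβ+β² α β αβ≢0)
      0≤q₋ : 0ℚ ≤ q₋
      0≤q₋ = 0≤diff (1≤α²-αβ+β² α β αβ≢0)
      0<c₊ : 0ℚ < c₊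
      0<c₊ = 0<+ (ℚ.positive⁻¹ 2ℚ) 0≤t-2ν
      excess≡0 : c₊ * q₊ + c₋ * q₋ ≡ 0ℚ
      excess≡0 = *-cancelˡ-≡ 0<Δ (begin
        Δ * (c₊ * q₊ + c₋ * q₋) ≡⟨ Q-P₁-excess x y ⟨
        Q τ ((1ℚ - ν) * Δ) x y - τ + (Q τ ((1ℚ - ν) * Δ) x y - τ)
          ≡⟨ cong (λ z → z - τ + (z - τ)) (trans (sym (trForm-P₁ x y)) (trans (cong (trForm P₁) (sym w≡)) P₁w≡τ)) ⟩
        τ - τ + (τ - τ) ≡⟨ lem τ Δ ⟩
        Δ * 0ℚ ∎)
        where
        lem : ∀ τ Δ → τ - τ + (τ - τ) ≡ Δ * 0ℚ
        lem = solve-∀ ℚ-ring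
      -- Both summands of the excess are nonnegative, and `c₊` is positive. The other coefficient
      -- `c₋` may vanish, which is the hexagonal case with a third pair of minimal vectors.
      q₊≡0 : q₊ ≡ 0ℚ
      q₊≡0 = ℚ.≤-antisym (*-cancelˡ-≤ 0<c₊ (≤-by-diff (trans (lem c₊ q₊ (c₋ * q₋)) (cong (λ z → c₋ * q₋ - z) excess≡0)) (subst (0ℚ ≤_) (lem₂ (c₋ * q₋)) (0≤* 0≤t-2+2ν 0≤q₋)))) 0≤q₊
        where
        lem : ∀ c q z → c * 0ℚ - c * q ≡ z - (c * q + z)
        lem = solve-∀ ℚ-ring
        lem₂ : ∀ z → z ≡ z - 0ℚ
        lem₂ = solve-∀ ℚ-ring
      c₋q₋≡0 : c₋ * q₋ ≡ 0ℚ
      c₋q₋≡0 = trans (lem c₊ (c₋ * q₋)) (trans (cong (λ z → c₊ * z + c₋ * q₋) (sym q₊≡0)) excess≡0)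
        where
        lem : ∀ c z → z ≡ c * 0ℚ + z
        lem = solve-∀ ℚ-ring
      x²+xy+y²≡1 : x * x + x * y + y * y ≡ 1ℚ
      x²+xy+y²≡1 = trans (lem (x * x + x * y + y * y)) (trans (cong (_+ 1ℚ) q₊≡0) (ℚ.+-identityˡ 1ℚ))
        where
        lem : ∀ z → z ≡ z - 1ℚ + 1ℚ
        lem = solve-∀ ℚ-ring
      norm²≡1 : norm ⟪ x , y ⟫ * norm ⟪ x , y ⟫ ≡ 1ℚ
      norm²≡1 = trans (cong (λ w → norm w * norm w) (sym w≡)) (Unit-norm² w-unit)

      real : β ≡ + 0 → w ² ≡ 1K
      real β≡0 = begin
        w ⊗ w                                      ≡⟨ cong (λ w → w ⊗ w) w≡ ⟩
        ⟪ x , y ⟫ ⊗ ⟪ x , y ⟫                      ≡⟨ ⟪⟫-⊗ x y x y ⟩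
        ⟪ x * x + ν * (y * y) , x * y + y * x + t * (y * y) ⟫ ≡⟨ cong (λ y → ⟪ x * x + ν * (y * y) , x * y + y * x + t * (y * y) ⟫) y≡0 ⟩
        ⟪ x * x + ν * (0ℚ * 0ℚ) , x * 0ℚ + 0ℚ * x + t * (0ℚ * 0ℚ) ⟫ ≡⟨ cong₂ ⟪_,_⟫ (trans (lem₁ x ν) (trans (cong (λ y → x * x + x * y + y * y) (sym y≡0)) x²+xy+y²≡1)) (lem₂ x t) ⟩
        ⟪ 1ℚ , 0ℚ ⟫                                ≡⟨ ⟪⟫-fromℚ 1ℚ ⟨
        1K                                         ∎
        where
        y≡0 : y ≡ 0ℚ
        y≡0 = trans (cong ι β≡0) ι-0
        lem₁ : ∀ x ν → x * x + ν * (0ℚ * 0ℚ) ≡ x * x + x * 0ℚ + 0ℚ * 0ℚ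
        lem₁ = solve-∀ ℚ-ring
        lem₂ : ∀ x t → x * 0ℚ + 0ℚ * x + t * (0ℚ * 0ℚ) ≡ 0ℚ
        lem₂ = solve-∀ ℚ-ring

      not-ξ : α ≢ + 0
      not-ξ α≡0 = ν²≢1 (begin
        ν * ν                                  ≡⟨ lem₁ ν ⟩
        - (ν * 1ℚ) * - (ν * 1ℚ)                ≡⟨ cong (λ z → - (ν * z) * - (ν * z)) y²≡1 ⟨
        - (ν * (y * y)) * - (ν * (y * y))      ≡⟨ cong (λ z → z * z) (norm-⟪0,⟫ y) ⟨
        norm ⟪ 0ℚ , y ⟫ * norm ⟪ 0ℚ , y ⟫      ≡⟨ cong (λ x → norm ⟪ x , y ⟫ * norm ⟪ x , y ⟫) x≡0 ⟨
        norm ⟪ x , y ⟫ * norm ⟪ x , y ⟫        ≡⟨ norm²≡1 ⟩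
        1ℚ                                     ∎)
        where
        x≡0 : x ≡ 0ℚ
        x≡0 = trans (cong ι α≡0) ι-0
        lem₁ : ∀ ν → ν * ν ≡ - (ν * 1ℚ) * - (ν * 1ℚ)
        lem₁ = solve-∀ ℚ-ring
        lem₂ : ∀ y → y * y ≡ 0ℚ * 0ℚ + 0ℚ * y + y * y
        lem₂ = solve-∀ ℚ-ring
        y²≡1 : y * y ≡ 1ℚ
        y²≡1 = trans (lem₂ y) (trans (cong (λ x → x * x + x * y + y * y) (sym x≡0)) x²+xy+y²≡1)

      -- With both coordinates nonzero, x² + x y + y² = 1 forces x² = y² = 1 and x y = -1. Then q₋ =
      -- 2, so c₋ = 0 and t = 2 - 2 ν, the norm is ν - 1, and a unit needs ν = 2; but then t = -2.
      not-hexagonal : α ≢ + 0 → β ≢ + 0 → ⊥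
      not-hexagonal α≢0 β≢0 = ℚ.<-irrefl (sym t+2≡0) (0<+ 0<t (ℚ.nonNegative⁻¹ 2ℚ))
        where
        0<x² : 0ℚ < x * x
        0<x² = p≢0⇒0<p² (ι≢0 α≢0)
        0<y² : 0ℚ < y * y
        0<y² = p≢0⇒0<p² (ι≢0 β≢0)
        1≤x² : 1ℚ ≤ x * x
        1≤x² = subst (1ℚ ≤_) (ι-* α α) (0<ι⇒1≤ι (α ℤ.* α) (subst (0ℚ <_) (sym (ι-* α α)) 0<x²))
        1≤y² : 1ℚ ≤ y * y
        1≤y² = subst (1ℚ ≤_) (ι-* β β) (0<ι⇒1≤ι (β ℤ.* β) (subst (0ℚ <_) (sym (ι-* β β)) 0<y²))
        [x+y]²≡1+xy : (x + y) * (x + y) ≡ 1ℚ + x * y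
        [x+y]²≡1+xy = trans (lem x y) (cong (_+ x * y) x²+xy+y²≡1)
          where
          lem : ∀ x y → (x + y) * (x + y) ≡ x * x + x * y + y * y + x * y
          lem = solve-∀ ℚ-ring
        -- The upper bound comes from x², y² ≥ 1, the lower one from (x + y)² = 1 + x y ≥ 0.
        xy≡-1 : x * y ≡ - 1ℚ
        xy≡-1 = ℚ.≤-antisym
          (≤-by-diff (trans (lem₁ (x * x) (x * y) (y * y)) (trans (cong (λ z → x * x - 1ℚ + (y * y - 1ℚ) + (1ℚ - z)) x²+xy+y²≡1) (lem₂ (x * x - 1ℚ + (y * y - 1ℚ)))))
            (0≤+ (0≤diff 1≤x²) (0≤diff 1≤y²)))
          (≤-by-diff (trans (lem₃ (x * y)) (sym [x+y]²≡1+xy)) (0≤² (x + y)))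
          where
          lem₁ : ∀ a b c → - 1ℚ - b ≡ a - 1ℚ + (c - 1ℚ) + (1ℚ - (a + b + c))
          lem₁ = solve-∀ ℚ-ring
          lem₂ : ∀ z → z + (1ℚ - 1ℚ) ≡ z
          lem₂ = solve-∀ ℚ-ring
          lem₃ : ∀ z → z - - 1ℚ ≡ 1ℚ + z
          lem₃ = solve-∀ ℚ-ring
        x²+y²≡2 : x * x + y * y ≡ 2ℚ
        x²+y²≡2 = trans (lem (x * x) (x * y) (y * y)) (cong₂ _-_ x²+xy+y²≡1 xy≡-1)
          where
          lem : ∀ a b c → a + c ≡ a + b + c - b
          lem = solve-∀ ℚ-ring
        x²≡1 : x * x ≡ 1ℚ
        x²≡1 = ℚ.≤-antisym (≤-by-diff (trans (lem (x * x) (y * y)) (trans (cong (λ z → y * y - 1ℚ + (2ℚ - z)) x²+y²≡2) (lem₂ (y * y - 1ℚ) 2ℚ))) (0≤diff 1≤y²)) 1≤x²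
          where
          lem : ∀ a b → 1ℚ - a ≡ b - 1ℚ + (1ℚ + 1ℚ - (a + b))
          lem = solve-∀ ℚ-ring
          lem₂ : ∀ z w → z + (w - w) ≡ z
          lem₂ = solve-∀ ℚ-ring
        y²≡1 : y * y ≡ 1ℚ
        y²≡1 = trans (lem (x * x) (y * y)) (cong₂ _-_ x²+y²≡2 x²≡1)
          where
          lem : ∀ a b → b ≡ a + b - a
          lem = solve-∀ ℚ-ring
        c₋≡0 : c₋ ≡ 0ℚ
        c₋≡0 = *-cancelˡ-≡ {2ℚ} (ℚ.positive⁻¹ 2ℚ) (begin
          2ℚ * c₋                            ≡⟨ lem c₋ ⟩
          c₋ * (2ℚ - - 1ℚ - 1ℚ)              ≡⟨ cong₂ (λ a b → c₋ * (a - b - 1ℚ)) x²+y²≡2 xy≡-1 ⟨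
          c₋ * (x * x + y * y - x * y - 1ℚ)  ≡⟨ lem₂ c₋ (x * x) (x * y) (y * y) ⟩
          c₋ * q₋                            ≡⟨ c₋q₋≡0 ⟩
          2ℚ * 0ℚ                            ∎)
          where
          lem : ∀ c → (1ℚ + 1ℚ) * c ≡ c * ((1ℚ + 1ℚ) - - 1ℚ - 1ℚ)
          lem = solve-∀ ℚ-ring
          lem₂ : ∀ c a b e → c * (a + e - b - 1ℚ) ≡ c * (a - b + e - 1ℚ)
          lem₂ = solve-∀ ℚ-ring
        t≡2-2ν : t ≡ 2ℚ - (ν + ν)
        t≡2-2ν = trans (lem t ν) (trans (cong (_+ (2ℚ - (ν + ν))) c₋≡0) (ℚ.+-identityˡ (2ℚ - (ν + ν))))
          where
          lem : ∀ t ν → t ≡ t - (1ℚ + 1ℚ) + (ν + ν) + (1ℚ + 1ℚ - (ν + ν))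
          lem = solve-∀ ℚ-ring
        norm≡ : norm ⟪ x , y ⟫ ≡ ν - 1ℚ
        norm≡ = begin
          norm ⟪ x , y ⟫                              ≡⟨ norm-⟪⟫ x y ⟩
          x * x + t * (x * y) - ν * (y * y)           ≡⟨ cong₂ (λ a b → a + t * (x * y) - ν * b) x²≡1 y²≡1 ⟩
          1ℚ + t * (x * y) - ν * 1ℚ                   ≡⟨ cong₂ (λ s b → 1ℚ + s * b - ν * 1ℚ) t≡2-2ν xy≡-1 ⟩
          1ℚ + (2ℚ - (ν + ν)) * - 1ℚ - ν * 1ℚ         ≡⟨ lem ν ⟩
          ν - 1ℚ                                      ∎
          where
          lem : ∀ ν → 1ℚ + (1ℚ + 1ℚ - (ν + ν)) * - 1ℚ - ν * 1ℚ ≡ ν - 1ℚ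
          lem = solve-∀ ℚ-ring
        0<ν² : 0ℚ < ν * ν
        0<ν² = p≢0⇒0<p² (ι≢0 n≢0)
        -- The equation (ν - 1)² = 1 reads ν² = 2 ν. It is multiplied by ν so that the factor
        -- cancelled is the positive ν².
        ν≡2 : ν ≡ 2ℚ
        ν≡2 = *-cancelˡ-≡ 0<ν² (begin
          ν * ν * ν                                     ≡⟨ lem ν ⟩
          ν * ((ν - 1ℚ) * (ν - 1ℚ) - 1ℚ) + ν * ν * 2ℚ   ≡⟨ cong (λ z → ν * (z * z - 1ℚ) + ν * ν * 2ℚ) norm≡ ⟨
          ν * (norm ⟪ x , y ⟫ * norm ⟪ x , y ⟫ - 1ℚ) + ν * ν * 2ℚ ≡⟨ cong (λ z → ν * (z - 1ℚ) + ν * ν * 2ℚ) norm²≡1 ⟩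
          ν * (1ℚ - 1ℚ) + ν * ν * 2ℚ                    ≡⟨ lem₂ ν ⟩
          ν * ν * 2ℚ                                    ∎)
          where
          lem : ∀ ν → ν * ν * ν ≡ ν * ((ν - 1ℚ) * (ν - 1ℚ) - 1ℚ) + ν * ν * (1ℚ + 1ℚ)
          lem = solve-∀ ℚ-ring
          lem₂ : ∀ ν → ν * (1ℚ - 1ℚ) + ν * ν * (1ℚ + 1ℚ) ≡ ν * ν * (1ℚ + 1ℚ)
          lem₂ = solve-∀ ℚ-ring
        t+2≡0 : t + 2ℚ ≡ 0ℚ
        t+2≡0 = trans (cong (_+ 2ℚ) (trans t≡2-2ν (cong (λ z → 2ℚ - (z + z)) ν≡2))) refl

      cases : Dec (α ≡ + 0) → Dec (β ≡ + 0) → w ² ≡ 1K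
      cases _         (yes β≡0) = real β≡0
      cases (yes α≡0) _         = ⊥-elim (not-ξ α≡0)
      cases (no α≢0)  (no β≢0)  = ⊥-elim (not-hexagonal α≢0 β≢0)

    -- Their values of `Trξ` differ by Δ (t² - 2 + 2 ν).
    P₁≢P₂ : P₁ ≢ P₂
    P₁≢P₂ eq = ℚ.<-irrefl (sym (trans (lem t ν Δ) (trans (cong₂ _-_ (sym Trξ-P₂) (sym Trξ-P₁)) (trans (cong (λ a → Trξ a - Trξ P₁) (sym eq)) (ℚ.+-inverseʳ (Trξ P₁))))))
        (0<* 0<Δ 0<t²-2+2ν)
      where
      lem : ∀ t ν Δ → Δ * (t * t - (1ℚ + 1ℚ) + (ν + ν)) ≡ t * (t * Δ) - (1ℚ - ν) * Δ - (1ℚ - ν) * Δ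
      lem = solve-∀ ℚ-ring

    -- Both forms have minimum `τ`, attained at the unit 1. If P₂ = r P₁ w², then τ = P₂(1) = r
    -- P₁(w) gives r ≤ 1, and P₂(w⁻¹) = r τ gives r ≥ 1. So `w` is a minimal vector of `P₁`, and w²
    -- = 1 would give P₂ = P₁.
    P₁≁P₂ : ν * ν ≢ 1ℚ → ¬ P₁ ∼ P₂
    P₁≁P₂ ν²≢1 (related r 0<r w w-unit P₂≡) = P₁≢P₂ (sym (begin
      P₂                         ≡⟨ P₂≡ ⟩
      fromℚ r ⊗ (P₁ ⊗ w ²)       ≡⟨ cong₂ (λ r v → fromℚ r ⊗ (P₁ ⊗ v)) r≡1 (minimal-unit ν²≢1 w-unit P₁w≡τ) ⟩
      1K ⊗ (P₁ ⊗ 1K)             ≡⟨ ⊗-identityˡ (P₁ ⊗ 1K) ⟩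
      P₁ ⊗ 1K                    ≡⟨ ⊗-identityʳ P₁ ⟩
      P₁                         ∎))
      where
      open ≡-Reasoning
      form : ∀ y → trForm P₂ y ≡ r * trForm P₁ (w ⊗ y)
      form y = trans (cong (λ a → trForm a y) P₂≡) (trans (trForm-scale r (P₁ ⊗ w ²) y) (cong (r *_) (trForm-⊗² P₁ w y)))
      w̄ : K
      w̄ = w-unit ⁻¹ᵁ
      τ≡rP₁w : τ ≡ r * trForm P₁ w
      τ≡rP₁w = trans (sym trForm-P₂-1K) (trans (form 1K) (cong (λ v → r * trForm P₁ v) (⊗-identityʳ w)))
      P₂w̄≡rτ : trForm P₂ w̄ ≡ r * τ
      P₂w̄≡rτ = trans (form w̄) (cong (r *_) (trans (cong (trForm P₁) (proj₂ (proj₂ (proj₂ w-unit)))) trForm-P₁-1K))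
      r≡1 : r ≡ 1ℚ
      r≡1 = ℚ.≤-antisym
        (*-cancelˡ-≤ 0<τ (subst₂ _≤_ (ℚ.*-comm r τ) (trans (sym τ≡rP₁w) (sym (ℚ.*-identityʳ τ)))
          (*-monoˡ-≤ (ℚ.<⇒≤ 0<r) (P₁-bounded w (Unit⇒NonZeroIntegral w-unit)))))
        (*-cancelˡ-≤ 0<τ (subst₂ _≤_ (sym (ℚ.*-identityʳ τ)) (trans P₂w̄≡rτ (ℚ.*-comm r τ))
          (BoundedBelow-conj P₁ P₁-bounded w̄ (Unit⇒NonZeroIntegral (Unit-inverse w-unit)))))
      P₁w≡τ : trForm P₁ w ≡ τ
      P₁w≡τ = trans (sym (ℚ.*-identityˡ (trForm P₁ w))) (trans (cong (_* trForm P₁ w) (sym r≡1)) (sym τ≡rP₁w))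

    nK≡2 : ν * ν ≢ 1ℚ → nK-is 2
    nK≡2 ν²≢1 = record
      { to        = λ (_ , perfect) → proj₁ (classify perfect)
      ; from      = λ i → P i , P-perfect i
      ; to-cong   = λ {(a , a-perfect)} {(b , b-perfect)} a≈b → distinct
          (∼-trans (proj₂ (classify a-perfect)) (∼-trans (closure⇒∼ a≈b) (∼-sym (proj₂ (classify b-perfect)))))
      ; from-cong = λ { refl → EqClosure.reflexive _ }
      ; inverse   = (λ {i} {(a , a-perfect)} a≈Pi → distinct (∼-trans (proj₂ (classify a-perfect)) (closure⇒∼ a≈Pi))) ,
                    (λ { {(a , a-perfect)} refl → ∼⇒closure (proj₂ (classify a-perfect)) })
      }
      where
      P-perfect : ∀ i → Perfect (P i)
      P-perfect zero       = Perfect-P₁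
      P-perfect (suc zero) = Perfect-P₂
      distinct : ∀ {i j} → P i ∼ P j → i ≡ j
      distinct {zero}     {zero}     _ = refl
      distinct {zero}     {suc zero} p = contradiction p (P₁≁P₂ ν²≢1)
      distinct {suc zero} {zero}     p = contradiction (∼-sym p) (P₁≁P₂ ν²≢1)
      distinct {suc zero} {suc zero} _ = refl

    ¬UnitReducible⇒nK≡2 : ¬ UnitReducible → nK-is 2
    ¬UnitReducible⇒nK≡2 ¬ur = nK≡2 λ ν²≡1 → ¬ur (ν²≡1⇒UnitReducible ν²≡1)

-- Rings of integers of Richaud-Degert type

module RichaudDegert where

  open import Data.Integer.Base as ℤ using (ℤ; +_; -[1+_]; _+_; _*_; -_; _-_; _≤_; _<_; +≤+)
  open import Data.Integer.DivMod using (_/ℕ_; _%ℕ_; n%ℕd<d; a≡a%ℕn+[a/ℕn]*n)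
  import Data.Integer.Divisibility as ℤ
  import Data.Integer.Divisibility.Signed as Signed
  import Data.Integer.Properties as ℤ
  open import Data.Integer.Tactic.RingSolver using (solve-∀)
  open import Data.Nat.Base as ℕ using (ℕ; zero; suc)
  open import Data.Nat.DivMod using (m≡m%n+[m/n]*n)
  import Data.Nat.Divisibility as ∣
  import Data.Nat.Properties as ℕ
  open import Data.Product.Base using (∃-syntax; _×_; _,_; proj₁; proj₂)
  open import Data.Rational.Base as ℚ using (ℚ; 1ℚ; ½)
  import Data.Rational.Properties as ℚ
  open import Data.Sum.Base using (_⊎_; inj₁; inj₂)
  open import Data.Empty using (⊥; ⊥-elim)
  open import Relation.Binary.PropositionalEquality
  open import Relation.Nullary using (¬_; contradiction)
  import Tactic.RingSolver as Tactic
  open import Defs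
  open TraceForms

  parity : ∀ i → ∃[ q ] (i ≡ q + q ⊎ i ≡ q + q + + 1)
  parity i = i /ℕ 2 , cases (i %ℕ 2) (n%ℕd<d i 2) (a≡a%ℕn+[a/ℕn]*n i 2)
    where
    q = i /ℕ 2
    lem₀ : ∀ q → + 0 + q * + 2 ≡ q + q
    lem₀ = solve-∀
    lem₁ : ∀ q → + 1 + q * + 2 ≡ q + q + + 1
    lem₁ = solve-∀
    cases : ∀ ρ → ρ ℕ.< 2 → i ≡ + ρ + q * + 2 → i ≡ q + q ⊎ i ≡ q + q + + 1
    cases 0 _ eq = inj₁ (trans eq (lem₀ q))
    cases 1 _ eq = inj₂ (trans eq (lem₁ q))
    cases (suc (suc _)) (ℕ.s≤s (ℕ.s≤s ())) _

  4∤ : ∀ k → suc k ℕ.< 4 → ∀ i → + suc k ≢ + 4 * i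
  4∤ k k<4 i eq = ∣.>⇒∤ k<4 (∣.divides ℤ.∣ i ∣ (trans (cong ℤ.∣_∣ eq) (trans (ℤ.abs-* (+ 4) i) (ℕ.*-comm 4 ℤ.∣ i ∣))))

  ≤-by-diffℤ : ∀ {i j k} → j - i ≡ k → + 0 ≤ k → i ≤ j
  ≤-by-diffℤ eq 0≤k = ℤ.0≤i-j⇒j≤i (subst (+ 0 ≤_) (sym eq) 0≤k)

  ½+½ : ∀ p → p ℚ.* ½ ℚ.+ p ℚ.* ½ ≡ p
  ½+½ p = trans (sym (ℚ.*-distribˡ-+ p ½ ½)) (ℚ.*-identityʳ p)

  double-injective : ∀ {p q} → p ℚ.+ p ≡ q ℚ.+ q → p ≡ q
  double-injective {p} {q} eq = trans (sym (lem p)) (trans (cong (ℚ._* ½) eq) (lem q))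
    where
    lem : ∀ p → (p ℚ.+ p) ℚ.* ½ ≡ p
    lem p = trans (ℚ.*-distribʳ-+ ½ p p) (½+½ p)

  module _ (d : ℕ) (1<d : 1 ℕ.< d) (sf : SquareFree d) (m r : ℤ) (d≡m²+r : + d ≡ m * m + r)
    (0<m : + 0 < m) (-m<r : - m < r) (r≤m : r ≤ m) (r∣4m : r ℤ.∣ + 4 * m) where

    open QuadraticField d

    0<d : 0 ℕ.< d
    0<d = ℕ.<-trans (ℕ.s≤s ℕ.z≤n) 1<d

    -- Otherwise d = m², and a square-free square is 1.
    r≢0 : r ≢ + 0
    r≢0 r≡0 = ℕ.<-irrefl (sym d≡1) 1<d
      where
      d≡∣m∣² : d ≡ ℤ.∣ m ∣ ℕ.* ℤ.∣ m ∣
      d≡∣m∣² = trans (cong ℤ.∣_∣ (trans d≡m²+r (trans (cong (_+_ (m * m)) r≡0) (ℤ.+-identityʳ (m * m))))) (ℤ.abs-* m m)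
      ∣m∣≡1 : ℤ.∣ m ∣ ≡ 1
      ∣m∣≡1 = sf ℤ.∣ m ∣ (∣.∣-reflexive (sym d≡∣m∣²))
      d≡1 : d ≡ 1
      d≡1 = trans d≡∣m∣² (cong (λ k → k ℕ.* k) ∣m∣≡1)

    signed : r Signed.∣ + 4 * m
    signed = Signed.∣ᵤ⇒∣ r∣4m

    k : ℤ
    k = Signed.quotient signed

    4m≡kr : + 4 * m ≡ k * r
    4m≡kr = Signed._∣_.equality signed

    0≤m+r-1 : + 0 ≤ m + r - + 1
    0≤m+r-1 = subst (+ 0 ≤_) (lem m r) (ℤ.i≤j⇒0≤j-i (ℤ.i<j⇒suc[i]≤j -m<r))
      where
      lem : ∀ m r → r - (+ 1 + - m) ≡ m + r - + 1
      lem = solve-∀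

    dℚ≡ : dℚ ≡ ι m ℚ.* ι m ℚ.+ ι r
    dℚ≡ = trans (sym (ι≡ (+ d))) (trans (cong ι d≡m²+r) (trans (ι-+ (m * m) r) (cong (ℚ._+ ι r) (ι-* m m))))

    -- Parities in the equation t² = d s² + 4 n

    module Residue (ρ : ℕ) (d%4≡ρ : d ℕ.% 4 ≡ ρ) where

      q : ℤ
      q = + (d ℕ./ 4)

      d≡ρ+4q : + d ≡ + ρ + + 4 * q
      d≡ρ+4q = trans (cong +_ (trans (m≡m%n+[m/n]*n d 4) (cong₂ ℕ._+_ d%4≡ρ (ℕ.*-comm (d ℕ./ 4) 4))))
        (cong (_+_ (+ ρ)) (ℤ.pos-* 4 (d ℕ./ 4)))

    -- Modulo 4 the equation reads 0 ≡ d.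
    even-odd : ∀ ρ → d ℕ.% 4 ≡ ρ → ∀ a b n →
      (a + a) * (a + a) ≡ + d * ((b + b + + 1) * (b + b + + 1)) + + 4 * n → ∃[ i ] + ρ ≡ + 4 * i
    even-odd ρ d%4≡ρ a b n eq = a * a - (+ d * (b * b + b) + q + n) ,
        trans (trans (lem₀ (+ ρ) q) (cong (_- + 4 * q) (sym d≡ρ+4q))) (trans (lem₁ (+ d) b n q)
          (trans (cong (λ x → x - + d * (+ 4 * (b * b + b)) - + 4 * n - + 4 * q) (sym eq)) (lem₂ (+ d) a b n q)))
      where
      open Residue ρ d%4≡ρ
      lem₀ : ∀ ρ q → ρ ≡ ρ + + 4 * q - + 4 * q
      lem₀ = solve-∀
      lem₁ : ∀ d b n q → d - + 4 * q ≡ d * ((b + b + + 1) * (b + b + + 1)) + + 4 * n - d * (+ 4 * (b * b + b)) - + 4 * n - + 4 * q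
      lem₁ = solve-∀
      lem₂ : ∀ d a b n q → (a + a) * (a + a) - d * (+ 4 * (b * b + b)) - + 4 * n - + 4 * q ≡ + 4 * (a * a - (d * (b * b + b) + q + n))
      lem₂ = solve-∀

    -- Modulo 4 the equation reads 1 ≡ 0.
    odd-even : ∀ a b n → (a + a + + 1) * (a + a + + 1) ≡ + d * ((b + b) * (b + b)) + + 4 * n → ⊥
    odd-even a b n eq = 4∤ 0 (ℕ.s≤s (ℕ.s≤s ℕ.z≤n)) (+ d * (b * b) + n - a * a - a)
        (trans (lem₁ a) (trans (cong (_- (+ 4 * (a * a + a))) eq) (lem₂ (+ d) a b n)))
      where
      lem₁ : ∀ a → + 1 ≡ (a + a + + 1) * (a + a + + 1) - + 4 * (a * a + a)
      lem₁ = solve-∀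
      lem₂ : ∀ d a b n → d * ((b + b) * (b + b)) + + 4 * n - + 4 * (a * a + a) ≡ + 4 * (d * (b * b) + n - a * a - a)
      lem₂ = solve-∀

    -- Modulo 4 the equation reads 1 ≡ d. The residue is written as `suc ρ` so that d - 1 ≡ ρ stays
    -- a natural number.
    odd-odd : ∀ ρ → d ℕ.% 4 ≡ suc ρ → ∀ a b n →
      (a + a + + 1) * (a + a + + 1) ≡ + d * ((b + b + + 1) * (b + b + + 1)) + + 4 * n → ∃[ i ] + ρ ≡ + 4 * i
    odd-odd ρ d%4≡ρ a b n eq = a * a + a - + d * (b * b + b) - q - n ,
        trans (trans (lem₀ (+ ρ) q) (cong (λ x → x - + 4 * q - + 1) (sym d≡ρ+4q))) (trans (lem₁ (+ d) b n q)
          (trans (cong (λ x → x - + d * (+ 4 * (b * b + b)) - + 4 * n - + 4 * q - + 1) (sym eq)) (lem₂ (+ d) a b n q)))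
      where
      open Residue (suc ρ) d%4≡ρ
      lem₀ : ∀ ρ q → ρ ≡ + 1 + ρ + + 4 * q - + 4 * q - + 1
      lem₀ = solve-∀
      lem₁ : ∀ d b n q → d - + 4 * q - + 1 ≡ d * ((b + b + + 1) * (b + b + + 1)) + + 4 * n - d * (+ 4 * (b * b + b)) - + 4 * n - + 4 * q - + 1
      lem₁ = solve-∀
      lem₂ : ∀ d a b n q → (a + a + + 1) * (a + a + + 1) - d * (+ 4 * (b * b + b)) - + 4 * n - + 4 * q - + 1 ≡ + 4 * (a * a + a - d * (b * b + b) - q - n)
      lem₂ = solve-∀

    -- 𝒪_K = ℤ[√d] and ξ = m + √d.
    module Order-ℤ[√d] (ρ : ℕ) (d%4≡ρ : d ℕ.% 4 ≡ suc (suc ρ)) (ρ<2 : suc (suc ρ) ℕ.< 4) where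

      ρ≢ : ∀ {i} → + suc (suc ρ) ≢ + 4 * i
      ρ≢ {i} = 4∤ (suc ρ) ρ<2 i

      ρ-1≢ : ∀ {i} → + suc ρ ≢ + 4 * i
      ρ-1≢ {i} = 4∤ ρ (ℕ.<-trans (ℕ.n<1+n (suc ρ)) ρ<2) i

      h+h≡ : ι m ℚ.+ ι m ≡ ι (m + m)
      h+h≡ = sym (ι-+ m m)

      g²d≡ : 1ℚ ℚ.* 1ℚ ℚ.* dℚ ≡ ι m ℚ.* ι m ℚ.+ ι r
      g²d≡ = trans (ℚ.*-identityˡ dℚ) dℚ≡

      -- As m² is 0 or 1 modulo 4, a multiple of 4 for `r` would make d congruent to 0 or 1.
      4∤r : ∀ i → r ≢ + 4 * i
      4∤r i r≡4i = cases (parity m)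
        where
        open Residue (suc (suc ρ)) d%4≡ρ
        d≡ : + suc (suc ρ) + + 4 * q ≡ m * m + + 4 * i
        d≡ = trans (sym d≡ρ+4q) (trans d≡m²+r (cong (_+_ (m * m)) r≡4i))
        lem₀ : ∀ ρ q → ρ ≡ ρ + + 4 * q - + 4 * q
        lem₀ = solve-∀
        lem₁ : ∀ a i q → (a + a) * (a + a) + + 4 * i - + 4 * q ≡ + 4 * (a * a + i - q)
        lem₁ = solve-∀
        lem₂ : ∀ ρ q → ρ ≡ + 1 + ρ + + 4 * q - + 4 * q - + 1
        lem₂ = solve-∀
        lem₃ : ∀ a i q → (a + a + + 1) * (a + a + + 1) + + 4 * i - + 4 * q - + 1 ≡ + 4 * (a * a + a + i - q)
        lem₃ = solve-∀
        cases : ∃[ a ] (m ≡ a + a ⊎ m ≡ a + a + + 1) → ⊥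
        cases (a , inj₁ m≡) = ρ≢ (trans (lem₀ (+ suc (suc ρ)) q) (trans (cong (_- + 4 * q) d≡)
          (trans (cong (λ m → m * m + + 4 * i - + 4 * q) m≡) (lem₁ a i q))))
        cases (a , inj₂ m≡) = ρ-1≢ (trans (lem₂ (+ suc ρ) q) (trans (cong (λ x → x - + 4 * q - + 1) d≡)
          (trans (cong (λ m → m * m + + 4 * i - + 4 * q - + 1) m≡) (lem₃ a i q))))

      -- The hypothesis gives r ∣ 4 m, whereas T = 2 m has to be a multiple of n = r. An odd
      -- quotient k would make `r` divisible by 4.
      quotient : ∃[ e ] m + m ≡ e * r
      quotient = cases (parity k)
        where
        lem₀ : ∀ m → + 4 * m ≡ + 2 * (m + m)
        lem₀ = solve-∀
        lem₁ : ∀ c r → (c + c) * r ≡ + 2 * (c * r)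
        lem₁ = solve-∀
        cases : ∃[ c ] (k ≡ c + c ⊎ k ≡ c + c + + 1) → ∃[ e ] m + m ≡ e * r
        cases (c , inj₁ k≡) = c , ℤ.*-cancelˡ-≡ (+ 2) (m + m) (c * r)
          (trans (sym (lem₀ m)) (trans 4m≡kr (trans (cong (_* r) k≡) (lem₁ c r))))
        -- With k = 2 c + 1 and s = 2 m - c r one finds r = 2 s, hence s = 2 (m - c s) and r = 4 (m
        -- - c s).
        cases (c , inj₂ k≡) = ⊥-elim (4∤r (m - c * s) (trans r≡2s (trans (cong (_+_ s) s≡) (trans (cong (_+ (+ 2 * (m - c * s))) s≡) (lem₄ (m - c * s))))))
          where
          s : ℤ
          s = m + m - c * r
          lem₂ : ∀ c r → r ≡ (c + c + + 1) * r - (c + c) * r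
          lem₂ = solve-∀
          lem₃ : ∀ m c r → + 4 * m - (c + c) * r ≡ m + m - c * r + (m + m - c * r)
          lem₃ = solve-∀
          lem₄ : ∀ x → + 2 * x + + 2 * x ≡ + 4 * x
          lem₄ = solve-∀
          r≡2s : r ≡ s + s
          r≡2s = trans (lem₂ c r) (trans (cong (_- ((c + c) * r)) (trans (cong (_* r) (sym k≡)) (sym 4m≡kr))) (lem₃ m c r))
          lem₅ : ∀ m c s → m + m - c * (s + s) ≡ + 2 * (m - c * s)
          lem₅ = solve-∀
          s≡ : s ≡ + 2 * (m - c * s)
          s≡ = trans (cong (λ r → m + m - c * r) r≡2s) (lem₅ m c s)

      2-2r≤2m : + 2 - (r + r) ≤ m + m
      2-2r≤2m = ≤-by-diffℤ (lem m r) (ℤ.+-mono-≤ 0≤m+r-1 0≤m+r-1)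
        where
        lem : ∀ m r → m + m - (+ 2 - (r + r)) ≡ m + r - + 1 + (m + r - + 1)
        lem = solve-∀

      open Basis d 0<d (m + m) r (ι m) 1ℚ 1ℚ h+h≡ g²d≡ refl using (Lattice; ⟪_,_⟫)

      Integral⇒Lattice : ∀ z → Integral z → Lattice z
      Integral⇒Lattice z z-int = cases (parity t) (parity s)
        where
        half : ∃[ t ] ∃[ s ] ∃[ n ] re z ℚ.+ re z ≡ ι t × im z ℚ.+ im z ≡ ι s × t * t ≡ + d * (s * s) + + 4 * n
        half = IntegralClosure.integral⇒half-integers d sf z z-int
        t s n : ℤ
        t = proj₁ half
        s = proj₁ (proj₂ half)
        n = proj₁ (proj₂ (proj₂ half))
        eq : t * t ≡ + d * (s * s) + + 4 * n
        eq = proj₂ (proj₂ (proj₂ (proj₂ (proj₂ half))))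
        substituted : ∀ {t′ s′} → t ≡ t′ → s ≡ s′ → t′ * t′ ≡ + d * (s′ * s′) + + 4 * n
        substituted t≡ s≡ = subst₂ (λ t s → t * t ≡ + d * (s * s) + + 4 * n) t≡ s≡ eq
        cases : ∃[ a ] (t ≡ a + a ⊎ t ≡ a + a + + 1) → ∃[ b ] (s ≡ b + b ⊎ s ≡ b + b + + 1) → Lattice z
        -- a + b √d = (a - m b) + b ξ.
        cases (a , inj₁ t≡) (b , inj₁ s≡) = a - m * b , b , cong₂ _+√_
          (trans re≡ (trans (lem (ι a) (ι m) (ι b)) (cong (ℚ._+ ι b ℚ.* ι m) (sym (trans (ι-- a (m * b)) (cong (λ x → ι a ℚ.- x) (ι-* m b)))))))
          (trans im≡ (sym (ℚ.*-identityʳ (ι b))))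
          where
          re≡ : re z ≡ ι a
          re≡ = double-injective (trans (proj₁ (proj₂ (proj₂ (proj₂ half)))) (trans (cong ι t≡) (ι-+ a a)))
          im≡ : im z ≡ ι b
          im≡ = double-injective (trans (proj₁ (proj₂ (proj₂ (proj₂ (proj₂ half))))) (trans (cong ι s≡) (ι-+ b b)))
          lem : ∀ a m b → a ≡ a ℚ.- m ℚ.* b ℚ.+ b ℚ.* m
          lem = Tactic.solve-∀ ℚ-ring
        cases (a , inj₁ t≡) (b , inj₂ s≡) = ⊥-elim (ρ≢ (proj₂ (even-odd _ d%4≡ρ a b n (substituted t≡ s≡))))
        cases (a , inj₂ t≡) (b , inj₁ s≡) = ⊥-elim (odd-even a b n (substituted t≡ s≡))
        cases (a , inj₂ t≡) (b , inj₂ s≡) = ⊥-elim (ρ-1≢ (proj₂ (odd-odd _ d%4≡ρ a b n (substituted t≡ s≡))))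

      two-classes : ¬ UnitReducible → nK-is 2
      two-classes = Forms.¬UnitReducible⇒nK≡2 d 0<d (m + m) r (proj₁ quotient) (ι m) 1ℚ 1ℚ h+h≡ g²d≡ refl
        (proj₂ quotient) r≢0 (ℤ.+-mono-≤ r≤m r≤m) 2-2r≤2m Integral⇒Lattice

    -- 𝒪_K = ℤ[ξ] with ξ = (m + √d) / 2.
    module Order-ℤ[½[m+√d]] (d%4≡1 : d ℕ.% 4 ≡ 1) (2∤m : ¬ (+ 2 ℤ.∣ m)) where

      open Residue 1 d%4≡1

      odd : ∃[ a ] m ≡ a + a + + 1
      odd = cases (parity m)
        where
        lem : ∀ a → a + a ≡ a * + 2
        lem = solve-∀
        cases : ∃[ a ] (m ≡ a + a ⊎ m ≡ a + a + + 1) → ∃[ a ] m ≡ a + a + + 1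
        cases (a , inj₁ m≡) = contradiction (Signed.∣⇒∣ᵤ (Signed.divides a (trans m≡ (lem a)))) 2∤m
        cases (a , inj₂ m≡) = a , m≡

      a₀ s₀ : ℤ
      a₀ = proj₁ odd
      s₀ = q - (a₀ * a₀ + a₀)

      -- Both d and the square of the odd number m are 1 modulo 4.
      r≡4s : r ≡ + 4 * s₀
      r≡4s = trans (lem₀ m r) (trans (cong (_- m * m) (trans (sym d≡m²+r) d≡ρ+4q))
          (trans (cong (λ m → + 1 + + 4 * q - m * m) (proj₂ odd)) (lem₁ a₀ q)))
        where
        lem₀ : ∀ m r → r ≡ m * m + r - m * m
        lem₀ = solve-∀
        lem₁ : ∀ a q → + 1 + + 4 * q - (a + a + + 1) * (a + a + + 1) ≡ + 4 * (q - (a * a + a))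
        lem₁ = solve-∀

      m≡ks : m ≡ k * s₀
      m≡ks = ℤ.*-cancelˡ-≡ (+ 4) m (k * s₀) (trans 4m≡kr (trans (cong (k *_) r≡4s) (lem k s₀)))
        where
        lem : ∀ k s → k * (+ 4 * s) ≡ + 4 * (k * s)
        lem = solve-∀

      s≢0 : s₀ ≢ + 0
      s≢0 s≡0 = r≢0 (trans r≡4s (cong (+ 4 *_) s≡0))

      -- The hypotheses bound 4 s, and the claims concern 2 s only. For each sign of s one claim
      -- follows from 0 < m alone, and the other from the bound on that side.
      bounds : ∀ s → s ≢ + 0 → + 4 * s ≤ m → + 0 ≤ m + + 4 * s - + 1 → s + s ≤ m × + 2 - (s + s) ≤ m
      bounds (+ zero)  s≢0 _ _ = contradiction refl s≢0
      bounds (+ suc j) _ 4s≤m _ =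
        ≤-by-diffℤ (lem₁ m (+ suc j)) (ℤ.+-mono-≤ (ℤ.i≤j⇒0≤j-i 4s≤m) (+≤+ ℕ.z≤n)) ,
        ≤-by-diffℤ (lem₂ m (+ j)) (ℤ.+-mono-≤ (ℤ.<⇒≤ 0<m) (+≤+ ℕ.z≤n))
        where
        lem₁ : ∀ m s → m - (s + s) ≡ m - + 4 * s + (s + s)
        lem₁ = solve-∀
        lem₂ : ∀ m j → m - (+ 2 - (+ 1 + j + (+ 1 + j))) ≡ m + (j + j)
        lem₂ = solve-∀
      bounds -[1+ j ] _ _ 0≤m+4s-1 =
        ≤-by-diffℤ (lem₁ m (+ suc j)) (ℤ.+-mono-≤ (ℤ.<⇒≤ 0<m) (+≤+ ℕ.z≤n)) ,
        ≤-by-diffℤ (lem₂ m (+ j)) (ℤ.+-mono-≤ 0≤m+4s-1 (+≤+ ℕ.z≤n))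
        where
        lem₁ : ∀ m s → m - (- s + - s) ≡ m + (s + s)
        lem₁ = solve-∀
        lem₂ : ∀ m j → m - (+ 2 - (- (+ 1 + j) + - (+ 1 + j))) ≡ m + + 4 * - (+ 1 + j) - + 1 + (+ 1 + (j + j))
        lem₂ = solve-∀

      s-bounds : s₀ + s₀ ≤ m × + 2 - (s₀ + s₀) ≤ m
      s-bounds = bounds s₀ s≢0 (subst (_≤ m) r≡4s r≤m) (subst (λ r → + 0 ≤ m + r - + 1) r≡4s 0≤m+r-1)

      g²d≡ : ½ ℚ.* ½ ℚ.* dℚ ≡ ι m ℚ.* ½ ℚ.* (ι m ℚ.* ½) ℚ.+ ι s₀
      g²d≡ = trans (cong (λ x → ½ ℚ.* ½ ℚ.* x) (trans dℚ≡ (cong (λ x → ι m ℚ.* ι m ℚ.+ x) ι-r)))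
          (trans (lem ½ (ι m) (ι s₀)) (cong (λ x → ι m ℚ.* ½ ℚ.* (ι m ℚ.* ½) ℚ.+ x) (ℚ.*-identityˡ (ι s₀))))
        where
        ι-r : ι r ≡ (ι s₀ ℚ.+ ι s₀) ℚ.+ (ι s₀ ℚ.+ ι s₀)
        ι-r = trans (cong ι (trans r≡4s (four s₀))) (trans (ι-+ (s₀ + s₀) (s₀ + s₀)) (cong₂ ℚ._+_ (ι-+ s₀ s₀) (ι-+ s₀ s₀)))
          where
          four : ∀ s → + 4 * s ≡ s + s + (s + s)
          four = solve-∀
        lem : ∀ c M S → c ℚ.* c ℚ.* (M ℚ.* M ℚ.+ (S ℚ.+ S ℚ.+ (S ℚ.+ S))) ≡ M ℚ.* c ℚ.* (M ℚ.* c) ℚ.+ (c ℚ.+ c) ℚ.* (c ℚ.+ c) ℚ.* S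
        lem = Tactic.solve-∀ ℚ-ring

      open Basis d 0<d m s₀ (ι m ℚ.* ½) ½ (1ℚ ℚ.+ 1ℚ) (½+½ (ι m)) g²d≡ refl using (Lattice; ⟪_,_⟫)

      Integral⇒Lattice : ∀ z → Integral z → Lattice z
      Integral⇒Lattice z z-int = cases (parity t) (parity s)
        where
        half : ∃[ t ] ∃[ s ] ∃[ n ] re z ℚ.+ re z ≡ ι t × im z ℚ.+ im z ≡ ι s × t * t ≡ + d * (s * s) + + 4 * n
        half = IntegralClosure.integral⇒half-integers d sf z z-int
        t s n : ℤ
        t = proj₁ half
        s = proj₁ (proj₂ half)
        n = proj₁ (proj₂ (proj₂ half))
        eq : t * t ≡ + d * (s * s) + + 4 * n
        eq = proj₂ (proj₂ (proj₂ (proj₂ (proj₂ half))))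
        substituted : ∀ {t′ s′} → t ≡ t′ → s ≡ s′ → t′ * t′ ≡ + d * (s′ * s′) + + 4 * n
        substituted t≡ s≡ = subst₂ (λ t s → t * t ≡ + d * (s * s) + + 4 * n) t≡ s≡ eq
        -- z = (t - s m) / 2 + s ξ, so `z` is in the lattice as soon as t - s m is even. Since m is
        -- odd, this means that t and s have the same parity.
        from-half : ∀ α → t ≡ α + α + s * m → Lattice z
        from-half α t≡ = α , s , cong₂ _+√_
          (double-injective (trans (proj₁ (proj₂ (proj₂ (proj₂ half)))) (trans (cong ι t≡) (trans (ι-+ (α + α) (s * m))
            (trans (cong₂ ℚ._+_ (ι-+ α α) (trans (ι-* s m) (cong (ι s ℚ.*_) (sym (½+½ (ι m)))))) (lem₁ (ι α) (ι s) (ι m ℚ.* ½)))))))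
          (double-injective (trans (proj₁ (proj₂ (proj₂ (proj₂ (proj₂ half))))) (sym (½+½ (ι s)))))
          where
          lem₁ : ∀ α s h → α ℚ.+ α ℚ.+ s ℚ.* (h ℚ.+ h) ≡ α ℚ.+ s ℚ.* h ℚ.+ (α ℚ.+ s ℚ.* h)
          lem₁ = Tactic.solve-∀ ℚ-ring
        cases : ∃[ a ] (t ≡ a + a ⊎ t ≡ a + a + + 1) → ∃[ b ] (s ≡ b + b ⊎ s ≡ b + b + + 1) → Lattice z
        cases (a , inj₁ t≡) (b , inj₁ s≡) = from-half (a - b * m) (trans t≡ (trans (lem a b m) (cong (λ s → a - b * m + (a - b * m) + s * m) (sym s≡))))
          where
          lem : ∀ a b m → a + a ≡ a - b * m + (a - b * m) + (b + b) * m
          lem = solve-∀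
        cases (a , inj₁ t≡) (b , inj₂ s≡) = ⊥-elim (4∤ 0 (ℕ.s≤s (ℕ.s≤s ℕ.z≤n)) _ (proj₂ (even-odd 1 d%4≡1 a b n (substituted t≡ s≡))))
        cases (a , inj₂ t≡) (b , inj₁ s≡) = ⊥-elim (odd-even a b n (substituted t≡ s≡))
        cases (a , inj₂ t≡) (b , inj₂ s≡) = from-half (a - b * m - a₀) (trans t≡ (trans (lem a b m a₀)
            (trans (cong (λ x → a - b * m - a₀ + (a - b * m - a₀) + ((b + b) * m + x)) (sym (proj₂ odd)))
              (trans (lem₂ (a - b * m - a₀ + (a - b * m - a₀)) b m) (cong (λ s → a - b * m - a₀ + (a - b * m - a₀) + s * m) (sym s≡))))))
          where
          lem : ∀ a b m a₀ → a + a + + 1 ≡ a - b * m - a₀ + (a - b * m - a₀) + ((b + b) * m + (a₀ + a₀ + + 1))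
          lem = solve-∀
          lem₂ : ∀ x b m → x + ((b + b) * m + m) ≡ x + (b + b + + 1) * m
          lem₂ = solve-∀

      two-classes : ¬ UnitReducible → nK-is 2
      two-classes = Forms.¬UnitReducible⇒nK≡2 d 0<d m s₀ k (ι m ℚ.* ½) ½ (1ℚ ℚ.+ 1ℚ) (½+½ (ι m)) g²d≡ refl
        m≡ks s≢0 (proj₁ s-bounds) (proj₂ s-bounds) Integral⇒Lattice

open import Data.Nat.Base as ℕ using (ℕ)
open import Data.Integer.Base using (ℤ; +_; -_; _+_; _*_; _<_; _≤_)
open import Data.Integer.Divisibility using (_∣_)
open import Data.Product.Base using (_×_; _,_)
open import Data.Sum.Base using (_⊎_; inj₁; inj₂)
open import Relation.Binary.PropositionalEquality using (_≡_)
open import Relation.Nullary.Negation.Core using (¬_)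
open import Defs

theorem2 : ∀ (d : ℕ) (m r : ℤ) →
    1 ℕ.< d → SquareFree d →
    + d ≡ m * m + r → + 0 < m → - m < r → r ≤ m → r ∣ + 4 * m →
    ((d ℕ.% 4 ≡ 2 ⊎ d ℕ.% 4 ≡ 3) ⊎ (d ℕ.% 4 ≡ 1 × ¬ (+ 2 ∣ m))) →
    ¬ QuadraticField.UnitReducible d →
    QuadraticField.nK-is d 2
-- In the first two cases the number passed before the residue equation is the `ρ` with
-- `d % 4 = 2 + ρ`.
theorem2 d m r 1<d sf d≡m²+r 0<m -m<r r≤m r∣4m (inj₁ (inj₁ d%4≡2)) =
  RichaudDegert.Order-ℤ[√d].two-classes d 1<d sf m r d≡m²+r 0<m -m<r r≤m r∣4m 0 d%4≡2 (ℕ.s≤s (ℕ.s≤s (ℕ.s≤s ℕ.z≤n)))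
theorem2 d m r 1<d sf d≡m²+r 0<m -m<r r≤m r∣4m (inj₁ (inj₂ d%4≡3)) =
  RichaudDegert.Order-ℤ[√d].two-classes d 1<d sf m r d≡m²+r 0<m -m<r r≤m r∣4m 1 d%4≡3 (ℕ.s≤s (ℕ.s≤s (ℕ.s≤s (ℕ.s≤s ℕ.z≤n))))
theorem2 d m r 1<d sf d≡m²+r 0<m -m<r r≤m r∣4m (inj₂ (d%4≡1 , 2∤m)) =
  RichaudDegert.Order-ℤ[½[m+√d]].two-classes d 1<d sf m r d≡m²+r 0<m -m<r r≤m r∣4m d%4≡1 2∤m
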